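{- Let $p(n)$ denote the probability that a partition of $n$ chosen uniformly at random among all partitions of $n$ is graphical. Then there exists a constant $C>0$ such that for all $n \geq 1$, $$p(n) \leq C n^{ -0.003297210314}.$$
   Context: A partition $\lambda = (\lambda_1 \geq \lambda_2 \geq \cdots)$ of a positive integer $n$ is called graphical if it can be realized as the (non-increasingly ordered) degree sequence of a simple graph (no loops, no multiple edges), i.e. there is a simple graph whose vertices of positive degree have degrees exactly the parts $\lambda_1,\lambda_2,\dots$. -}

module Defs where

open import Data.Nat using (ℕ; zero; suc; _+_; _*_; _^_; _≤_; _<_; _≥_)
open import Data.Bool using (Bool; true; false; if_then_else_)
open import Data.Fin using (Fin)
open import Data.List using (List; []; _∷_; length; lookup; allFin; map)
open import Data.Nat.ListAction using (sum)
open import Data.List.Relation.Unary.All using (All)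
open import Data.List.Relation.Unary.Linked using (Linked)
open import Data.List.Relation.Unary.Unique.Propositional using (Unique)
open import Data.List.Membership.Propositional using (_∈_)
open import Data.Product using (Σ; _×_)
open import Relation.Binary.PropositionalEquality using (_≡_)
open import Function.Bundles using (_⇔_)

IsPartition : ℕ → List ℕ → Set
IsPartition n λs = Linked _≥_ λs × All (λ x → 0 < x) λs × sum λs ≡ n

record SimpleGraph (k : ℕ) : Set where
  field
    adj     : Fin k → Fin k → Bool
    symm    : ∀ i j → adj i j ≡ adj j i
    irrefl  : ∀ i → adj i i ≡ false

degree : ∀ {k} → SimpleGraph k → Fin k → ℕ
degree {k} G i = sum (map (λ j → if SimpleGraph.adj G i j then 1 else 0) (allFin k))

-- λ is graphical: some simple graph whose vertices (all of positive degree,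
-- since parts are positive; isolated vertices are irrelevant) have degrees
-- exactly the parts of λ, vertex i having degree λ_i.
Graphical : List ℕ → Set
Graphical λs = Σ (SimpleGraph (length λs)) λ G → ∀ i → degree G i ≡ lookup λs i

Enumerates : (List ℕ → Set) → List (List ℕ) → Set
Enumerates P L = Unique L × (∀ x → (x ∈ L) ⇔ P x)

expNum : ℕ
expNum = 3297210314

expDen : ℕ
expDen = 1000000000000

{-# OPTIONS --safe #-}
module Submission where

-- Write d for the side of the Durfee square of a partition, and for j ≤ d let a_j be the number of
-- columns of length exactly j to the right of the square and b_j the number of parts equal to j below
-- it, so that n = d² + ∑ j (a_j + b_j). The Erdős–Gallai inequality for the k largest degrees,
-- k ≤ d, reads D_k = ∑_j min(j , k) (b_j - a_j) ≥ k. Exchanging a_j and b_j preserves n, so given the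
-- |b_j - a_j| the signs of the summands are independent and uniform.
--
-- We test only k = k_t with k_{t+1} = 2¹⁰⁰ k_t. Group the indices j in blocks around the k_t. In D_{k_t}
-- the contribution of the own block is spread out on a scale √k_t √n (Littlewood–Offord), while the
-- other blocks are smaller by powers of 2⁵⁰; hence the tests are nearly independent, each failing with
-- probability close to 1/2. A block that is too large ruins other tests, which is paid for with a factor
-- 16 for each ruined test: on survivors the product over the blocks of (16 or 1) · 16^{ruined tests} is
-- at least 16^{tests}, and it has a small mean by second moments. So a fraction at most 6 (3/5)^T of the
-- partitions of n survives T tests, where T ≈ log₂ n / 216.
--
-- This requires that a_j + b_j is not too large on average and that |b_j - a_j| is of order √n / j for
-- enough j. Both follow from p(n - D) ≤ p(n) / 2 for D of order √n (a partition has at most √(2n)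
-- distinct parts) and p(n) ≤ 128 p(n - B) for B of order √n (Euler's recurrence).

open import Defs
open import Data.Nat using (ℕ; zero; suc; _+_; _*_; _^_; _∸_; _⊔_; _⊓_; _≤_; _<_; _≥_; z≤n; s≤s; _≤?_; _<?_; NonZero; >-nonZero)
import Data.Nat as ℕ
open import Data.Nat.Properties
open import Data.Nat.Tactic.RingSolver using (solve-∀)
open import Data.Nat.ListAction using (sum)
open import Data.Nat.ListAction.Properties using (sum-++)
open import Data.Integer using (ℤ; -[1+_]; ∣_∣)
import Data.Integer as ℤ
import Data.Integer.Properties as ℤ
import Data.Integer.Tactic.RingSolver as ℤSolver
open import Data.Bool using (Bool; true; false; if_then_else_)
open import Data.Fin using (Fin)
import Data.Fin as Fin
open import Data.List using (List; applyUpTo; take; drop; []; _∷_; _++_; length; map; lookup; allFin; tabulate; upTo; filter; replicate; cartesianProductWith; concat)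
open import Data.List.Properties using (map-tabulate; length-take; length-drop; take++drop≡id; ++-identityʳ; length-++; length-map; length-replicate; ∷-injective; ++-assoc)
open import Data.List.Membership.Propositional using (_∈_)
open import Data.List.Membership.Propositional.Properties
open import Data.List.Relation.Unary.Any using (here; there)
open import Data.List.Relation.Unary.All using (All; []; _∷_)
import Data.List.Relation.Unary.All as All
open import Data.List.Relation.Unary.Linked using (Linked; []; [-]; _∷_)
open import Data.List.Relation.Unary.AllPairs using ([]; _∷_)
open import Data.List.Relation.Unary.Unique.Propositional using (Unique)
import Data.List.Relation.Unary.Unique.Propositional.Properties as Unique
open import Data.Product using (Σ; ∃; _×_; _,_; proj₁; proj₂)
open import Data.Sum using (_⊎_; inj₁; inj₂)
open import Data.Unit using (⊤; tt)
open import Function using (_∘_; id)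
open import Function.Bundles using (Equivalence)
open import Relation.Nullary using (¬_; Dec; yes; no; contradiction)
open import Relation.Nullary.Decidable using (_×-dec_; _⊎-dec_; ¬?)
open import Relation.Binary.PropositionalEquality using (_≡_; _≢_; refl; sym; trans; cong; cong₂; subst; subst₂; module ≡-Reasoning)
open import Relation.Binary.Definitions using (tri<; tri≈; tri>)

-- The entries a_j and b_j of a uniform partition are dependent, and no asymptotic formula for p(n)
-- is used. Every estimate is a count relative to p(n): to demand t copies of a part j is to delete
-- them, which leaves the partitions of n - j t, and the bounds on ratios of p turn this into
-- moments. Only the signs of b_j - a_j are independent, so the signs are averaged out first, with
-- |b_j - a_j| fixed, and the squares that remain are averaged over configurations.
--
-- Upper bounds on the a_j lower the total; lower bounds on |b_j - a_j| need a larger total to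
-- compare with. Hence everything is counted below N₀ = n + y₀, and f y is the number of partitions
-- of N₀ - y, so that f y₀ = p(n).
--
-- A test sits at the geometric middle of its block, a factor m = 2⁵⁰ from both ends. The second
-- moment of the noise over its squared threshold is a constant times 1 / m, and the constant
-- exceeds 2³⁷; this fixes the size of m. Each factor 2⁴¹⁰⁰ of n holds 19 tests, which gives the
-- exponent (19 / 4100) log₂ (5/3) > 0.0034.

≤-by : ∀ {a b} c → b ≡ a + c → a ≤ b
≤-by {a} c refl = m≤m+n a c

-- Indicators and finite sums.

𝟙 : ∀ {p} {P : Set p} → Dec P → ℕ
𝟙 (yes _) = 1
𝟙 (no  _) = 0

𝟙-mono : ∀ {p q} {P : Set p} {Q : Set q} (d : Dec P) (e : Dec Q) → (P → Q) → 𝟙 d ≤ 𝟙 e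
𝟙-mono (yes p) (yes q) f = ≤-refl
𝟙-mono (yes p) (no ¬q) f = contradiction (f p) ¬q
𝟙-mono (no ¬p) e       f = z≤n

𝟙-cong : ∀ {p q} {P : Set p} {Q : Set q} (d : Dec P) (e : Dec Q) → (P → Q) → (Q → P) → 𝟙 d ≡ 𝟙 e
𝟙-cong d e f g = ≤-antisym (𝟙-mono d e f) (𝟙-mono e d g)

module _ {p} {P : Set p} where

  𝟙≤1 : (d : Dec P) → 𝟙 d ≤ 1
  𝟙≤1 (yes _) = ≤-refl
  𝟙≤1 (no  _) = z≤n

  𝟙-yes : (d : Dec P) → P → 𝟙 d ≡ 1
  𝟙-yes (yes _) _ = refl
  𝟙-yes (no ¬p) p = contradiction p ¬p

  𝟙-no : (d : Dec P) → ¬ P → 𝟙 d ≡ 0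
  𝟙-no (yes p) ¬p = contradiction p ¬p
  𝟙-no (no _)  _  = refl

  𝟙*≤ : (d : Dec P) (x : ℕ) → 𝟙 d * x ≤ x
  𝟙*≤ d x = ≤-trans (*-monoˡ-≤ x (𝟙≤1 d)) (≤-reflexive (*-identityˡ x))

-- The decision stays an argument, so that `choose-yes` and `choose-no` can resolve the case from
-- outside, without a `with`.
choose : ∀ {p} {P : Set p} → Dec P → ℕ → ℕ → ℕ
choose (yes _) x y = x
choose (no _)  x y = y

choose-yes : ∀ {p} {P : Set p} (d : Dec P) {x y : ℕ} → P → choose d x y ≡ x
choose-yes (yes _) _ = refl
choose-yes (no ¬p) p = contradiction p ¬p

choose-no : ∀ {p} {P : Set p} (d : Dec P) {x y : ℕ} → ¬ P → choose d x y ≡ y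
choose-no (yes p) ¬p = contradiction p ¬p
choose-no (no _)  _  = refl

∑ : ℕ → (ℕ → ℕ) → ℕ
∑ zero    f = 0
∑ (suc n) f = f 0 + ∑ n (λ i → f (suc i))

∑-mono : ∀ n {f g : ℕ → ℕ} → (∀ i → i < n → f i ≤ g i) → ∑ n f ≤ ∑ n g
∑-mono zero    h = z≤n
∑-mono (suc n) h = +-mono-≤ (h 0 (s≤s z≤n)) (∑-mono n (λ i i<n → h (suc i) (s≤s i<n)))

∑-cong : ∀ n {f g : ℕ → ℕ} → (∀ i → i < n → f i ≡ g i) → ∑ n f ≡ ∑ n g
∑-cong zero    h = refl
∑-cong (suc n) h = cong₂ _+_ (h 0 (s≤s z≤n)) (∑-cong n (λ i i<n → h (suc i) (s≤s i<n)))

+-interchange : ∀ a b c d → (a + b) + (c + d) ≡ (a + c) + (b + d)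
+-interchange = solve-∀

∑-+ : ∀ n (f g : ℕ → ℕ) → ∑ n (λ i → f i + g i) ≡ ∑ n f + ∑ n g
∑-+ zero    f g = refl
∑-+ (suc n) f g = trans (cong ((f 0 + g 0) +_) (∑-+ n (f ∘ suc) (g ∘ suc)))
                        (+-interchange (f 0) (g 0) _ _)

∑-*ˡ : ∀ n c (f : ℕ → ℕ) → ∑ n (λ i → c * f i) ≡ c * ∑ n f
∑-*ˡ zero    c f = sym (*-zeroʳ c)
∑-*ˡ (suc n) c f = trans (cong (c * f 0 +_) (∑-*ˡ n c (f ∘ suc))) (sym (*-distribˡ-+ c (f 0) _))

∑-*ʳ : ∀ n c (f : ℕ → ℕ) → ∑ n (λ i → f i * c) ≡ ∑ n f * c
∑-*ʳ zero    c f = refl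
∑-*ʳ (suc n) c f = trans (cong (f 0 * c +_) (∑-*ʳ n c (f ∘ suc))) (sym (*-distribʳ-+ c (f 0) _))

∑-const : ∀ n c → ∑ n (λ _ → c) ≡ n * c
∑-const zero    c = refl
∑-const (suc n) c = cong (c +_) (∑-const n c)

∑-zero : ∀ n {f : ℕ → ℕ} → (∀ i → i < n → f i ≡ 0) → ∑ n f ≡ 0
∑-zero n h = trans (∑-cong n h) (trans (∑-const n 0) (*-zeroʳ n))

∑-last : ∀ n (f : ℕ → ℕ) → ∑ (suc n) f ≡ ∑ n f + f n
∑-last zero    f = +-comm (f 0) 0
∑-last (suc n) f = trans (cong (f 0 +_) (∑-last n (f ∘ suc))) (sym (+-assoc (f 0) _ _))

∑-split : ∀ m n (f : ℕ → ℕ) → ∑ (m + n) f ≡ ∑ m f + ∑ n (λ i → f (m + i))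
∑-split zero    n f = refl
∑-split (suc m) n f = trans (cong (f 0 +_) (∑-split m n (f ∘ suc))) (sym (+-assoc (f 0) _ _))

∑-len : ∀ {m n} (f : ℕ → ℕ) → m ≤ n → ∑ m f ≤ ∑ n f
∑-len f z≤n     = z≤n
∑-len f (s≤s p) = +-monoʳ-≤ (f 0) (∑-len (f ∘ suc) p)

∑-swap : ∀ m n (f : ℕ → ℕ → ℕ) → ∑ m (λ i → ∑ n (λ j → f i j)) ≡ ∑ n (λ j → ∑ m (λ i → f i j))
∑-swap zero    n f = sym (∑-zero n (λ _ _ → refl))
∑-swap (suc m) n f = trans (cong (∑ n (f 0) +_) (∑-swap m n (f ∘ suc))) (sym (∑-+ n (f 0) _))

∑-term : ∀ n (f : ℕ → ℕ) {i} → i < n → f i ≤ ∑ n f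
∑-term (suc n) f {zero}  _         = m≤m+n _ _
∑-term (suc n) f {suc i} (s≤s i<n) = ≤-trans (∑-term n (f ∘ suc) i<n) (m≤n+m _ _)

-- Sums over configurations.

Cfg : Set
Cfg = List (ℕ × ℕ)

-- Entry i of a configuration holds (a_j , b_j) for j = i + 1. The cutoff K keeps the sums finite:
-- it is later N₀ + 1, which exceeds every entry of a configuration of total at most N₀.
sumP : ℕ → ℕ → (Cfg → ℕ) → ℕ
sumP K zero    F = F []
sumP K (suc d) F = ∑ K λ a → ∑ K λ b → sumP K d λ c → F ((a , b) ∷ c)

module _ (K : ℕ) where

  sumP-mono : ∀ d {F G : Cfg → ℕ} → (∀ c → length c ≡ d → F c ≤ G c) → sumP K d F ≤ sumP K d G
  sumP-mono zero    h = h [] refl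
  sumP-mono (suc d) h = ∑-mono K λ a _ → ∑-mono K λ b _ →
    sumP-mono d λ c e → h ((a , b) ∷ c) (cong suc e)

  sumP-cong : ∀ d {F G : Cfg → ℕ} → (∀ c → length c ≡ d → F c ≡ G c) → sumP K d F ≡ sumP K d G
  sumP-cong d h = ≤-antisym (sumP-mono d λ c e → ≤-reflexive (h c e))
                            (sumP-mono d λ c e → ≤-reflexive (sym (h c e)))

  sumP-+ : ∀ d (F G : Cfg → ℕ) → sumP K d (λ c → F c + G c) ≡ sumP K d F + sumP K d G
  sumP-+ zero    F G = refl
  sumP-+ (suc d) F G = trans
    (∑-cong K λ a _ → trans (∑-cong K λ b _ → sumP-+ d (F ∘ ((a , b) ∷_)) (G ∘ ((a , b) ∷_))) (∑-+ K _ _))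
    (∑-+ K _ _)

  sumP-*ˡ : ∀ d k (F : Cfg → ℕ) → sumP K d (λ c → k * F c) ≡ k * sumP K d F
  sumP-*ˡ zero    k F = refl
  sumP-*ˡ (suc d) k F = trans
    (∑-cong K λ a _ → trans (∑-cong K λ b _ → sumP-*ˡ d k (F ∘ ((a , b) ∷_))) (∑-*ˡ K k _))
    (∑-*ˡ K k _)

  sumP-∑ : ∀ d n (F : ℕ → Cfg → ℕ) → sumP K d (λ c → ∑ n λ i → F i c) ≡ ∑ n (λ i → sumP K d (F i))
  sumP-∑ d zero    F = trans (sumP-cong d {G = λ c → 0 * 0} λ _ _ → refl) (sumP-*ˡ d 0 (λ _ → 0))
  sumP-∑ d (suc n) F = trans (sumP-+ d _ _) (cong (sumP K d (F 0) +_) (sumP-∑ d n (F ∘ suc)))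

  sumP-const : ∀ d k → sumP K d (λ _ → k) ≡ (K * K) ^ d * k
  sumP-const zero    k = sym (+-identityʳ k)
  sumP-const (suc d) k = begin
    ∑ K (λ _ → ∑ K λ _ → sumP K d λ _ → k)
      ≡⟨ ∑-const K _ ⟩
    K * ∑ K (λ _ → sumP K d λ _ → k)
      ≡⟨ cong (K *_) (∑-const K _) ⟩
    K * (K * sumP K d λ _ → k)
      ≡⟨ cong (λ z → K * (K * z)) (sumP-const d k) ⟩
    K * (K * ((K * K) ^ d * k))
      ≡⟨ sym (*-assoc K K _) ⟩
    (K * K) * ((K * K) ^ d * k)
      ≡⟨ sym (*-assoc (K * K) ((K * K) ^ d) k) ⟩
    (K * K) ^ suc d * k ∎
    where open ≡-Reasoning

-- Measures of quadratic growth against a halving function.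

record Positive (Λ : (ℕ → ℕ) → ℕ) : Set where
  field
    mono  : ∀ {φ ψ : ℕ → ℕ} → (∀ y → φ y ≤ ψ y) → Λ φ ≤ Λ ψ
    plus  : ∀ (φ ψ : ℕ → ℕ) → Λ (λ y → φ y + ψ y) ≡ Λ φ + Λ ψ
    scale : ∀ k (φ : ℕ → ℕ) → Λ (λ y → k * φ y) ≡ k * Λ φ

-- Think of Λ as a measure with mass at most x² on [0 , x], and of g as a tail that halves over each
-- distance D. Then the part of Λ g beyond x is at most a quadratic polynomial times g x. This
-- serves twice with g z = f (y + z): in Euler's recurrence, and at x = 0 for second moments.
module Halving
  (Λ : (ℕ → ℕ) → ℕ) (pos : Positive Λ)
  (S≤ : ∀ x → Λ (λ y → 𝟙 (y ≤? x)) ≤ x * x)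
  (g : ℕ → ℕ) (anti : ∀ {x y} → x ≤ y → g y ≤ g x)
  (D : ℕ) (D≥1 : 1 ≤ D) (half : ∀ x → 2 * g (x + D) ≤ g x)
  (Z : ℕ) (g-zero : ∀ x → Z ≤ x → g x ≡ 0)
  where

  open Positive pos

  V : ℕ → ℕ
  V x = Λ (λ y → g (y ⊔ x))

  -- The solution of (x + D)² + q (x + D) = 2 q x, which makes the downward induction close.
  q : ℕ → ℕ
  q x = x * x + 4 * (D * x) + 6 * (D * D)

  private
    S : ℕ → ℕ
    S x = Λ (λ y → 𝟙 (y ≤? x))

    -- `V x` and `V (x + D)` differ only by the mass on [0 , x + D], where the first integrand is at
    -- most g x and the second equals g (x + D). The subtracted term stands on the left to remain in
    -- ℕ.
    recursion : ∀ x → V x + g (x + D) * S (x + D) ≤ V (x + D) + g x * S (x + D)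
    recursion x = begin
      V x + g (x + D) * S (x + D)
        ≡⟨ cong (V x +_) (sym (scale (g (x + D)) _)) ⟩
      V x + Λ (λ y → g (x + D) * 𝟙 (y ≤? (x + D)))
        ≡⟨ sym (plus _ _) ⟩
      Λ (λ y → g (y ⊔ x) + g (x + D) * 𝟙 (y ≤? (x + D)))
        ≤⟨ mono pointwise ⟩
      Λ (λ y → g (y ⊔ (x + D)) + g x * 𝟙 (y ≤? (x + D)))
        ≡⟨ plus _ _ ⟩
      V (x + D) + Λ (λ y → g x * 𝟙 (y ≤? (x + D)))
        ≡⟨ cong (V (x + D) +_) (scale (g x) _) ⟩
      V (x + D) + g x * S (x + D) ∎
      where
      open ≤-Reasoning
      pointwise : ∀ y → g (y ⊔ x) + g (x + D) * 𝟙 (y ≤? (x + D))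
                      ≤ g (y ⊔ (x + D)) + g x * 𝟙 (y ≤? (x + D))
      pointwise y with y ≤? (x + D)
      ... | yes y≤ rewrite m≤n⇒m⊔n≡n y≤ | *-identityʳ (g (x + D)) | *-identityʳ (g x)
            = ≤-trans (+-monoˡ-≤ (g (x + D)) (anti (m≤n⊔m y x))) (≤-reflexive (+-comm (g x) _))
      ... | no y≰ rewrite *-zeroʳ (g (x + D)) | *-zeroʳ (g x)
                        | m≥n⇒m⊔n≡m (<⇒≤ (≰⇒> y≰))
                        | m≥n⇒m⊔n≡m (≤-trans (m≤m+n x D) (<⇒≤ (≰⇒> y≰))) = ≤-refl

    -- Here s is the mass of [0 , x + D] and s + e = q (x + D). Cancelling g₂ s leaves v ≤ e g₂ + s
    -- g₁; with g₂ ≤ g₁ / 2 the right side is at most (e + 2 s) g₁ / 2 ≤ c g₁.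
    closing : ∀ v s e c g₁ g₂ → v + g₂ * s ≤ (s + e) * g₂ + g₁ * s → 2 * g₂ ≤ g₁ →
              (s + e) + s ≤ 2 * c → v ≤ c * g₁
    closing v s e c g₁ g₂ h half′ hc = *-cancelˡ-≤ 2 (+-cancelʳ-≤ (2 * (g₂ * s)) _ _ (begin
      2 * v + 2 * (g₂ * s)                    ≡⟨ sym (*-distribˡ-+ 2 v _) ⟩
      2 * (v + g₂ * s)                        ≤⟨ *-monoʳ-≤ 2 h ⟩
      2 * ((s + e) * g₂ + g₁ * s)             ≡⟨ r₁ s e g₁ g₂ ⟩
      (e * (2 * g₂) + 2 * (s * g₁)) + 2 * (g₂ * s)
        ≤⟨ +-monoˡ-≤ _ (+-monoˡ-≤ _ (*-monoʳ-≤ e half′)) ⟩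
      (e * g₁ + 2 * (s * g₁)) + 2 * (g₂ * s)  ≡⟨ r₂ s e g₁ g₂ ⟩
      ((s + e) + s) * g₁ + 2 * (g₂ * s)       ≤⟨ +-monoˡ-≤ _ (*-monoˡ-≤ g₁ hc) ⟩
      2 * c * g₁ + 2 * (g₂ * s)               ≡⟨ cong (_+ 2 * (g₂ * s)) (*-assoc 2 c g₁) ⟩
      2 * (c * g₁) + 2 * (g₂ * s)             ∎))
      where
      open ≤-Reasoning
      r₁ : ∀ s e g₁ g₂ → 2 * ((s + e) * g₂ + g₁ * s) ≡ (e * (2 * g₂) + 2 * (s * g₁)) + 2 * (g₂ * s)
      r₁ = solve-∀
      r₂ : ∀ s e g₁ g₂ → (e * g₁ + 2 * (s * g₁)) + 2 * (g₂ * s) ≡ ((s + e) + s) * g₁ + 2 * (g₂ * s)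
      r₂ = solve-∀

    -- Downward induction from Z, beyond which g vanishes; k steps of length D lead from x past Z.
    V-bound′ : ∀ k x → Z ≤ x + k * D → V x ≤ q x * g x
    V-bound′ zero x Z≤ = ≤-trans (mono {ψ = λ y → 0 * g y} λ y →
        ≤-trans (anti (m≤n⊔m y x)) (≤-reflexive (g-zero x (subst (Z ≤_) (+-identityʳ x) Z≤))))
      (≤-trans (≤-reflexive (scale 0 g)) z≤n)
    V-bound′ (suc k) x Z≤ = closing (V x) s e (q x) (g x) (g (x + D))
      (≤-trans (recursion x) (+-monoˡ-≤ _ (≤-trans (V-bound′ k (x + D)
        (subst (Z ≤_) (sym (+-assoc x D (k * D))) Z≤)) (≤-reflexive (cong (_* g (x + D)) q≡)))))
      (half x)
      (begin
        s + e + s                                ≡⟨ cong (_+ s) (sym q≡) ⟩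
        q (x + D) + s                            ≤⟨ +-monoʳ-≤ _ (S≤ (x + D)) ⟩
        q (x + D) + (x + D) * (x + D)            ≡⟨ quad x D ⟩
        2 * q x                                  ∎)
      where
      open ≤-Reasoning
      s e : ℕ
      s = S (x + D)
      e = q (x + D) ∸ s
      q≡ : q (x + D) ≡ s + e
      q≡ = sym (m+[n∸m]≡n (≤-trans (S≤ (x + D))
             (≤-trans (m≤m+n _ (4 * (D * (x + D)))) (m≤m+n _ (6 * (D * D))))))
      quad : ∀ x D → (x + D) * (x + D) + 4 * (D * (x + D)) + 6 * (D * D) + (x + D) * (x + D)
                   ≡ 2 * (x * x + 4 * (D * x) + 6 * (D * D))
      quad = solve-∀

  V-bound : ∀ x → V x ≤ q x * g x
  V-bound x = V-bound′ Z x (≤-trans (≤-trans (≤-reflexive (sym (*-identityʳ Z))) (*-monoʳ-≤ Z D≥1))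
                                    (m≤n+m (Z * D) x))

-- Sums with random signs and the Littlewood-Offord problem.

sumσ : List ℤ → ℤ → (ℤ → ℕ) → ℕ
sumσ []       y φ = φ y
sumσ (v ∷ vs) y φ = sumσ vs (y ℤ.+ v) φ + sumσ vs (y ℤ.- v) φ

sumσ-mono : ∀ vs y {φ ψ : ℤ → ℕ} → (∀ y → φ y ≤ ψ y) → sumσ vs y φ ≤ sumσ vs y ψ
sumσ-mono []       y h = h y
sumσ-mono (v ∷ vs) y h = +-mono-≤ (sumσ-mono vs _ h) (sumσ-mono vs _ h)

sumσ-cong : ∀ vs y {φ ψ : ℤ → ℕ} → (∀ y → φ y ≡ ψ y) → sumσ vs y φ ≡ sumσ vs y ψ
sumσ-cong []       y h = h y
sumσ-cong (v ∷ vs) y h = cong₂ _+_ (sumσ-cong vs _ h) (sumσ-cong vs _ h)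

sumσ-+ : ∀ vs y (φ ψ : ℤ → ℕ) → sumσ vs y (λ z → φ z + ψ z) ≡ sumσ vs y φ + sumσ vs y ψ
sumσ-+ []       y φ ψ = refl
sumσ-+ (v ∷ vs) y φ ψ = trans (cong₂ _+_ (sumσ-+ vs _ φ ψ) (sumσ-+ vs _ φ ψ))
  (+-interchange (sumσ vs (y ℤ.+ v) φ) (sumσ vs (y ℤ.+ v) ψ) _ _)

double : ∀ n x → n * x + n * x ≡ 2 * n * x
double = solve-∀

sumσ-const : ∀ vs y c → sumσ vs y (λ _ → c) ≡ 2 ^ length vs * c
sumσ-const []       y c = sym (+-identityʳ c)
sumσ-const (v ∷ vs) y c = trans (cong₂ _+_ (sumσ-const vs _ c) (sumσ-const vs _ c))
                                (double (2 ^ length vs) c)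

sumσ-shift : ∀ vs y t (φ : ℤ → ℕ) → sumσ vs (y ℤ.+ t) φ ≡ sumσ vs y (λ z → φ (z ℤ.+ t))
sumσ-shift []       y t φ = refl
sumσ-shift (v ∷ vs) y t φ = cong₂ _+_
  (trans (cong (λ z → sumσ vs z φ) (comm y t v)) (sumσ-shift vs (y ℤ.+ v) t φ))
  (trans (cong (λ z → sumσ vs z φ) (comm y t (ℤ.- v))) (sumσ-shift vs (y ℤ.- v) t φ))
  where
  comm : ∀ y t v → y ℤ.+ t ℤ.+ v ≡ y ℤ.+ v ℤ.+ t
  comm = ℤSolver.solve-∀

sumσ-neg : ∀ vs y (φ : ℤ → ℕ) → sumσ vs (ℤ.- y) φ ≡ sumσ vs y (λ z → φ (ℤ.- z))
sumσ-neg []       y φ = refl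
sumσ-neg (v ∷ vs) y φ = trans (+-comm (sumσ vs (ℤ.- y ℤ.+ v) φ) _) (cong₂ _+_
  (trans (cong (λ z → sumσ vs z φ) (e₁ y v)) (sumσ-neg vs (y ℤ.+ v) φ))
  (trans (cong (λ z → sumσ vs z φ) (e₂ y v)) (sumσ-neg vs (y ℤ.- v) φ)))
  where
  e₁ : ∀ y v → ℤ.- y ℤ.- v ≡ ℤ.- (y ℤ.+ v)
  e₁ = ℤSolver.solve-∀
  e₂ : ∀ y v → ℤ.- y ℤ.+ v ≡ ℤ.- (y ℤ.- v)
  e₂ = ℤSolver.solve-∀

-- The two signs may be exchanged, so every step may be taken nonnegative; then the interval that
-- changes sides in `littlewood-offord` is always the topmost one.
sumσ-abs : ∀ v vs y φ → sumσ (v ∷ vs) y φ ≡ sumσ vs (y ℤ.- ℤ.+ ∣ v ∣) φ + sumσ vs (y ℤ.+ ℤ.+ ∣ v ∣) φ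
sumσ-abs (ℤ.+ n)  vs y φ = +-comm (sumσ vs (y ℤ.+ ℤ.+ n) φ) _
sumσ-abs -[1+ n ] vs y φ = refl

-- The maximal number of sign vectors of length r whose sum falls in a union of k disjoint
-- half-open intervals of length two.
B : ℕ → ℕ → ℕ
B zero    zero    = 0
B zero    (suc k) = 1
B (suc r) zero    = 0
B (suc r) (suc k) = B r (suc (suc k)) + B r k

B≤2^ : ∀ r k → B r k ≤ 2 ^ r
B≤2^ zero    zero    = z≤n
B≤2^ zero    (suc k) = ≤-refl
B≤2^ (suc r) zero    = z≤n
B≤2^ (suc r) (suc k) = ≤-trans (+-mono-≤ (B≤2^ r (suc (suc k))) (B≤2^ r k))
                               (≤-reflexive (cong (2 ^ r +_) (sym (+-identityʳ (2 ^ r)))))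

-- Optional stopping for the simple walk on (0, A): k (A - k) is the mean exit time
-- and k / A the probability to leave at A.
B-bound : ∀ A r k k′ → k + k′ ≡ A → A * r * B r k ≤ 2 ^ r * (k * (A * k′ + r))
B-bound A zero    k       k′       e = ≤-trans (≤-reflexive (cong (_* B 0 k) (*-zeroʳ A))) z≤n
B-bound A (suc r) zero    k′       e = ≤-trans (≤-reflexive (*-zeroʳ (A * suc r))) z≤n
B-bound A (suc r) (suc k) zero     e = begin
  A * suc r * B (suc r) (suc k)  ≤⟨ *-monoʳ-≤ (A * suc r) (B≤2^ (suc r) (suc k)) ⟩
  A * suc r * 2 ^ suc r          ≡⟨ r₀ A r (2 ^ suc r) ⟩
  2 ^ suc r * (A * (A * 0 + suc r))
    ≡⟨ cong (λ z → 2 ^ suc r * (z * (A * 0 + suc r))) (trans (sym e) (+-identityʳ (suc k))) ⟩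
  2 ^ suc r * (suc k * (A * 0 + suc r)) ∎
  where
  open ≤-Reasoning
  r₀ : ∀ A r p → A * suc r * p ≡ p * (A * (A * 0 + suc r))
  r₀ = solve-∀
B-bound A (suc r) (suc k) (suc k′) e = begin
  A * suc r * (b₁ + b₂)
    ≡⟨ r₀ A r b₁ b₂ ⟩
  (A * r * b₁ + A * r * b₂) + A * (b₁ + b₂)
    ≤⟨ +-mono-≤ (+-mono-≤ (B-bound A r (suc (suc k)) k′ (trans (sym (+-suc (suc k) k′)) e))
                          (B-bound A r k (suc (suc k′)) (trans (+-suc k (suc k′)) e)))
                (*-monoʳ-≤ A (B≤2^ (suc r) (suc k))) ⟩
  (2 ^ r * (suc (suc k) * (A * k′ + r)) + 2 ^ r * (k * (A * suc (suc k′) + r))) + A * (2 * 2 ^ r)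
    ≤⟨ ≤-by (2 * 2 ^ r * suc k) (r₁ A r k k′ (2 ^ r)) ⟩
  2 * 2 ^ r * (suc k * (A * suc k′ + suc r)) ∎
  where
  open ≤-Reasoning
  b₁ b₂ : ℕ
  b₁ = B r (suc (suc k))
  b₂ = B r k
  r₀ : ∀ A r b₁ b₂ → A * suc r * (b₁ + b₂) ≡ (A * r * b₁ + A * r * b₂) + A * (b₁ + b₂)
  r₀ = solve-∀
  r₁ : ∀ A r k k′ p → 2 * p * (suc k * (A * suc k′ + suc r))
     ≡ ((p * (suc (suc k) * (A * k′ + r)) + p * (k * (A * suc (suc k′) + r))) + A * (2 * p)) + 2 * p * suc k
  r₁ = solve-∀

module LittlewoodOfford (w : ℕ) where

  2w : ℤ
  2w = ℤ.+ (2 * w)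

  hit : ℤ → ℤ → ℕ
  hit x y = 𝟙 ((x ℤ.≤? y) ×-dec (y ℤ.<? x ℤ.+ 2w))

  hits : List ℤ → ℤ → ℕ
  hits []       y = 0
  hits (x ∷ xs) y = hit x y + hits xs y

  translate : ℤ → List ℤ → List ℤ
  translate t = map (ℤ._+ t)

  Sep : List ℤ → Set
  Sep = Linked (λ x x′ → x′ ℤ.+ 2w ℤ.≤ x)

  big : List ℤ → ℕ
  big []       = 0
  big (v ∷ vs) = 𝟙 (w ≤? ∣ v ∣) + big vs

  private
    cancel : ∀ x t → x ℤ.+ t ℤ.- t ≡ x
    cancel = ℤSolver.solve-∀
    cancel′ : ∀ x t → x ℤ.- t ℤ.+ t ≡ x
    cancel′ = ℤSolver.solve-∀
    swap₁ : ∀ x t s → x ℤ.+ t ℤ.+ s ≡ x ℤ.+ s ℤ.+ t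
    swap₁ = ℤSolver.solve-∀
    swap₂ : ∀ x t s → x ℤ.- t ℤ.+ s ≡ x ℤ.+ s ℤ.- t
    swap₂ = ℤSolver.solve-∀

  hit-shift : ∀ x y t → hit x (y ℤ.+ t) ≡ hit (x ℤ.- t) y
  hit-shift x y t = 𝟙-cong ((x ℤ.≤? y ℤ.+ t) ×-dec (y ℤ.+ t ℤ.<? x ℤ.+ 2w))
                           ((x ℤ.- t ℤ.≤? y) ×-dec (y ℤ.<? x ℤ.- t ℤ.+ 2w))
    (λ (p , q) → subst (x ℤ.- t ℤ.≤_) (cancel y t) (ℤ.+-monoˡ-≤ (ℤ.- t) p)
               , subst₂ ℤ._<_ (cancel y t) (sym (swap₂ x t 2w)) (ℤ.+-monoˡ-< (ℤ.- t) q))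
    (λ (p , q) → subst (ℤ._≤ y ℤ.+ t) (cancel′ x t) (ℤ.+-monoˡ-≤ t p)
               , subst (y ℤ.+ t ℤ.<_) (trans (cong (ℤ._+ t) (swap₂ x t 2w)) (cancel′ (x ℤ.+ 2w) t)) (ℤ.+-monoˡ-< t q))

  hits-shift : ∀ xs y t → hits xs (y ℤ.+ t) ≡ hits (translate (ℤ.- t) xs) y
  hits-shift []       y t = refl
  hits-shift (x ∷ xs) y t = cong₂ _+_ (hit-shift x y t) (hits-shift xs y t)

  sep-translate : ∀ t {xs} → Sep xs → Sep (translate t xs)
  sep-translate t []      = []
  sep-translate t [-]     = [-]
  sep-translate t (_∷_ {x} {x′} p s) =
    subst (ℤ._≤ x ℤ.+ t) (sym (swap₁ x′ t 2w)) (ℤ.+-monoˡ-≤ t p) ∷ sep-translate t s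

  sep-tail : ∀ {x xs} → Sep (x ∷ xs) → Sep xs
  sep-tail [-]     = []
  sep-tail (_ ∷ s) = s

  hits-below : ∀ x xs y → Sep (x ∷ xs) → x ℤ.≤ y → hits xs y ≡ 0
  hits-below x []        y s x≤y = refl
  hits-below x (x′ ∷ xs) y (p ∷ s) x≤y = cong₂ _+_
    (𝟙-no ((x′ ℤ.≤? y) ×-dec (y ℤ.<? x′ ℤ.+ 2w)) (λ (_ , q) → ℤ.<⇒≱ q (ℤ.≤-trans p x≤y)))
    (hits-below x′ xs y s (ℤ.≤-trans (ℤ.i≤i+j x′ 2w) (ℤ.≤-trans p x≤y)))

  hits≤1 : ∀ xs y → Sep xs → hits xs y ≤ 1
  hits≤1 []       y s = z≤n
  hits≤1 (x ∷ xs) y s with x ℤ.≤? y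
  ... | yes p rewrite hits-below x xs y s p | +-identityʳ (𝟙 (yes p ×-dec (y ℤ.<? x ℤ.+ 2w)))
        = 𝟙≤1 (yes p ×-dec (y ℤ.<? x ℤ.+ 2w))
  ... | no _ = hits≤1 xs y (sep-tail s)

  hits-base : ∀ xs y → Sep xs → hits xs y ≤ B 0 (length xs)
  hits-base []       y s = z≤n
  hits-base (x ∷ xs) y s = hits≤1 (x ∷ xs) y s

  hits≡0 : ∀ vs y → sumσ vs y (hits []) ≡ 0
  hits≡0 vs y = trans (sumσ-const vs y 0) (*-zeroʳ (2 ^ length vs))

  -- An exchange argument. A step |v| ≥ w replaces the k disjoint intervals by their shifts by |v|
  -- up and down. The topmost interval of the upper shift clears all of the lower shift, so it can
  -- change sides: k + 1 and k - 1 disjoint intervals take the place of k and k, which is the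
  -- recursion of `B`. A small step leaves the number of intervals alone and counts only in the
  -- factor 2 of `2 ^ length vs`.
  littlewood-offord : ∀ vs y xs → Sep xs →
    sumσ vs y (hits xs) * 2 ^ big vs ≤ 2 ^ length vs * B (big vs) (length xs)
  littlewood-offord []       y xs s = ≤-trans (≤-reflexive (*-identityʳ (hits xs y)))
    (≤-trans (hits-base xs y s) (≤-reflexive (sym (+-identityʳ _))))
  littlewood-offord (v ∷ vs) y [] s rewrite hits≡0 vs (y ℤ.+ v) | hits≡0 vs (y ℤ.- v) = z≤n
  littlewood-offord (v ∷ vs) y (x ∷ xs) s with w ≤? ∣ v ∣
  ... | no _ = begin
    (sumσ vs (y ℤ.+ v) h + sumσ vs (y ℤ.- v) h) * 2 ^ big vs
      ≡⟨ *-distribʳ-+ (2 ^ big vs) (sumσ vs (y ℤ.+ v) h) _ ⟩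
    sumσ vs (y ℤ.+ v) h * 2 ^ big vs + sumσ vs (y ℤ.- v) h * 2 ^ big vs
      ≤⟨ +-mono-≤ (littlewood-offord vs _ (x ∷ xs) s) (littlewood-offord vs _ (x ∷ xs) s) ⟩
    2 ^ length vs * B (big vs) k + 2 ^ length vs * B (big vs) k
      ≡⟨ double (2 ^ length vs) _ ⟩
    2 ^ suc (length vs) * B (big vs) k ∎
    where
    open ≤-Reasoning
    h = hits (x ∷ xs)
    k = length (x ∷ xs)
  ... | yes w≤ = begin
    (sumσ (v ∷ vs) y (hits (x ∷ xs))) * 2 ^ suc (big vs)
      ≡⟨ cong (_* 2 ^ suc (big vs)) (sumσ-abs v vs y _) ⟩
    (sumσ vs (y ℤ.- n) (hits (x ∷ xs)) + sumσ vs (y ℤ.+ n) (hits (x ∷ xs))) * 2 ^ suc (big vs)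
      ≡⟨ cong (_* 2 ^ suc (big vs)) exchange ⟩
    (sumσ vs y (hits up) + sumσ vs y (hits down)) * 2 ^ suc (big vs)
      ≡⟨ e₁ (sumσ vs y (hits up)) (sumσ vs y (hits down)) (2 ^ big vs) ⟩
    2 * (sumσ vs y (hits up) * 2 ^ big vs + sumσ vs y (hits down) * 2 ^ big vs)
      ≤⟨ *-monoʳ-≤ 2 (+-mono-≤ (littlewood-offord vs y up sep-up) (littlewood-offord vs y down sep-down)) ⟩
    2 * (2 ^ length vs * B (big vs) (length up) + 2 ^ length vs * B (big vs) (length down))
      ≡⟨ cong₂ (λ a b → 2 * (2 ^ length vs * B (big vs) (2 + a) + 2 ^ length vs * B (big vs) b))
               (length-map _ xs) (length-map _ xs) ⟩
    2 * (2 ^ length vs * B (big vs) (2 + length xs) + 2 ^ length vs * B (big vs) (length xs))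
      ≡⟨ e₂ (2 ^ length vs) (B (big vs) (2 + length xs)) _ ⟩
    2 ^ suc (length vs) * (B (big vs) (2 + length xs) + B (big vs) (length xs)) ∎
    where
    open ≤-Reasoning
    n = ℤ.+ ∣ v ∣
    up down : List ℤ
    up   = (x ℤ.+ n) ∷ translate (ℤ.- n) (x ∷ xs)
    down = translate n xs
    e₁ : ∀ a b p → (a + b) * (2 * p) ≡ 2 * (a * p + b * p)
    e₁ = solve-∀
    e₂ : ∀ p a b → 2 * (p * a + p * b) ≡ 2 * p * (a + b)
    e₂ = solve-∀
    e₃ : ∀ a b c d → (a + b) + (c + d) ≡ (c + (a + b)) + d
    e₃ = solve-∀
    sep-down : Sep down
    sep-down = sep-translate n (sep-tail s)
    gap : x ℤ.- n ℤ.+ 2w ℤ.≤ x ℤ.+ n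
    gap = subst₂ ℤ._≤_ (e₄ x n 2w) (e₅ x n)
      (ℤ.+-monoʳ-≤ (x ℤ.- n) (subst (2w ℤ.≤_) (ℤ.pos-+ ∣ v ∣ ∣ v ∣)
        (ℤ.+≤+ (≤-trans (*-monoʳ-≤ 2 w≤) (≤-reflexive (cong (∣ v ∣ +_) (+-identityʳ ∣ v ∣)))))))
      where
      e₄ : ∀ x n t → x ℤ.- n ℤ.+ t ≡ x ℤ.- n ℤ.+ t
      e₄ x n t = refl
      e₅ : ∀ x n → x ℤ.- n ℤ.+ (n ℤ.+ n) ≡ x ℤ.+ n
      e₅ = ℤSolver.solve-∀
    sep-up : Sep up
    sep-up = gap ∷ sep-translate (ℤ.- n) s
    exchange : sumσ vs (y ℤ.- n) (hits (x ∷ xs)) + sumσ vs (y ℤ.+ n) (hits (x ∷ xs))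
             ≡ sumσ vs y (hits up) + sumσ vs y (hits down)
    exchange = trans
      (cong₂ _+_
        (trans (sumσ-shift vs y (ℤ.- n) _) (sumσ-cong vs y λ z → trans (hits-shift (x ∷ xs) z (ℤ.- n))
          (cong (λ t → hits (translate t (x ∷ xs)) z) (ℤ.neg-involutive n))))
        (trans (sumσ-shift vs y n _) (sumσ-cong vs y λ z → hits-shift (x ∷ xs) z n)))
      (trans (sym (sumσ-+ vs y (hits (translate n (x ∷ xs))) (hits (translate (ℤ.- n) (x ∷ xs)))))
      (trans (sumσ-cong vs y λ z → e₃ (hit (x ℤ.+ n) z) (hits down z) (hit (x ℤ.- n) z) (hits (translate (ℤ.- n) xs) z))
      (trans (sumσ-cong vs y λ z → e₆ (hit (x ℤ.- n) z) (hit (x ℤ.+ n) z) (hits down z) (hits (translate (ℤ.- n) xs) z))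
             (sumσ-+ vs y (hits up) (hits down)))))
      where
      e₆ : ∀ a b c d → (a + (b + c)) + d ≡ (b + (a + d)) + c
      e₆ = solve-∀

module SmallBall (w : ℕ) (w≥1 : 1 ≤ w) where

  open LittlewoodOfford w

  prog : ℕ → ℤ → List ℤ
  prog zero    x = []
  prog (suc k) x = (x ℤ.+ ℤ.+ (2 * w * k)) ∷ prog k x

  length-prog : ∀ k x → length (prog k x) ≡ k
  length-prog zero    x = refl
  length-prog (suc k) x = cong suc (length-prog k x)

  private
    step : ∀ x k → x ℤ.+ ℤ.+ (2 * w * k) ℤ.+ 2w ≡ x ℤ.+ ℤ.+ (2 * w * suc k)
    step x k = trans (ℤ.+-assoc x _ 2w)
      (cong (ℤ._+_ (x)) (trans (sym (ℤ.pos-+ (2 * w * k) (2 * w)))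
        (cong ℤ.+_ (trans (+-comm (2 * w * k) (2 * w)) (sym (*-suc (2 * w) k))))))

  sep-prog : ∀ k x → Sep (prog k x)
  sep-prog zero          x = []
  sep-prog (suc zero)    x = [-]
  sep-prog (suc (suc k)) x = ℤ.≤-reflexive (step x k) ∷ sep-prog (suc k) x

  prog-covers : ∀ k x y → x ℤ.≤ y → y ℤ.< x ℤ.+ ℤ.+ (2 * w * k) → 1 ≤ hits (prog k x) y
  prog-covers zero x y p q = contradiction
    (subst (y ℤ.<_) (trans (cong (λ z → x ℤ.+ ℤ.+ z) (*-zeroʳ (2 * w))) (ℤ.+-identityʳ x)) q) (ℤ.≤⇒≯ p)
  prog-covers (suc k) x y p q with (x ℤ.+ ℤ.+ (2 * w * k)) ℤ.≤? y
  ... | no  r = ≤-trans (prog-covers k x y p (ℤ.≰⇒> r)) (m≤n+m _ _)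
  ... | yes r = ≤-trans (≤-reflexive (sym (𝟙-yes (yes r ×-dec (y ℤ.<? x ℤ.+ ℤ.+ (2 * w * k) ℤ.+ 2w))
                  (r , subst (y ℤ.<_) (sym (step x k)) q)))) (m≤m+n _ _)

  -- The κ intervals of length 2 w tile [-κ w , κ w). In `B-bound` with A = 32 κ and r ≥ A², the
  -- mean exit time over r and the probability to leave at A contribute at most 1/32 each.
  concentration : ∀ vs κ → 1 ≤ κ → (32 * κ) * (32 * κ) ≤ big vs →
    16 * sumσ vs (ℤ.+ 0) (hits (prog κ (ℤ.- ℤ.+ (κ * w)))) ≤ 2 ^ length vs
  concentration vs κ κ≥1 A²≤r =
    *-cancelʳ-≤ _ _ (4 * κ * r * 2 ^ r) {{m*n≢0 (4 * κ * r) (2 ^ r) {{>-nonZero pos₁}} {{m^n≢0 2 r}}}} (begin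
    16 * s * (4 * κ * r * 2 ^ r)        ≡⟨ e₁ s κ r (2 ^ r) ⟩
    2 * (A * r) * (s * 2 ^ r)           ≤⟨ *-monoʳ-≤ (2 * (A * r)) (littlewood-offord vs (ℤ.+ 0) _ (sep-prog κ _)) ⟩
    2 * (A * r) * (L * B r (length (prog κ (ℤ.- ℤ.+ (κ * w)))))
      ≡⟨ cong (λ z → 2 * (A * r) * (L * B r z)) (length-prog κ _) ⟩
    2 * (A * r) * (L * B r κ)           ≡⟨ e₂ A r L (B r κ) ⟩
    2 * L * (A * r * B r κ)             ≤⟨ *-monoʳ-≤ (2 * L) (B-bound A r κ (31 * κ) refl) ⟩
    2 * L * (2 ^ r * (κ * (A * (31 * κ) + r)))
      ≤⟨ *-monoʳ-≤ (2 * L) (*-monoʳ-≤ (2 ^ r) (*-monoʳ-≤ κ (+-monoˡ-≤ r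
           (≤-trans (*-monoʳ-≤ A (*-monoˡ-≤ κ (m≤m+n 31 1))) A²≤r)))) ⟩
    2 * L * (2 ^ r * (κ * (r + r)))     ≡⟨ e₃ L κ r (2 ^ r) ⟩
    L * (4 * κ * r * 2 ^ r)             ∎)
    where
    open ≤-Reasoning
    r = big vs
    A = 32 * κ
    L = 2 ^ length vs
    s = sumσ vs (ℤ.+ 0) (hits (prog κ (ℤ.- ℤ.+ (κ * w))))
    e₁ : ∀ s κ r p → 16 * s * (4 * κ * r * p) ≡ 2 * (32 * κ * r) * (s * p)
    e₁ = solve-∀
    e₂ : ∀ A r L b → 2 * (A * r) * (L * b) ≡ 2 * L * (A * r * b)
    e₂ = solve-∀
    e₃ : ∀ L κ r p → 2 * L * (p * (κ * (r + r))) ≡ L * (4 * κ * r * p)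
    e₃ = solve-∀
    A≥1 : 1 ≤ A
    A≥1 = *-mono-≤ (s≤s (z≤n {31})) κ≥1
    pos₁ : 0 < 4 * κ * r
    pos₁ = *-mono-≤ (*-mono-≤ (s≤s (z≤n {3})) κ≥1) (≤-trans (*-mono-≤ A≥1 A≥1) A²≤r)

  -- The sum is symmetric and its central window has share at most 1/16, so at least (1 - 1/16) / 2
  -- = 15/32 lies below the window.
  lower-tail : ∀ vs κ → 1 ≤ κ → (32 * κ) * (32 * κ) ≤ big vs →
    15 * 2 ^ length vs ≤ 32 * sumσ vs (ℤ.+ 0) (λ y → 𝟙 (y ℤ.≤? ℤ.- ℤ.+ (κ * w)))
  lower-tail vs κ κ≥1 A²≤r = +-cancelʳ-≤ L _ _ (begin
    15 * L + L            ≡⟨ e₁ L ⟩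
    16 * L                ≤⟨ *-monoʳ-≤ 16 cover ⟩
    16 * (t + t + s)      ≡⟨ e₂ t s ⟩
    32 * t + 16 * s       ≤⟨ +-monoʳ-≤ (32 * t) (concentration vs κ κ≥1 A²≤r) ⟩
    32 * t + L            ∎)
    where
    open ≤-Reasoning
    L = 2 ^ length vs
    U = ℤ.+ (κ * w)
    s = sumσ vs (ℤ.+ 0) (hits (prog κ (ℤ.- U)))
    low high : ℤ → ℕ
    low  y = 𝟙 (y ℤ.≤? ℤ.- U)
    high y = 𝟙 ((ℤ.- y) ℤ.≤? ℤ.- U)
    t = sumσ vs (ℤ.+ 0) low
    e₁ : ∀ x → 15 * x + x ≡ 16 * x
    e₁ = solve-∀
    e₂ : ∀ t s → 16 * (t + t + s) ≡ 32 * t + 16 * s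
    e₂ = solve-∀
    mid : ∀ u → ℤ.- u ℤ.+ (u ℤ.+ u) ≡ u
    mid = ℤSolver.solve-∀
    top : ℤ.- U ℤ.+ ℤ.+ (2 * w * κ) ≡ U
    top = trans (cong (ℤ._+_ (ℤ.- U)) (trans (cong ℤ.+_ (e₃ w κ)) (ℤ.pos-+ (κ * w) (κ * w)))) (mid U)
      where
      e₃ : ∀ w κ → 2 * w * κ ≡ κ * w + κ * w
      e₃ = solve-∀
    pointwise : ∀ y → 1 ≤ low y + high y + hits (prog κ (ℤ.- U)) y
    pointwise y with y ℤ.≤? ℤ.- U | (ℤ.- y) ℤ.≤? ℤ.- U
    ... | yes _ | _     = s≤s z≤n
    ... | no _  | yes _ = s≤s z≤n
    ... | no p  | no q  = prog-covers κ (ℤ.- U) y (ℤ.<⇒≤ (ℤ.≰⇒> p))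
                            (subst (y ℤ.<_) (sym top) (ℤ.neg-cancel-< (ℤ.≰⇒> q)))
    cover : L ≤ t + t + s
    cover = begin
      L                                       ≡⟨ sym (trans (sumσ-const vs (ℤ.+ 0) 1) (*-identityʳ L)) ⟩
      sumσ vs (ℤ.+ 0) (λ _ → 1)               ≤⟨ sumσ-mono vs (ℤ.+ 0) pointwise ⟩
      sumσ vs (ℤ.+ 0) (λ y → low y + high y + hits (prog κ (ℤ.- U)) y)
        ≡⟨ trans (sumσ-+ vs _ (λ y → low y + high y) _) (cong (_+ s) (sumσ-+ vs _ low high)) ⟩
      t + sumσ vs (ℤ.+ 0) high + s
        ≡⟨ cong (λ z → t + z + s) (sym (sumσ-neg vs (ℤ.+ 0) low)) ⟩
      t + t + s ∎

-- Signed lists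

sumS : List ℤ → (List ℤ → ℕ) → ℕ
sumS []       ψ = ψ []
sumS (x ∷ xs) ψ = sumS xs (λ z → ψ (x ∷ z)) + sumS xs (λ z → ψ (ℤ.- x ∷ z))

sumS-mono : ∀ xs {φ ψ : List ℤ → ℕ} → (∀ z → length z ≡ length xs → φ z ≤ ψ z) → sumS xs φ ≤ sumS xs ψ
sumS-mono []       h = h [] refl
sumS-mono (x ∷ xs) h = +-mono-≤ (sumS-mono xs λ z e → h (x ∷ z) (cong suc e))
                                (sumS-mono xs λ z e → h (ℤ.- x ∷ z) (cong suc e))

sumS-cong : ∀ xs {φ ψ : List ℤ → ℕ} → (∀ z → length z ≡ length xs → φ z ≡ ψ z) → sumS xs φ ≡ sumS xs ψ
sumS-cong xs h = ≤-antisym (sumS-mono xs λ z e → ≤-reflexive (h z e))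
                           (sumS-mono xs λ z e → ≤-reflexive (sym (h z e)))

sumS-+ : ∀ xs (φ ψ : List ℤ → ℕ) → sumS xs (λ z → φ z + ψ z) ≡ sumS xs φ + sumS xs ψ
sumS-+ []       φ ψ = refl
sumS-+ (x ∷ xs) φ ψ = trans (cong₂ _+_ (sumS-+ xs (φ ∘ (x ∷_)) (ψ ∘ (x ∷_))) (sumS-+ xs (φ ∘ (ℤ.- x ∷_)) (ψ ∘ (ℤ.- x ∷_))))
  (+-interchange (sumS xs (φ ∘ (x ∷_))) (sumS xs (ψ ∘ (x ∷_))) _ _)

sumS-*ˡ : ∀ xs k (φ : List ℤ → ℕ) → sumS xs (λ z → k * φ z) ≡ k * sumS xs φ
sumS-*ˡ []       k φ = refl
sumS-*ˡ (x ∷ xs) k φ = trans (cong₂ _+_ (sumS-*ˡ xs k (φ ∘ (x ∷_))) (sumS-*ˡ xs k (φ ∘ (ℤ.- x ∷_))))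
  (sym (*-distribˡ-+ k (sumS xs (φ ∘ (x ∷_))) _))

sumS-const : ∀ xs c → sumS xs (λ _ → c) ≡ 2 ^ length xs * c
sumS-const []       c = sym (+-identityʳ c)
sumS-const (x ∷ xs) c = trans (cong₂ _+_ (sumS-const xs c) (sumS-const xs c)) (double (2 ^ length xs) c)

sumS-++ : ∀ xs ys (φ : List ℤ → ℕ) → sumS (xs ++ ys) φ ≡ sumS xs (λ z → sumS ys (λ z′ → φ (z ++ z′)))
sumS-++ []       ys φ = refl
sumS-++ (x ∷ xs) ys φ = cong₂ _+_ (sumS-++ xs ys (φ ∘ (x ∷_))) (sumS-++ xs ys (φ ∘ (ℤ.- x ∷_)))

-- Position i of a list with offset o stands for the index o + i + 1.
weighted : (ℕ → ℕ) → ℕ → List ℤ → List ℤ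
weighted c o []       = []
weighted c o (x ∷ xs) = (ℤ.+ c (suc o) ℤ.* x) ∷ weighted c (suc o) xs

linear : (ℕ → ℕ) → ℕ → List ℤ → ℤ
linear c o []       = ℤ.+ 0
linear c o (x ∷ xs) = ℤ.+ c (suc o) ℤ.* x ℤ.+ linear c (suc o) xs

energy : (ℕ → ℕ) → ℕ → List ℤ → ℕ
energy c o []       = 0
energy c o (x ∷ xs) = c (suc o) * (∣ x ∣ * ∣ x ∣) + energy c (suc o) xs

length-weighted : ∀ c o xs → length (weighted c o xs) ≡ length xs
length-weighted c o []       = refl
length-weighted c o (x ∷ xs) = cong suc (length-weighted c (suc o) xs)

linear-++ : ∀ c o xs ys → linear c o (xs ++ ys) ≡ linear c o xs ℤ.+ linear c (o + length xs) ys
linear-++ c o []       ys = sym (trans (ℤ.+-identityˡ _) (cong (λ z → linear c z ys) (+-identityʳ o)))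
linear-++ c o (x ∷ xs) ys = trans
  (cong (ℤ._+_ (ℤ.+ c (suc o) ℤ.* x)) (trans (linear-++ c (suc o) xs ys)
    (cong (λ z → linear c (suc o) xs ℤ.+ linear c z ys) (sym (+-suc o (length xs))))))
  (sym (ℤ.+-assoc (ℤ.+ c (suc o) ℤ.* x) _ _))

sumS-linear : ∀ c o xs y (φ : ℤ → ℕ) → sumS xs (λ z → φ (y ℤ.+ linear c o z)) ≡ sumσ (weighted c o xs) y φ
sumS-linear c o []       y φ = cong φ (ℤ.+-identityʳ y)
sumS-linear c o (x ∷ xs) y φ = cong₂ _+_
  (trans (sumS-cong xs λ z _ → cong φ (sym (ℤ.+-assoc y (ℤ.+ c (suc o) ℤ.* x) _)))
         (sumS-linear c (suc o) xs (y ℤ.+ ℤ.+ c (suc o) ℤ.* x) φ))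
  (trans (sumS-cong xs λ z _ → cong φ (trans (sym (ℤ.+-assoc y _ _))
           (cong (λ t → y ℤ.+ t ℤ.+ linear c (suc o) z) (sym (ℤ.neg-distribʳ-* (ℤ.+ c (suc o)) x)))))
         (sumS-linear c (suc o) xs (y ℤ.- ℤ.+ c (suc o) ℤ.* x) φ))

sq : ℤ → ℕ
sq y = ∣ y ∣ * ∣ y ∣

+sq : ∀ y → ℤ.+ sq y ≡ y ℤ.* y
+sq (ℤ.+ n)  = ℤ.pos-* n n
+sq -[1+ n ] = refl

sq-parallelogram : ∀ y v → sq (y ℤ.+ v) + sq (y ℤ.- v) ≡ 2 * sq y + 2 * sq v
sq-parallelogram y v = ℤ.+-injective (begin
  ℤ.+ (sq (y ℤ.+ v) + sq (y ℤ.- v))                 ≡⟨ ℤ.pos-+ (sq (y ℤ.+ v)) _ ⟩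
  ℤ.+ sq (y ℤ.+ v) ℤ.+ ℤ.+ sq (y ℤ.- v)             ≡⟨ cong₂ ℤ._+_ (+sq (y ℤ.+ v)) (+sq (y ℤ.- v)) ⟩
  (y ℤ.+ v) ℤ.* (y ℤ.+ v) ℤ.+ (y ℤ.- v) ℤ.* (y ℤ.- v) ≡⟨ e y v ⟩
  ℤ.+ 2 ℤ.* (y ℤ.* y) ℤ.+ ℤ.+ 2 ℤ.* (v ℤ.* v)
    ≡⟨ cong₂ (λ a b → ℤ.+ 2 ℤ.* a ℤ.+ ℤ.+ 2 ℤ.* b) (sym (+sq y)) (sym (+sq v)) ⟩
  ℤ.+ 2 ℤ.* ℤ.+ sq y ℤ.+ ℤ.+ 2 ℤ.* ℤ.+ sq v
    ≡⟨ cong₂ ℤ._+_ (sym (ℤ.pos-* 2 (sq y))) (sym (ℤ.pos-* 2 (sq v))) ⟩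
  ℤ.+ (2 * sq y) ℤ.+ ℤ.+ (2 * sq v)                 ≡⟨ sym (ℤ.pos-+ (2 * sq y) _) ⟩
  ℤ.+ (2 * sq y + 2 * sq v)                         ∎)
  where
  open ≡-Reasoning
  e : ∀ y v → (y ℤ.+ v) ℤ.* (y ℤ.+ v) ℤ.+ (y ℤ.- v) ℤ.* (y ℤ.- v)
            ≡ ℤ.+ 2 ℤ.* (y ℤ.* y) ℤ.+ ℤ.+ 2 ℤ.* (v ℤ.* v)
  e = ℤSolver.solve-∀

-- By the parallelogram law the cross terms of y + v and y - v cancel, so that independent signs add
-- their squares.
sumσ-sq : ∀ c o xs y → sumσ (weighted c o xs) y sq
        ≡ 2 ^ length xs * (sq y + energy (λ j → c j * c j) o xs)
sumσ-sq c o []       y = sym (trans (+-identityʳ _) (+-identityʳ (sq y)))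
sumσ-sq c o (x ∷ xs) y = begin
  sumσ vs (y ℤ.+ v) sq + sumσ vs (y ℤ.- v) sq
    ≡⟨ cong₂ _+_ (sumσ-sq c (suc o) xs (y ℤ.+ v)) (sumσ-sq c (suc o) xs (y ℤ.- v)) ⟩
  L * (sq (y ℤ.+ v) + E) + L * (sq (y ℤ.- v) + E)
    ≡⟨ e₁ L (sq (y ℤ.+ v)) (sq (y ℤ.- v)) E ⟩
  L * ((sq (y ℤ.+ v) + sq (y ℤ.- v)) + 2 * E)
    ≡⟨ cong (λ z → L * (z + 2 * E)) (sq-parallelogram y v) ⟩
  L * ((2 * sq y + 2 * sq v) + 2 * E)
    ≡⟨ cong (λ z → L * ((2 * sq y + 2 * z) + 2 * E)) (trans (cong (λ z → z * z) (ℤ.abs-* (ℤ.+ k) x)) (e₂ k ∣ x ∣)) ⟩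
  L * ((2 * sq y + 2 * (k * k * (∣ x ∣ * ∣ x ∣))) + 2 * E)
    ≡⟨ e₃ L (sq y) (k * k * (∣ x ∣ * ∣ x ∣)) E ⟩
  2 * L * (sq y + (k * k * (∣ x ∣ * ∣ x ∣) + E)) ∎
  where
  open ≡-Reasoning
  k = c (suc o)
  v = ℤ.+ k ℤ.* x
  vs = weighted c (suc o) xs
  L = 2 ^ length xs
  E = energy (λ j → c j * c j) (suc o) xs
  e₁ : ∀ L a b E → L * (a + E) + L * (b + E) ≡ L * ((a + b) + 2 * E)
  e₁ = solve-∀
  e₂ : ∀ k x → k * x * (k * x) ≡ k * k * (x * x)
  e₂ = solve-∀
  e₃ : ∀ L a b E → L * ((2 * a + 2 * b) + 2 * E) ≡ 2 * L * (a + (b + E))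
  e₃ = solve-∀

second-moment : ∀ c o xs → sumS xs (λ z → sq (linear c o z)) ≡ 2 ^ length xs * energy (λ j → c j * c j) o xs
second-moment c o xs = trans (sumS-cong xs λ z _ → cong sq (sym (ℤ.+-identityˡ (linear c o z))))
  (trans (sumS-linear c o xs (ℤ.+ 0) sq) (sumσ-sq c o xs (ℤ.+ 0)))

-- Finite products, geometric budgets and exponential counts.

^-distribʳ-* : ∀ n a b → (a * b) ^ n ≡ a ^ n * b ^ n
^-distribʳ-* zero    a b = refl
^-distribʳ-* (suc n) a b = trans (cong (a * b *_) (^-distribʳ-* n a b)) (e a b (a ^ n) (b ^ n))
  where
  e : ∀ a b p q → a * b * (p * q) ≡ a * p * (b * q)
  e = solve-∀

∏ : ℕ → (ℕ → ℕ) → ℕ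
∏ zero    f = 1
∏ (suc n) f = f 0 * ∏ n (λ i → f (suc i))

∏-mono : ∀ n {f g : ℕ → ℕ} → (∀ i → i < n → f i ≤ g i) → ∏ n f ≤ ∏ n g
∏-mono zero    h = ≤-refl
∏-mono (suc n) h = *-mono-≤ (h 0 (s≤s z≤n)) (∏-mono n (λ i i<n → h (suc i) (s≤s i<n)))

∏-cong : ∀ n {f g : ℕ → ℕ} → (∀ i → i < n → f i ≡ g i) → ∏ n f ≡ ∏ n g
∏-cong n h = ≤-antisym (∏-mono n λ i p → ≤-reflexive (h i p)) (∏-mono n λ i p → ≤-reflexive (sym (h i p)))

*-interchange : ∀ a b c d → (a * b) * (c * d) ≡ (a * c) * (b * d)
*-interchange = solve-∀

∏-* : ∀ n (f g : ℕ → ℕ) → ∏ n (λ i → f i * g i) ≡ ∏ n f * ∏ n g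
∏-* zero    f g = refl
∏-* (suc n) f g = trans (cong (f 0 * g 0 *_) (∏-* n (f ∘ suc) (g ∘ suc)))
                        (*-interchange (f 0) (g 0) (∏ n (f ∘ suc)) _)

∏-last : ∀ n (f : ℕ → ℕ) → ∏ (suc n) f ≡ ∏ n f * f n
∏-last zero    f = *-comm (f 0) 1
∏-last (suc n) f = trans (cong (f 0 *_) (∏-last n (f ∘ suc))) (sym (*-assoc (f 0) _ _))

∏-const : ∀ n c → ∏ n (λ _ → c) ≡ c ^ n
∏-const zero    c = refl
∏-const (suc n) c = cong (c *_) (∏-const n c)

∏-^ : ∀ n b (f : ℕ → ℕ) → ∏ n (λ i → b ^ f i) ≡ b ^ ∑ n f
∏-^ zero    b f = refl
∏-^ (suc n) b f = trans (cong (b ^ f 0 *_) (∏-^ n b (f ∘ suc))) (sym (^-distribˡ-+-* b (f 0) _))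

∏-≥1 : ∀ n {f : ℕ → ℕ} → (∀ i → i < n → 1 ≤ f i) → 1 ≤ ∏ n f
∏-≥1 n h = ≤-trans (≤-reflexive (sym (trans (∏-const n 1) (^-zeroˡ n)))) (∏-mono n h)

∏-dichotomy : ∀ n {p} {A : ℕ → Set p} (A? : ∀ i → Dec (A i)) →
              ∏ n (λ i → 𝟙 (A? i)) ≡ 0 ⊎ (∏ n (λ i → 𝟙 (A? i)) ≡ 1 × (∀ i → i < n → A i))
∏-dichotomy zero    A? = inj₂ (refl , λ i ())
∏-dichotomy (suc n) A? with A? 0 | ∏-dichotomy n (A? ∘ suc)
... | no  _ | _              = inj₁ refl
... | yes _ | inj₁ e         = inj₁ (trans (*-identityˡ _) e)
... | yes p | inj₂ (e , all) = inj₂ (trans (*-identityˡ _) e , λ { zero _ → p ; (suc i) (s≤s q) → all i q })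

∑ℤ : ℕ → (ℕ → ℤ) → ℤ
∑ℤ zero    f = ℤ.+ 0
∑ℤ (suc n) f = f 0 ℤ.+ ∑ℤ n (λ i → f (suc i))

∑ℤ-split : ∀ m n (f : ℕ → ℤ) → ∑ℤ (m + n) f ≡ ∑ℤ m f ℤ.+ ∑ℤ n (λ i → f (m + i))
∑ℤ-split zero    n f = sym (ℤ.+-identityˡ _)
∑ℤ-split (suc m) n f = trans (cong (ℤ._+_ (f 0)) (∑ℤ-split m n (f ∘ suc))) (sym (ℤ.+-assoc (f 0) _ _))

∣∑ℤ∣≤ : ∀ n (f : ℕ → ℤ) → ∣ ∑ℤ n f ∣ ≤ ∑ n (λ i → ∣ f i ∣)
∣∑ℤ∣≤ zero    f = z≤n
∣∑ℤ∣≤ (suc n) f = ≤-trans (ℤ.∣i+j∣≤∣i∣+∣j∣ (f 0) _) (+-monoʳ-≤ ∣ f 0 ∣ (∣∑ℤ∣≤ n (f ∘ suc)))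

shiftTwo : ∀ p y → 2 * p * y ≡ p * (2 * y)
shiftTwo = solve-∀

-- The thresholds u / 2^(j + 1) at the distances j = 1, 2, ... add up to at most u / 2, so quiet
-- blocks on one side of a test use half of the budget u.
geometric-left : ∀ s (y : ℕ → ℕ) u → (∀ t → t < s → 2 ^ suc (s ∸ t) * y t ≤ u) → 2 * ∑ s y ≤ u
geometric-left zero    y u h = z≤n
geometric-left (suc s) y u h = *-cancelˡ-≤ 2 (begin
  2 * (2 * ∑ (suc s) y)               ≡⟨ cong (λ z → 2 * (2 * z)) (∑-last s y) ⟩
  2 * (2 * (∑ s y + y s))             ≡⟨ e (∑ s y) (y s) ⟩
  2 * (2 * ∑ s y) + 4 * y s           ≤⟨ +-mono-≤ tail last ⟩
  u + u                               ≡⟨ cong (u +_) (sym (+-identityʳ u)) ⟩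
  2 * u                               ∎)
  where
  open ≤-Reasoning
  e : ∀ a b → 2 * (2 * (a + b)) ≡ 2 * (2 * a) + 4 * b
  e = solve-∀
  last : 4 * y s ≤ u
  last = subst (λ z → 2 ^ suc z * y s ≤ u) (m+n∸n≡m 1 s) (h s ≤-refl)
  tail : 2 * (2 * ∑ s y) ≤ u
  tail = subst (λ z → 2 * z ≤ u) (∑-*ˡ s 2 y) (geometric-left s (λ t → 2 * y t) u λ t t<s →
    subst (_≤ u) (trans (cong (λ z → 2 ^ suc z * y t) (+-∸-assoc 1 (<⇒≤ t<s))) (shiftTwo (2 ^ suc (s ∸ t)) (y t)))
      (h t (m≤n⇒m≤1+n t<s)))

geometric-right : ∀ r (y : ℕ → ℕ) u → (∀ i → i < r → 2 ^ suc (suc i) * y i ≤ u) → 2 * ∑ r y ≤ u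
geometric-right zero    y u h = z≤n
geometric-right (suc r) y u h = *-cancelˡ-≤ 2 (begin
  2 * (2 * (y 0 + ∑ r (y ∘ suc)))     ≡⟨ e (y 0) (∑ r (y ∘ suc)) ⟩
  4 * y 0 + 2 * (2 * ∑ r (y ∘ suc))   ≤⟨ +-mono-≤ (h 0 (s≤s z≤n)) tail ⟩
  u + u                               ≡⟨ cong (u +_) (sym (+-identityʳ u)) ⟩
  2 * u                               ∎)
  where
  open ≤-Reasoning
  e : ∀ a b → 2 * (2 * (a + b)) ≡ 4 * a + 2 * (2 * b)
  e = solve-∀
  tail : 2 * (2 * ∑ r (y ∘ suc)) ≤ u
  tail = subst (λ z → 2 * z ≤ u) (∑-*ˡ r 2 (y ∘ suc)) (geometric-right r (λ t → 2 * y (suc t)) u λ i i<r →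
    subst (_≤ u) (shiftTwo (2 ^ suc (suc i)) (y (suc i))) (h (suc i) (s≤s i<r)))

-- If i is the largest index with `A i`, the count is at most i + 1 while θ 256^i ≤ b. An
-- exponential in the number of ruined tests is thus dominated by a single quantity b, later a
-- square whose mean is computable.
count-up : ∀ n {p} {A : ℕ → Set p} (A? : ∀ i → Dec (A i)) θ b →
  (∀ i → i < n → A i → θ * 256 ^ i ≤ b) → 256 ^ ∑ n (λ i → 𝟙 (A? i)) * θ ≤ θ ⊔ (256 * b)
count-up zero    A? θ b h = ≤-trans (≤-reflexive (*-identityˡ θ)) (m≤m⊔n θ _)
count-up (suc n) A? θ b h with θ ≤? b
... | no θ≰b = begin
  256 ^ ∑ (suc n) (λ i → 𝟙 (A? i)) * θ
    ≡⟨ cong (λ z → 256 ^ z * θ) (∑-zero (suc n) {λ i → 𝟙 (A? i)} λ i i<n → 𝟙-no (A? i) λ a →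
         θ≰b (≤-trans (m≤m*n θ (256 ^ i) {{m^n≢0 256 i}}) (h i i<n a))) ⟩
  1 * θ  ≡⟨ *-identityˡ θ ⟩
  θ      ≤⟨ m≤m⊔n θ _ ⟩
  θ ⊔ (256 * b) ∎
  where open ≤-Reasoning
... | yes θ≤b = begin
  256 ^ (𝟙 (A? 0) + rest) * θ     ≤⟨ *-monoˡ-≤ θ (^-monoʳ-≤ 256 (+-monoˡ-≤ rest (𝟙≤1 (A? 0)))) ⟩
  256 * 256 ^ rest * θ            ≡⟨ e (256 ^ rest) θ ⟩
  256 ^ rest * (256 * θ)
    ≤⟨ count-up n (A? ∘ suc) (256 * θ) b (λ i i<n a → ≤-trans (≤-reflexive (e′ θ (256 ^ i))) (h (suc i) (s≤s i<n) a)) ⟩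
  (256 * θ) ⊔ (256 * b)           ≤⟨ ⊔-lub (≤-trans (*-monoʳ-≤ 256 θ≤b) (m≤n⊔m θ _)) (m≤n⊔m θ _) ⟩
  θ ⊔ (256 * b)                   ∎
  where
  open ≤-Reasoning
  rest = ∑ n (λ i → 𝟙 (A? (suc i)))
  e : ∀ p θ → 256 * p * θ ≡ p * (256 * θ)
  e = solve-∀
  e′ : ∀ θ p → 256 * θ * p ≡ θ * (256 * p)
  e′ = solve-∀

∑-reverse : ∀ n (f : ℕ → ℕ) → ∑ n f ≡ ∑ n (λ i → f (n ∸ suc i))
∑-reverse zero    f = refl
∑-reverse (suc n) f = trans (∑-last n f) (trans (+-comm (∑ n f) (f n)) (cong (f n +_) (∑-reverse n f)))

-- Survival of the tests, and ruin by other blocks.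

Upper : ℕ → ℕ → ℕ → Set
Upper c θ b = 256 ^ c * θ ≤ θ + 256 * b

-- The base 256 = 16² leaves room for both sides: 16^(c + c′) is the geometric mean of 256^c and
-- 256^c′, hence at most their arithmetic mean. Multiplying the two bounds instead would call for a
-- fourth moment.
combine-counts : ∀ c c′ θ b b′ → Upper c θ b → Upper c′ θ b′ → 16 ^ (c + c′) * θ ≤ θ + 128 * (b + b′)
combine-counts c c′ θ b b′ h h′ = *-cancelˡ-≤ 2 (begin
  2 * (16 ^ (c + c′) * θ)               ≡⟨ cong (λ z → 2 * (z * θ)) (^-distribˡ-+-* 16 c c′) ⟩
  2 * (16 ^ c * 16 ^ c′ * θ)            ≡⟨ sym (*-assoc 2 (16 ^ c * 16 ^ c′) θ) ⟩
  2 * (16 ^ c * 16 ^ c′) * θ            ≤⟨ *-monoˡ-≤ θ (am-gm (16 ^ c) (16 ^ c′)) ⟩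
  (16 ^ c * 16 ^ c + 16 ^ c′ * 16 ^ c′) * θ
    ≡⟨ cong₂ (λ x y → (x + y) * θ) (sym (^-distribʳ-* c 16 16)) (sym (^-distribʳ-* c′ 16 16)) ⟩
  (256 ^ c + 256 ^ c′) * θ              ≡⟨ *-distribʳ-+ θ (256 ^ c) _ ⟩
  256 ^ c * θ + 256 ^ c′ * θ            ≤⟨ +-mono-≤ h h′ ⟩
  (θ + 256 * b) + (θ + 256 * b′)        ≡⟨ e θ b b′ ⟩
  2 * (θ + 128 * (b + b′))              ∎)
  where
  open ≤-Reasoning
  e : ∀ θ b b′ → (θ + 256 * b) + (θ + 256 * b′) ≡ 2 * (θ + 128 * (b + b′))
  e = solve-∀
  am-gm′ : ∀ x d → 2 * (x * (x + d)) ≤ x * x + (x + d) * (x + d)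
  am-gm′ x d = ≤-by (d * d) (e′ x d)
    where
    e′ : ∀ x d → x * x + (x + d) * (x + d) ≡ 2 * (x * (x + d)) + d * d
    e′ = solve-∀
  am-gm : ∀ x y → 2 * (x * y) ≤ x * x + y * y
  am-gm x y with ≤-total x y
  ... | inj₁ x≤y = subst (λ z → 2 * (x * z) ≤ x * x + z * z) (m+[n∸m]≡n x≤y) (am-gm′ x (y ∸ x))
  ... | inj₂ y≤x = subst₂ _≤_ (cong (2 *_) (*-comm y x)) (+-comm (y * y) (x * x))
    (subst (λ z → 2 * (y * z) ≤ y * y + z * z) (m+[n∸m]≡n y≤x) (am-gm′ y (x ∸ y)))

-- Test σ is attached to block suc σ; blocks 0 and suc T carry no test.
module Tests (T : ℕ) (u : ℕ → ℕ) (Y : ℕ → ℕ → ℤ) where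

  -- A block at distance j from the own block of a test ruins it when it contributes at least u /
  -- 2^(j + 1) in absolute value. While no block does so, each side contributes at most u / 2, by
  -- `geometric-left` and `geometric-right`.
  Left Right : ℕ → ℕ → Set
  Left  t σ = t < suc σ × u σ ≤ 2 ^ suc (suc σ ∸ t) * ∣ Y t σ ∣
  Right t σ = suc σ < t × u σ ≤ 2 ^ suc (t ∸ suc σ) * ∣ Y t σ ∣

  left? : ∀ t σ → Dec (Left t σ)
  left? t σ = (t <? suc σ) ×-dec (u σ ≤? 2 ^ suc (suc σ ∸ t) * ∣ Y t σ ∣)

  right? : ∀ t σ → Dec (Right t σ)
  right? t σ = (suc σ <? t) ×-dec (u σ ≤? 2 ^ suc (t ∸ suc σ) * ∣ Y t σ ∣)

  -- Judged by the own block alone: its contribution stays above -u. At or below -u, the other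
  -- blocks can make up for it only if one of them ruins the test.
  passes : ℕ → ℕ
  passes σ = 𝟙 (¬? (Y (suc σ) σ ℤ.≤? ℤ.- ℤ.+ u σ))

  N : ℕ
  N = suc (suc T)

  ruins : ℕ → ℕ → ℕ
  ruins t σ = 𝟙 (left? t σ) + 𝟙 (right? t σ)

  factor : ℕ → ℕ
  factor zero    = 1
  factor (suc σ) = choose (σ <? T) (1 + 15 * passes σ) 1

  private
    some-ruin : ∀ σ → σ < T → ℤ.+ 1 ℤ.≤ ∑ℤ N (λ t → Y t σ) → Y (suc σ) σ ℤ.≤ ℤ.- ℤ.+ u σ →
                ¬ (∑ N (λ t → ruins t σ) ≡ 0)
    some-ruin σ σ<T 1≤ fails none = ℤ.<⇒≱ {ℤ.+ 0} (ℤ.+<+ (s≤s z≤n)) (begin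
      ℤ.+ 1                                      ≤⟨ 1≤ ⟩
      ∑ℤ N y                                     ≡⟨ cong (λ n → ∑ℤ n y) (sym N≡) ⟩
      ∑ℤ (suc σ + suc r) y                       ≡⟨ ∑ℤ-split (suc σ) (suc r) y ⟩
      L ℤ.+ (y (suc σ + 0) ℤ.+ R)                ≡⟨ cong (λ z → L ℤ.+ (y z ℤ.+ R)) (+-identityʳ (suc σ)) ⟩
      L ℤ.+ (y (suc σ) ℤ.+ R)                    ≤⟨ ℤ.+-mono-≤ (i≤∣i∣ L) (ℤ.+-mono-≤ fails (i≤∣i∣ R)) ⟩
      ℤ.+ ∣ L ∣ ℤ.+ (ℤ.- ℤ.+ u σ ℤ.+ ℤ.+ ∣ R ∣)  ≡⟨ e (ℤ.+ ∣ L ∣) (ℤ.+ u σ) (ℤ.+ ∣ R ∣) ⟩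
      (ℤ.+ ∣ L ∣ ℤ.+ ℤ.+ ∣ R ∣) ℤ.- ℤ.+ u σ      ≡⟨ cong (ℤ._- ℤ.+ u σ) (sym (ℤ.pos-+ ∣ L ∣ ∣ R ∣)) ⟩
      ℤ.+ (∣ L ∣ + ∣ R ∣) ℤ.- ℤ.+ u σ            ≤⟨ ℤ.+-monoˡ-≤ (ℤ.- ℤ.+ u σ) (ℤ.+≤+ noise≤) ⟩
      ℤ.+ u σ ℤ.- ℤ.+ u σ                        ≡⟨ ℤ.+-inverseʳ (ℤ.+ u σ) ⟩
      ℤ.+ 0                                      ∎)
      where
      open ℤ.≤-Reasoning
      y : ℕ → ℤ
      y t = Y t σ
      r = T ∸ σ
      N≡ : suc σ + suc r ≡ N
      N≡ = trans (+-suc (suc σ) r) (cong (suc ∘ suc) (m+[n∸m]≡n (<⇒≤ σ<T)))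
      L = ∑ℤ (suc σ) y
      R = ∑ℤ r (λ i → y (suc σ + suc i))
      i≤∣i∣ : ∀ i → i ℤ.≤ ℤ.+ ∣ i ∣
      i≤∣i∣ (ℤ.+ n)  = ℤ.≤-refl
      i≤∣i∣ -[1+ n ] = ℤ.-≤+
      e : ∀ a b c → a ℤ.+ (ℤ.- b ℤ.+ c) ≡ (a ℤ.+ c) ℤ.- b
      e = ℤSolver.solve-∀
      quiet : ∀ t → t < N → ruins t σ ≡ 0
      quiet t t<N = n≤0⇒n≡0 (subst (ruins t σ ≤_) none (∑-term N (λ t → ruins t σ) t<N))
      not-left : ∀ t → t < N → ¬ Left t σ
      not-left t t<N l = 1+n≰n (subst (1 ≤_) (m+n≡0⇒m≡0 _ (quiet t t<N)) (≤-reflexive (sym (𝟙-yes (left? t σ) l))))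
      not-right : ∀ t → t < N → ¬ Right t σ
      not-right t t<N l = 1+n≰n (subst (1 ≤_) (m+n≡0⇒n≡0 (𝟙 (left? t σ)) (quiet t t<N)) (≤-reflexive (sym (𝟙-yes (right? t σ) l))))
      noise-left : 2 * ∑ (suc σ) (λ t → ∣ y t ∣) ≤ u σ
      noise-left = geometric-left (suc σ) _ _ λ t t<s → <⇒≤ (≰⇒> λ q →
        not-left t (≤-trans t<s (≤-trans (m≤n⇒m≤1+n σ<T) (n≤1+n _))) (t<s , q))
      noise-right : 2 * ∑ r (λ i → ∣ y (suc σ + suc i) ∣) ≤ u σ
      noise-right = geometric-right r _ _ λ i i<r → <⇒≤ (≰⇒> λ q →
        not-right (suc σ + suc i) (subst (suc σ + suc i <_) N≡ (+-monoʳ-< (suc σ) (s≤s i<r)))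
          ( subst (suc (suc σ) ≤_) (sym (+-suc (suc σ) i)) (s≤s (m≤m+n (suc σ) i))
          , subst (λ z → u σ ≤ 2 ^ suc z * ∣ y (suc σ + suc i) ∣) (sym (m+n∸m≡n (suc σ) (suc i))) q))
      noise≤ : ∣ L ∣ + ∣ R ∣ ≤ u σ
      noise≤ = *-cancelˡ-≤ 2 (≤-trans (≤-reflexive (*-distribˡ-+ 2 ∣ L ∣ ∣ R ∣))
        (≤-trans (+-mono-≤ (≤-trans (*-monoʳ-≤ 2 (∣∑ℤ∣≤ (suc σ) y)) noise-left)
                           (≤-trans (*-monoʳ-≤ 2 (∣∑ℤ∣≤ r (λ i → y (suc σ + suc i)))) noise-right))
                 (≤-reflexive (cong (u σ +_) (sym (+-identityʳ (u σ)))))))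

    one-test : ∀ σ → σ < T → ℤ.+ 1 ℤ.≤ ∑ℤ N (λ t → Y t σ) →
               16 ≤ (1 + 15 * passes σ) * 16 ^ ∑ N (λ t → ruins t σ)
    one-test σ σ<T 1≤ with Y (suc σ) σ ℤ.≤? ℤ.- ℤ.+ u σ
    ... | no  _ = m≤m*n 16 _ {{m^n≢0 16 (∑ N (λ t → ruins t σ))}}
    ... | yes f with ∑ N (λ t → ruins t σ) in eq
    ...   | zero  = contradiction eq (some-ruin σ σ<T 1≤ f)
    ...   | suc c = ≤-trans (m≤m*n 16 (16 ^ c) {{m^n≢0 16 c}}) (≤-reflexive (sym (+-identityʳ _)))

  -- Each survived test yields a factor 16, either from its own block or from a block that ruins it.
  -- Reordering the double product over tests and blocks gives one weight per block, and the mean of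
  -- such a product factorises.
  survival : (∀ σ → σ < T → ℤ.+ 1 ℤ.≤ ∑ℤ N (λ t → Y t σ)) →
             16 ^ T ≤ ∏ N (λ t → factor t * 16 ^ ∑ T (ruins t))
  survival h = begin
    16 ^ T
      ≡⟨ sym (∏-const T 16) ⟩
    ∏ T (λ _ → 16)
      ≤⟨ ∏-mono T (λ σ p → one-test σ p (h σ p)) ⟩
    ∏ T (λ σ → (1 + 15 * passes σ) * 16 ^ ∑ N (λ t → ruins t σ))
      ≡⟨ ∏-* T _ _ ⟩
    ∏ T (λ σ → 1 + 15 * passes σ) * ∏ T (λ σ → 16 ^ ∑ N (λ t → ruins t σ))
      ≡⟨ cong₂ _*_ (sym factors) exchange ⟩
    ∏ N factor * ∏ N (λ t → 16 ^ ∑ T (ruins t))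
      ≡⟨ sym (∏-* N factor (λ t → 16 ^ ∑ T (ruins t))) ⟩
    ∏ N (λ t → factor t * 16 ^ ∑ T (ruins t)) ∎
    where
    open ≤-Reasoning
    exchange : ∏ T (λ σ → 16 ^ ∑ N (λ t → ruins t σ)) ≡ ∏ N (λ t → 16 ^ ∑ T (ruins t))
    exchange = trans (∏-^ T 16 _) (trans (cong (16 ^_) (∑-swap T N (λ σ t → ruins t σ))) (sym (∏-^ N 16 (λ t → ∑ T (ruins t)))))
    factor-test : ∀ σ → σ < T → factor (suc σ) ≡ 1 + 15 * passes σ
    factor-test σ p = choose-yes (σ <? T) p
    factor-end : factor (suc T) ≡ 1
    factor-end = choose-no (T <? T) (<-irrefl refl)
    factors : ∏ N factor ≡ ∏ T (λ σ → 1 + 15 * passes σ)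
    factors = trans (*-identityˡ _) (trans (∏-last T (factor ∘ suc))
      (trans (cong (∏ T (factor ∘ suc) *_) factor-end) (trans (*-identityʳ _) (∏-cong T factor-test))))

  Upper-left : ∀ t θ b → (∀ i → Left t (t + i) → θ * 256 ^ i ≤ b) → Upper (∑ T (λ σ → 𝟙 (left? t σ))) θ b
  Upper-left t θ b h = ≤-trans (*-monoˡ-≤ θ (^-monoʳ-≤ 256 reindex))
    (≤-trans (count-up T (λ i → left? t (t + i)) θ b (λ i _ → h i)) (m⊔n≤m+n θ (256 * b)))
    where
    reindex : ∑ T (λ σ → 𝟙 (left? t σ)) ≤ ∑ T (λ i → 𝟙 (left? t (t + i)))
    reindex = ≤-trans (∑-len _ (m≤n+m T t)) (≤-reflexive (trans (∑-split t T _)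
      (cong (_+ ∑ T (λ i → 𝟙 (left? t (t + i)))) (∑-zero t λ σ σ<t → 𝟙-no (left? t σ) λ (p , _) →
        <⇒≱ σ<t (≤-pred p)))))

  -- The indices run downwards from block t, hence the reversal.
  Upper-right : ∀ t θ b → t ≤ suc T → (∀ i σ → suc (suc σ) + i ≡ t → Right t σ → θ * 256 ^ i ≤ b) →
                Upper (∑ T (λ σ → 𝟙 (right? t σ))) θ b
  Upper-right zero    θ b t≤ h = ≤-trans (*-monoˡ-≤ θ (≤-reflexive (cong (256 ^_)
    (∑-zero T λ σ _ → 𝟙-no (right? zero σ) λ ())))) (≤-trans (≤-reflexive (*-identityˡ θ)) (m≤m+n θ _))
  Upper-right (suc n) θ b t≤ h = ≤-trans (*-monoˡ-≤ θ (^-monoʳ-≤ 256 (≤-reflexive reindex)))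
    (≤-trans (count-up n (λ i → right? (suc n) (n ∸ suc i)) θ b (λ i i<n → h i (n ∸ suc i)
        (trans (cong suc (sym (+-suc (n ∸ suc i) i))) (cong suc (m∸n+n≡m i<n)))))
      (m⊔n≤m+n θ (256 * b)))
    where
    reindex : ∑ T (λ σ → 𝟙 (right? (suc n) σ)) ≡ ∑ n (λ i → 𝟙 (right? (suc n) (n ∸ suc i)))
    reindex = begin
      ∑ T (λ σ → 𝟙 (right? (suc n) σ))
        ≡⟨ cong (λ z → ∑ z (λ σ → 𝟙 (right? (suc n) σ))) (sym (m+[n∸m]≡n (≤-pred t≤))) ⟩
      ∑ (n + (T ∸ n)) (λ σ → 𝟙 (right? (suc n) σ))
        ≡⟨ ∑-split n (T ∸ n) _ ⟩
      ∑ n (λ σ → 𝟙 (right? (suc n) σ)) + ∑ (T ∸ n) (λ i → 𝟙 (right? (suc n) (n + i)))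
        ≡⟨ cong (∑ n (λ σ → 𝟙 (right? (suc n) σ)) +_) (∑-zero (T ∸ n) λ i _ →
             𝟙-no (right? (suc n) (n + i)) λ (p , _) → <⇒≱ p (s≤s (m≤m+n n i))) ⟩
      ∑ n (λ σ → 𝟙 (right? (suc n) σ)) + 0
        ≡⟨ trans (+-identityʳ _) (∑-reverse n _) ⟩
      ∑ n (λ i → 𝟙 (right? (suc n) (n ∸ suc i))) ∎
      where open ≡-Reasoning

-- Independent blocks of signs.

nthL : ℕ → List (List ℤ) → List ℤ
nthL t       []       = []
nthL zero    (z ∷ zs) = z
nthL (suc t) (z ∷ zs) = nthL t zs

sumBl : List (List ℤ) → (List (List ℤ) → ℕ) → ℕ
sumBl []       F = F []
sumBl (b ∷ bs) F = sumS b (λ z → sumBl bs (λ zs → F (z ∷ zs)))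

SameLengths : List (List ℤ) → List (List ℤ) → Set
SameLengths zs bs = length zs ≡ length bs × (∀ t → length (nthL t zs) ≡ length (nthL t bs))

sumBl-mono : ∀ bs {F G : List (List ℤ) → ℕ} → (∀ zs → SameLengths zs bs → F zs ≤ G zs) → sumBl bs F ≤ sumBl bs G
sumBl-mono []       h = h [] (refl , λ _ → refl)
sumBl-mono (b ∷ bs) h = sumS-mono b λ z e → sumBl-mono bs λ zs (e′ , f) →
  h (z ∷ zs) (cong suc e′ , λ { zero → e ; (suc t) → f t })

sumBl-*ˡ : ∀ bs k (F : List (List ℤ) → ℕ) → sumBl bs (λ zs → k * F zs) ≡ k * sumBl bs F
sumBl-*ˡ []       k F = refl
sumBl-*ˡ (b ∷ bs) k F = trans (sumS-cong b λ z _ → sumBl-*ˡ bs k (F ∘ (z ∷_))) (sumS-*ˡ b k _)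

sumS-concat : ∀ bs (F : List ℤ → ℕ) → sumS (concat bs) F ≡ sumBl bs (F ∘ concat)
sumS-concat []       F = refl
sumS-concat (b ∷ bs) F = trans (sumS-++ b (concat bs) F)
  (sumS-cong b λ z _ → sumS-concat bs (λ z′ → F (z ++ z′)))

-- Independence of the blocks: each factor ψ t reads the signs of block t only.
sumBl-∏ : ∀ bs (ψ : ℕ → List ℤ → ℕ) →
  sumBl bs (λ zs → ∏ (length bs) (λ t → ψ t (nthL t zs))) ≡ ∏ (length bs) (λ t → sumS (nthL t bs) (ψ t))
sumBl-∏ []       ψ = refl
sumBl-∏ (b ∷ bs) ψ = begin
  sumS b (λ z → sumBl bs (λ zs → ψ 0 z * ∏ (length bs) (λ t → ψ (suc t) (nthL t zs))))
    ≡⟨ sumS-cong b (λ z _ → trans (sumBl-*ˡ bs (ψ 0 z) _) (trans (*-comm (ψ 0 z) _) (cong (_* ψ 0 z) (sumBl-∏ bs (ψ ∘ suc))))) ⟩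
  sumS b (λ z → R * ψ 0 z)
    ≡⟨ trans (sumS-*ˡ b R (ψ 0)) (*-comm R _) ⟩
  sumS b (ψ 0) * R ∎
  where
  open ≡-Reasoning
  R = ∏ (length bs) (λ t → sumS (nthL t bs) (ψ (suc t)))

linear-concat : ∀ c zs (off : ℕ → ℕ) → (∀ t → t < length zs → off t + length (nthL t zs) ≡ off (suc t)) →
  linear c (off 0) (concat zs) ≡ ∑ℤ (length zs) (λ t → linear c (off t) (nthL t zs))
linear-concat c []       off h = refl
linear-concat c (z ∷ zs) off h = trans (linear-++ c (off 0) z (concat zs))
  (cong (ℤ._+_ (linear c (off 0) z)) (trans (cong (λ o → linear c o (concat zs)) (h 0 (s≤s z≤n)))
    (linear-concat c zs (off ∘ suc) (λ t p → h (suc t) (s≤s p)))))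

linear-cong : ∀ {c c′ : ℕ → ℕ} o z → (∀ j → o < j → j ≤ o + length z → c j ≡ c′ j) → linear c o z ≡ linear c′ o z
linear-cong o []      h = refl
linear-cong o (x ∷ z) h = cong₂ (λ a b → ℤ.+ a ℤ.* x ℤ.+ b)
  (h (suc o) ≤-refl (subst (suc o ≤_) (sym (+-suc o (length z))) (s≤s (m≤m+n o _))))
  (linear-cong (suc o) z λ j p q → h j (<-trans (n<1+n o) p) (subst (j ≤_) (sym (+-suc o (length z))) q))

linear-scale : ∀ k o z → linear (λ _ → k) o z ≡ ℤ.+ k ℤ.* linear (λ _ → 1) o z
linear-scale k o []      = sym (ℤ.*-zeroʳ (ℤ.+ k))
linear-scale k o (x ∷ z) = trans (cong₂ ℤ._+_ (cong (ℤ._*_ (ℤ.+ k)) (sym (ℤ.*-identityˡ x))) (linear-scale k (suc o) z))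
  (sym (ℤ.*-distribˡ-+ (ℤ.+ k) (ℤ.+ 1 ℤ.* x) _))

countBig : ℕ → (ℕ → ℕ) → ℕ → List ℤ → ℕ
countBig w c o []       = 0
countBig w c o (x ∷ xs) = 𝟙 (w ≤? c (suc o) * ∣ x ∣) + countBig w c (suc o) xs

big-weighted : ∀ w c o xs → LittlewoodOfford.big w (weighted c o xs) ≡ countBig w c o xs
big-weighted w c o []       = refl
big-weighted w c o (x ∷ xs) = cong₂ _+_
  (cong (λ z → 𝟙 (w ≤? z)) (ℤ.abs-* (ℤ.+ c (suc o)) x)) (big-weighted w c (suc o) xs)

-- The mean weight of a block.

*-square : ∀ {a b} → a ≤ b → a * a ≤ b * b
*-square h = *-mono-≤ h h

-- Abstract, lest type checking unfold the literal factors.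
abstract

  endCost testCost : ℕ → ℕ → ℕ
  endCost  θ n = θ + 128 * n
  testCost θ n = 9 * θ + 2048 * n

  endCost-≡ : ∀ θ n → endCost θ n ≡ θ + 128 * n
  endCost-≡ θ n = refl

  testCost-≡ : ∀ θ n → testCost θ n ≡ 9 * θ + 2048 * n
  testCost-≡ θ n = refl

  endCost-mono : ∀ θ {n n′} → n ≤ n′ → endCost θ n ≤ endCost θ n′
  endCost-mono θ h = +-monoʳ-≤ θ (*-monoʳ-≤ 128 h)

  testCost-mono : ∀ θ {n n′} → n ≤ n′ → testCost θ n ≤ testCost θ n′
  testCost-mono θ h = +-monoʳ-≤ (9 * θ) (*-monoʳ-≤ 2048 h)

-- An inner block t holds the indices with a_t² < j ≤ a_{t+1}² = m² a_t², and its test k_t = m a_t²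
-- is their geometric middle. The size w, of order √n, is what a large summand min(j , k) |b_j -
-- a_j| must reach. The equations tie the thresholds together: (32 c a_t)² = k_t / 4 for
-- Littlewood-Offord, e = c m / 4 for the noise.
record Setting : Set where
  field
    T m m₂ c e w : ℕ
    a      : ℕ → ℕ
    a-suc  : ∀ t → a (suc t) ≡ m * a t
    a≥1    : ∀ t → 1 ≤ a t
    m≡     : m ≡ 2 * m₂
    16≤m₂  : 16 ≤ m₂
    cm≡4e  : c * m ≡ 4 * e
    w≥1    : 1 ≤ w
    c≥1    : 1 ≤ c
    km≡    : m * 1 ≡ 4 * ((32 * c) * (32 * c))

module Signs
  (S : Setting) (off : ℕ → ℕ) (off-0 : off 0 ≡ 0)
  (off-mid : ∀ t → 1 ≤ t → t ≤ suc (Setting.T S) → off t ≡ Setting.a S t * Setting.a S t)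
  where

  open Setting S

  -- `u t` is the scale √k_t √n, up to constants, on which the own block spreads. `Θ t` is the
  -- square of the least noise by which block t ruins an adjacent test.
  k u Θ : ℕ → ℕ
  k t = m * (a t * a t)
  u t = c * (a t * w)
  Θ t = e * (a t * w) * (e * (a t * w))

  private
    m≥1 : 1 ≤ m
    m≥1 = subst (1 ≤_) (sym m≡) (≤-trans (≤-trans (s≤s z≤n) 16≤m₂) (m≤m+n m₂ _))

    a-+ : ∀ t i → a (t + i) ≡ m ^ i * a t
    a-+ t zero    = trans (cong a (+-identityʳ t)) (sym (+-identityʳ (a t)))
    a-+ t (suc i) = trans (cong a (+-suc t i)) (trans (a-suc (t + i))
                    (trans (cong (m *_) (a-+ t i)) (sym (*-assoc m (m ^ i) (a t)))))

    k-mono : ∀ t i → k t ≤ k (t + i)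
    k-mono t i = *-monoʳ-≤ m (*-square (subst (a t ≤_) (sym (a-+ t i)) (m≤n*m (a t) (m ^ i) {{m^n≢0 m i {{>-nonZero m≥1}}}})))

    16^≤ : ∀ i x → 2 ^ i * 16 ^ i * x ≤ m ^ i * x
    16^≤ i x = *-monoˡ-≤ x (begin
      2 ^ i * 16 ^ i    ≤⟨ *-monoʳ-≤ (2 ^ i) (^-monoˡ-≤ i 16≤m₂) ⟩
      2 ^ i * m₂ ^ i    ≡⟨ sym (^-distribʳ-* i 2 m₂) ⟩
      (2 * m₂) ^ i      ≡⟨ cong (_^ i) (sym m≡) ⟩
      m ^ i             ∎)
      where open ≤-Reasoning

    squares : ∀ x i p → x * 16 ^ i ≤ p → x * x * 256 ^ i ≤ p * p
    squares x i p h = ≤-trans (≤-reflexive (trans (cong (x * x *_) (^-distribʳ-* i 16 16)) (r x (16 ^ i)))) (*-square h)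
      where
      r : ∀ x y → x * x * (y * y) ≡ x * y * (x * y)
      r = solve-∀

  Yz : ℕ → List ℤ → ℕ → ℤ
  Yz t z σ = linear (_⊓ k (suc σ)) (off t) z

  -- For a test above the block min(j , k) = j, so all these tests receive the same `P t z`. For a
  -- test below it min(j , k) = k, and the contribution is `Q t z` scaled by the ratio of k to
  -- `k t`. One number per side therefore governs all tests that block t can ruin.
  P Q : ℕ → List ℤ → ℤ
  P t z = linear (λ j → j) (off t) z
  Q t z = linear (λ _ → k t) (off t) z

  module Ts (z : List ℤ) = Tests T (λ σ → u (suc σ)) (λ t σ → Yz t z σ)

  -- From one test to the next the threshold u grows by m, of which the power of 2 in `Left` takes
  -- back a factor 2, and m / 2 = m₂ ≥ 16. So ruining the i-th further test needs |P| ≥ 16^i √Θ,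
  -- which squares to the 256^i of `count-up`.
  upper-left : ∀ t z → t ≤ T → off t + length z ≡ off (suc t) →
               Upper (∑ T (λ σ → 𝟙 (Ts.left? z t σ))) (Θ t) (sq (P t z))
  upper-left t z t≤T len = Ts.Upper-left z t (Θ t) (sq (P t z)) λ i (_ , h) →
    squares (e * (a t * w)) i ∣ P t z ∣ (*-cancelˡ-≤ (4 * 2 ^ i) {{m*n≢0 4 (2 ^ i) {{_}} {{m^n≢0 2 i}}}} (begin
      4 * 2 ^ i * (e * (a t * w) * 16 ^ i)    ≡⟨ r₁ (2 ^ i) e (a t) w (16 ^ i) ⟩
      4 * e * (2 ^ i * 16 ^ i * (a t * w))    ≤⟨ *-monoʳ-≤ (4 * e) (16^≤ i (a t * w)) ⟩
      4 * e * (m ^ i * (a t * w))             ≡⟨ cong (_* (m ^ i * (a t * w))) (sym cm≡4e) ⟩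
      c * m * (m ^ i * (a t * w))             ≡⟨ r₂ c m (m ^ i) (a t) w ⟩
      c * (m ^ suc i * a t * w)               ≡⟨ cong (λ q → c * (q * w)) (trans (sym (a-+ t (suc i))) (cong a (+-suc t i))) ⟩
      u (suc (t + i))                         ≤⟨ h ⟩
      2 ^ suc (suc (t + i) ∸ t) * ∣ Yz t z (t + i) ∣
        ≡⟨ cong₂ (λ p q → 2 ^ suc p * ∣ q ∣) (trans (cong (_∸ t) (sym (+-suc t i))) (m+n∸m≡n t (suc i)))
             (linear-cong (off t) z λ j _ j≤ → m≤n⇒m⊓n≡m (≤-trans j≤ (edge i))) ⟩
      2 ^ suc (suc i) * ∣ P t z ∣             ≡⟨ cong (_* ∣ P t z ∣) (sym (*-assoc 2 2 (2 ^ i))) ⟩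
      4 * 2 ^ i * ∣ P t z ∣                   ∎))
    where
    open ≤-Reasoning
    r₁ : ∀ p e a w q → 4 * p * (e * (a * w) * q) ≡ 4 * e * (p * q * (a * w))
    r₁ = solve-∀
    r₂ : ∀ c m p a w → c * m * (p * (a * w)) ≡ c * (m * p * a * w)
    r₂ = solve-∀
    edge : ∀ i → off t + length z ≤ k (suc (t + i))
    edge i = begin
      off t + length z         ≡⟨ trans len (off-mid (suc t) (s≤s z≤n) (s≤s t≤T)) ⟩
      a (suc t) * a (suc t)    ≤⟨ m≤n*m _ m {{>-nonZero m≥1}} ⟩
      k (suc t)                ≤⟨ k-mono (suc t) i ⟩
      k (suc (t + i))          ∎

  -- Downwards the contribution falls by m² per test, as k does, but the threshold only by m; after
  -- the factor 2 for the distance, m / 2 ≥ 16 is left again.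
  upper-right : ∀ t z → 1 ≤ t → t ≤ suc T →
                Upper (∑ T (λ σ → 𝟙 (Ts.right? z t σ))) (Θ t) (sq (Q t z))
  upper-right t z 1≤t t≤ = Ts.Upper-right z t (Θ t) (sq (Q t z)) t≤ λ { i σ refl (_ , h) →
      let s = suc σ
          q = ∣ linear (λ _ → 1) (off (suc s + i)) z ∣
          Yabs : ∣ Yz (suc s + i) z σ ∣ ≡ k s * q
          Yabs = trans (cong ∣_∣ (trans (linear-cong (off (suc s + i)) z λ j off<j _ →
                   m≥n⇒m⊓n≡n (≤-trans (edge s i t≤) (<⇒≤ off<j))) (linear-scale (k s) (off (suc s + i)) z)))
                   (ℤ.abs-* (ℤ.+ k s) _)
          Qabs : ∣ Q (suc s + i) z ∣ ≡ k (suc s + i) * q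
          Qabs = trans (cong ∣_∣ (linear-scale (k (suc s + i)) (off (suc s + i)) z)) (ℤ.abs-* (ℤ.+ k (suc s + i)) _)
          A≡ : a (suc s + i) ≡ m ^ suc i * a s
          A≡ = trans (cong a (sym (+-suc s i))) (a-+ s (suc i))
          core : e * w * 16 ^ i ≤ m * a (suc s + i) * q
          core = *-cancelˡ-≤ (4 * 2 ^ i * a s) {{m*n≢0 (4 * 2 ^ i) (a s) {{m*n≢0 4 (2 ^ i) {{_}} {{m^n≢0 2 i}}}} {{>-nonZero (a≥1 s)}}}} (begin
            4 * 2 ^ i * a s * (e * w * 16 ^ i)        ≡⟨ r₁ (2 ^ i) e (a s) w (16 ^ i) ⟩
            4 * e * (2 ^ i * 16 ^ i * (a s * w))      ≤⟨ *-monoʳ-≤ (4 * e) (16^≤ i (a s * w)) ⟩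
            4 * e * (m ^ i * (a s * w))               ≡⟨ cong (_* (m ^ i * (a s * w))) (sym cm≡4e) ⟩
            c * m * (m ^ i * (a s * w))               ≡⟨ r₂ c m (m ^ i) (a s) w ⟩
            m * m ^ i * u s                           ≤⟨ *-monoʳ-≤ (m ^ suc i) h ⟩
            m ^ suc i * (2 ^ suc (suc s + i ∸ s) * ∣ Yz (suc s + i) z σ ∣)
              ≡⟨ cong₂ (λ x y → m ^ suc i * (2 ^ suc x * y)) (trans (cong (_∸ s) (sym (+-suc s i))) (m+n∸m≡n s (suc i))) Yabs ⟩
            m ^ suc i * (2 ^ suc (suc i) * (k s * q)) ≡⟨ r₃ (m ^ suc i) (2 ^ i) m (a s) q ⟩
            4 * 2 ^ i * a s * (m * (m ^ suc i * a s) * q) ≡⟨ cong (λ x → 4 * 2 ^ i * a s * (m * x * q)) (sym A≡) ⟩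
            4 * 2 ^ i * a s * (m * a (suc s + i) * q) ∎)
      in squares (e * (a (suc s + i) * w)) i ∣ Q (suc s + i) z ∣ (begin
        e * (a (suc s + i) * w) * 16 ^ i         ≡⟨ r₄ e (a (suc s + i)) w (16 ^ i) ⟩
        a (suc s + i) * (e * w * 16 ^ i)         ≤⟨ *-monoʳ-≤ (a (suc s + i)) core ⟩
        a (suc s + i) * (m * a (suc s + i) * q)  ≡⟨ r₅ (a (suc s + i)) m q ⟩
        k (suc s + i) * q                        ≡⟨ sym Qabs ⟩
        ∣ Q (suc s + i) z ∣                      ∎) }
    where
    open ≤-Reasoning
    r₁ : ∀ p e a w q → 4 * p * a * (e * w * q) ≡ 4 * e * (p * q * (a * w))
    r₁ = solve-∀
    r₂ : ∀ c m p a w → c * m * (p * (a * w)) ≡ m * p * (c * (a * w))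
    r₂ = solve-∀
    r₃ : ∀ M p m a q → M * (2 * (2 * p) * (m * (a * a) * q)) ≡ 4 * p * a * (m * (M * a) * q)
    r₃ = solve-∀
    r₄ : ∀ e a w q → e * (a * w) * q ≡ a * (e * w * q)
    r₄ = solve-∀
    r₅ : ∀ a m q → a * (m * a * q) ≡ m * (a * a) * q
    r₅ = solve-∀
    edge : ∀ s i → suc s + i ≤ suc T → k s ≤ off (suc s + i)
    edge s i h = begin
      m * (a s * a s)                      ≤⟨ *-monoʳ-≤ m (m≤n*m (a s * a s) m {{>-nonZero m≥1}}) ⟩
      m * (m * (a s * a s))                ≡⟨ r₆ m (a s) ⟩
      m * a s * (m * a s)                  ≡⟨ cong (λ x → x * x) (sym (a-suc s)) ⟩
      a (suc s) * a (suc s)                ≤⟨ *-square (subst (a (suc s) ≤_) (sym (a-+ (suc s) i))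
                                                (m≤n*m (a (suc s)) (m ^ i) {{m^n≢0 m i {{>-nonZero m≥1}}}})) ⟩
      a (suc s + i) * a (suc s + i)        ≡⟨ sym (off-mid (suc s + i) (s≤s z≤n) h) ⟩
      off (suc s + i)                      ∎
      where
      r₆ : ∀ m a → m * (m * (a * a)) ≡ m * a * (m * a)
      r₆ = solve-∀

  noiseP noiseQ : ℕ → List ℤ → ℕ
  noiseP t b = energy (λ j → j * j) (off t) b
  noiseQ t b = energy (λ _ → k t * k t) (off t) b

  ψ : ℕ → List ℤ → ℕ
  ψ t z = Ts.factor z t * 16 ^ ∑ T (Ts.ruins z t)

  private
    counts : ∀ z t → ∑ T (Ts.ruins z t) ≡ ∑ T (λ σ → 𝟙 (Ts.left? z t σ)) + ∑ T (λ σ → 𝟙 (Ts.right? z t σ))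
    counts z t = ∑-+ T _ _

    average : ∀ b θ A (F : List ℤ → ℕ) → sumS b (λ _ → θ) ≡ 2 ^ length b * θ →
              sumS b F ≡ 2 ^ length b * A → ∀ κ → sumS b (λ z → θ + κ * F z) ≡ 2 ^ length b * (θ + κ * A)
    average b θ A F h h′ κ = trans (sumS-+ b (λ _ → θ) (λ z → κ * F z)) (trans (cong₂ _+_ h (trans (sumS-*ˡ b κ F) (cong (κ *_) h′)))
      (r (2 ^ length b) θ κ A))
      where
      r : ∀ L θ κ A → L * θ + κ * (L * A) ≡ L * (θ + κ * A)
      r = solve-∀

  -- Block 0 has neither a test of its own nor tests below it. Its weight exceeds 1 only through
  -- ruined tests above, and `combine-counts` bounds this by the square of `P`, whose mean is the
  -- noise. `high-block` is the mirror image with `Q`.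
  low-block : ∀ b → off 0 + length b ≡ off 1 →
    sumS b (ψ 0) * Θ 0 ≤ 2 ^ length b * endCost (Θ 0) (noiseP 0 b)
  low-block b len = begin
    sumS b (ψ 0) * Θ 0                       ≡⟨ trans (*-comm _ (Θ 0)) (sym (sumS-*ˡ b (Θ 0) (ψ 0))) ⟩
    sumS b (λ z → Θ 0 * ψ 0 z)               ≤⟨ sumS-mono b pointwise ⟩
    sumS b (λ z → Θ 0 + 128 * sq (P 0 z))    ≡⟨ average b (Θ 0) _ _ (sumS-const b (Θ 0)) (second-moment (λ j → j) (off 0) b) 128 ⟩
    2 ^ length b * (Θ 0 + 128 * noiseP 0 b)  ≡⟨ cong (2 ^ length b *_) (sym (endCost-≡ (Θ 0) (noiseP 0 b))) ⟩
    2 ^ length b * endCost (Θ 0) (noiseP 0 b) ∎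
    where
    open ≤-Reasoning
    pointwise : ∀ z → length z ≡ length b → Θ 0 * ψ 0 z ≤ Θ 0 + 128 * sq (P 0 z)
    pointwise z e = begin
      Θ 0 * ψ 0 z                        ≡⟨ trans (*-comm (Θ 0) _) (cong (_* Θ 0) (trans (*-identityˡ _) (cong (16 ^_) (counts z 0)))) ⟩
      16 ^ (∑ T (λ σ → 𝟙 (Ts.left? z 0 σ)) + ∑ T (λ σ → 𝟙 (Ts.right? z 0 σ))) * Θ 0
        ≤⟨ combine-counts (∑ T (λ σ → 𝟙 (Ts.left? z 0 σ))) _ (Θ 0) (sq (P 0 z)) 0
             (upper-left 0 z z≤n (trans (cong (off 0 +_) e) len))
             (Ts.Upper-right z 0 (Θ 0) 0 z≤n λ i σ ()) ⟩
      Θ 0 + 128 * (sq (P 0 z) + 0)       ≡⟨ cong (λ x → Θ 0 + 128 * x) (+-identityʳ (sq (P 0 z))) ⟩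
      Θ 0 + 128 * sq (P 0 z)             ∎

  high-block : ∀ b →
    sumS b (ψ (suc T)) * Θ (suc T) ≤ 2 ^ length b * endCost (Θ (suc T)) (noiseQ (suc T) b)
  high-block b = begin
    sumS b (ψ t) * Θ t                       ≡⟨ trans (*-comm _ (Θ t)) (sym (sumS-*ˡ b (Θ t) (ψ t))) ⟩
    sumS b (λ z → Θ t * ψ t z)               ≤⟨ sumS-mono b pointwise ⟩
    sumS b (λ z → Θ t + 128 * sq (Q t z))    ≡⟨ average b (Θ t) _ _ (sumS-const b (Θ t)) (second-moment (λ _ → k t) (off t) b) 128 ⟩
    2 ^ length b * (Θ t + 128 * noiseQ t b)  ≡⟨ cong (2 ^ length b *_) (sym (endCost-≡ (Θ t) (noiseQ t b))) ⟩
    2 ^ length b * endCost (Θ t) (noiseQ t b) ∎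
    where
    open ≤-Reasoning
    t = suc T
    factor-end : ∀ z → Ts.factor z t ≡ 1
    factor-end z = choose-no (T <? T) (<-irrefl refl)
    no-left : ∀ z → ∑ T (λ σ → 𝟙 (Ts.left? z t σ)) ≡ 0
    no-left z = ∑-zero T λ σ σ<T → 𝟙-no (Ts.left? z t σ) λ (p , _) → <⇒≱ σ<T (<⇒≤ (≤-pred p))
    pointwise : ∀ z → length z ≡ length b → Θ t * ψ t z ≤ Θ t + 128 * sq (Q t z)
    pointwise z _ = begin
      Θ t * ψ t z                        ≡⟨ trans (*-comm (Θ t) _) (cong (_* Θ t) (cong₂ _*_ (factor-end z) (cong (16 ^_) (counts z t)))) ⟩
      1 * 16 ^ (∑ T (λ σ → 𝟙 (Ts.left? z t σ)) + ∑ T (λ σ → 𝟙 (Ts.right? z t σ))) * Θ t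
        ≡⟨ cong (_* Θ t) (*-identityˡ (16 ^ (∑ T (λ σ → 𝟙 (Ts.left? z t σ)) + ∑ T (λ σ → 𝟙 (Ts.right? z t σ))))) ⟩
      16 ^ (∑ T (λ σ → 𝟙 (Ts.left? z t σ)) + ∑ T (λ σ → 𝟙 (Ts.right? z t σ))) * Θ t
        ≤⟨ combine-counts (∑ T (λ σ → 𝟙 (Ts.left? z t σ))) _ (Θ t) 0 (sq (Q t z))
             (≤-trans (≤-reflexive (trans (cong (λ x → 256 ^ x * Θ t) (no-left z)) (*-identityˡ (Θ t)))) (m≤m+n (Θ t) _))
             (upper-right t z (s≤s z≤n) ≤-refl) ⟩
      Θ t + 128 * sq (Q t z)             ∎

  -- 16 - 15 · 15/32 < 9.
  test-block : ∀ σ b → σ < T → off (suc σ) + length b ≡ off (suc (suc σ)) →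
    k (suc σ) ≤ 4 * countBig w (_⊓ k (suc σ)) (off (suc σ)) b →
    sumS b (ψ (suc σ)) * Θ (suc σ) ≤ 2 ^ length b * testCost (Θ (suc σ)) (noiseP (suc σ) b + noiseQ (suc σ) b)
  test-block σ b σ<T len dense = begin
    sumS b (ψ t) * Θ t
      ≡⟨ trans (*-comm _ (Θ t)) (sym (sumS-*ˡ b (Θ t) (ψ t))) ⟩
    sumS b (λ z → Θ t * ψ t z)
      ≤⟨ sumS-mono b pointwise ⟩
    sumS b (λ z → Θ t * g z + (2048 * sq (P t z) + 2048 * sq (Q t z)))
      ≡⟨ trans (sumS-+ b _ _) (cong₂ _+_ (sumS-*ˡ b (Θ t) g) (trans (sumS-+ b _ _) (cong₂ _+_ (sumS-*ˡ b 2048 _) (sumS-*ˡ b 2048 _)))) ⟩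
    Θ t * sumS b g + (2048 * sumS b (λ z → sq (P t z)) + 2048 * sumS b (λ z → sq (Q t z)))
      ≤⟨ +-mono-≤ (*-monoʳ-≤ (Θ t) g≤) (≤-reflexive (cong₂ (λ x y → 2048 * x + 2048 * y)
           (second-moment (λ j → j) (off t) b) (second-moment (λ _ → k t) (off t) b))) ⟩
    Θ t * (9 * L) + (2048 * (L * noiseP t b) + 2048 * (L * noiseQ t b))
      ≡⟨ r (Θ t) L (noiseP t b) (noiseQ t b) ⟩
    L * (9 * Θ t + 2048 * (noiseP t b + noiseQ t b))
      ≡⟨ cong (L *_) (sym (testCost-≡ (Θ t) (noiseP t b + noiseQ t b))) ⟩
    L * testCost (Θ t) (noiseP t b + noiseQ t b) ∎
    where
    open ≤-Reasoning
    t = suc σ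
    L = 2 ^ length b
    g f : List ℤ → ℕ
    g z = 1 + 15 * 𝟙 (¬? (Yz t z σ ℤ.≤? ℤ.- ℤ.+ u t))
    f z = 𝟙 (Yz t z σ ℤ.≤? ℤ.- ℤ.+ u t)
    r : ∀ θ L p q → θ * (9 * L) + (2048 * (L * p) + 2048 * (L * q)) ≡ L * (9 * θ + 2048 * (p + q))
    r = solve-∀
    g≤16 : ∀ z → g z ≤ 16
    g≤16 z = +-monoʳ-≤ 1 (*-monoʳ-≤ 15 (𝟙≤1 (¬? (Yz t z σ ℤ.≤? ℤ.- ℤ.+ u t))))
    g+f : ∀ z → g z + 15 * f z ≡ 16
    g+f z with Yz t z σ ℤ.≤? ℤ.- ℤ.+ u t
    ... | yes _ = refl
    ... | no  _ = refl
    factor≡ : ∀ z → Ts.factor z t ≡ g z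
    factor≡ z = choose-yes (σ <? T) σ<T
    pointwise : ∀ z → length z ≡ length b → Θ t * ψ t z ≤ Θ t * g z + (2048 * sq (P t z) + 2048 * sq (Q t z))
    pointwise z e = begin
      Θ t * (Ts.factor z t * 16 ^ ∑ T (Ts.ruins z t))
        ≡⟨ cong₂ (λ x y → Θ t * (x * 16 ^ y)) (factor≡ z) (counts z t) ⟩
      Θ t * (g z * 16 ^ (∑ T (λ σ → 𝟙 (Ts.left? z t σ)) + ∑ T (λ σ → 𝟙 (Ts.right? z t σ))))
        ≡⟨ r₁ (Θ t) (g z) _ ⟩
      g z * (16 ^ (∑ T (λ σ → 𝟙 (Ts.left? z t σ)) + ∑ T (λ σ → 𝟙 (Ts.right? z t σ))) * Θ t)
        ≤⟨ *-monoʳ-≤ (g z) (combine-counts (∑ T (λ σ → 𝟙 (Ts.left? z t σ))) _ (Θ t) (sq (P t z)) (sq (Q t z))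
             (upper-left t z σ<T (trans (cong (off t +_) e) len))
             (upper-right t z (s≤s z≤n) (m≤n⇒m≤1+n σ<T))) ⟩
      g z * (Θ t + 128 * (sq (P t z) + sq (Q t z)))
        ≡⟨ *-distribˡ-+ (g z) (Θ t) _ ⟩
      g z * Θ t + g z * (128 * (sq (P t z) + sq (Q t z)))
        -- The factor `g z` is kept in front of Θ, where its mean matters, and bounded by 16 in
        -- front of the noise: 2048 = 16 · 128.
        ≤⟨ +-mono-≤ (≤-reflexive (*-comm (g z) (Θ t))) (*-monoˡ-≤ _ (g≤16 z)) ⟩
      Θ t * g z + 16 * (128 * (sq (P t z) + sq (Q t z)))
        ≡⟨ cong (Θ t * g z +_) (r₂ (sq (P t z)) (sq (Q t z))) ⟩
      Θ t * g z + (2048 * sq (P t z) + 2048 * sq (Q t z)) ∎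
      where
      r₁ : ∀ θ g x → θ * (g * x) ≡ g * (x * θ)
      r₁ = solve-∀
      r₂ : ∀ p q → 16 * (128 * (p + q)) ≡ 2048 * p + 2048 * q
      r₂ = solve-∀
    -- By `km≡`, (32 κ)² with κ = c a_t is k_t / 4, the number of large summands that `dense`
    -- grants.
    many : (32 * (c * a t)) * (32 * (c * a t)) ≤ LittlewoodOfford.big w (weighted (_⊓ k t) (off t) b)
    many = *-cancelˡ-≤ 4 (begin
      4 * ((32 * (c * a t)) * (32 * (c * a t)))    ≡⟨ r₁ c (a t) ⟩
      4 * ((32 * c) * (32 * c)) * (a t * a t)      ≡⟨ cong (_* (a t * a t)) (trans (sym km≡) (*-identityʳ m)) ⟩
      k t                                          ≤⟨ dense ⟩
      4 * countBig w (_⊓ k t) (off t) b            ≡⟨ cong (4 *_) (sym (big-weighted w (_⊓ k t) (off t) b)) ⟩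
      4 * LittlewoodOfford.big w (weighted (_⊓ k t) (off t) b) ∎)
      where
      r₁ : ∀ c a → 4 * ((32 * (c * a)) * (32 * (c * a))) ≡ 4 * ((32 * c) * (32 * c)) * (a * a)
      r₁ = solve-∀
    fails : 15 * L ≤ 32 * sumS b f
    fails = begin
      15 * L
        ≡⟨ cong (λ x → 15 * 2 ^ x) (sym (length-weighted (_⊓ k t) (off t) b)) ⟩
      15 * 2 ^ length (weighted (_⊓ k t) (off t) b)
        ≤⟨ SmallBall.lower-tail w w≥1 (weighted (_⊓ k t) (off t) b) (c * a t) (*-mono-≤ c≥1 (a≥1 t)) many ⟩
      32 * sumσ (weighted (_⊓ k t) (off t) b) (ℤ.+ 0) (λ y → 𝟙 (y ℤ.≤? ℤ.- ℤ.+ (c * a t * w)))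
        ≡⟨ cong (λ x → 32 * sumσ (weighted (_⊓ k t) (off t) b) (ℤ.+ 0) (λ y → 𝟙 (y ℤ.≤? ℤ.- ℤ.+ x))) (*-assoc c (a t) w) ⟩
      32 * sumσ (weighted (_⊓ k t) (off t) b) (ℤ.+ 0) (λ y → 𝟙 (y ℤ.≤? ℤ.- ℤ.+ u t))
        ≡⟨ cong (32 *_) (sym (sumS-linear (_⊓ k t) (off t) b (ℤ.+ 0) (λ y → 𝟙 (y ℤ.≤? ℤ.- ℤ.+ u t)))) ⟩
      32 * sumS b (λ z → 𝟙 ((ℤ.+ 0 ℤ.+ Yz t z σ) ℤ.≤? ℤ.- ℤ.+ u t))
        ≡⟨ cong (32 *_) (sumS-cong b λ z _ → cong (λ y → 𝟙 (y ℤ.≤? ℤ.- ℤ.+ u t)) (ℤ.+-identityˡ (Yz t z σ))) ⟩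
      32 * sumS b f ∎
    g≤ : sumS b g ≤ 9 * L
    g≤ = *-cancelˡ-≤ 32 (+-cancelʳ-≤ (15 * (32 * sumS b f)) _ _ (begin
      32 * sumS b g + 15 * (32 * sumS b f)     ≡⟨ r₁ (sumS b g) (sumS b f) ⟩
      32 * (sumS b g + 15 * sumS b f)
        ≡⟨ cong (32 *_) (trans (cong (sumS b g +_) (sym (sumS-*ˡ b 15 f))) (trans (sym (sumS-+ b g (λ z → 15 * f z)))
             (trans (sumS-cong b λ z _ → g+f z) (sumS-const b 16)))) ⟩
      32 * (L * 16)                            ≤⟨ ≤-by L (r₂ L) ⟩
      32 * (9 * L) + 15 * (15 * L)             ≤⟨ +-monoʳ-≤ (32 * (9 * L)) (*-monoʳ-≤ 15 fails) ⟩
      32 * (9 * L) + 15 * (32 * sumS b f)      ∎))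
      where
      r₁ : ∀ x y → 32 * x + 15 * (32 * y) ≡ 32 * (x + 15 * y)
      r₁ = solve-∀
      r₂ : ∀ L → 32 * (9 * L) + 15 * (15 * L) ≡ 32 * (L * 16) + L
      r₂ = solve-∀

  survives : List ℤ → ℕ
  survives x = ∏ T (λ σ → 𝟙 (ℤ.+ 1 ℤ.≤? linear (_⊓ k (suc σ)) 0 x))

  bound : ℕ → List ℤ → ℕ
  bound zero    b = endCost (Θ 0) (noiseP 0 b)
  bound (suc σ) b = choose (σ <? T) (testCost (Θ (suc σ)) (noiseP (suc σ) b + noiseQ (suc σ) b))
                                    (endCost (Θ (suc T)) (noiseQ (suc T) b))

  bound-test : ∀ σ b → σ < T → bound (suc σ) b ≡ testCost (Θ (suc σ)) (noiseP (suc σ) b + noiseQ (suc σ) b)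
  bound-test σ b p = choose-yes (σ <? T) p

  bound-high : ∀ b → bound (suc T) b ≡ endCost (Θ (suc T)) (noiseQ (suc T) b)
  bound-high b = choose-no (T <? T) (<-irrefl refl)

  private
    N : ℕ
    N = suc (suc T)

    len-concat : ∀ bs → ∏ (length bs) (λ t → 2 ^ length (nthL t bs)) ≡ 2 ^ length (concat bs)
    len-concat []       = refl
    len-concat (b ∷ bs) = trans (cong (2 ^ length b *_) (len-concat bs))
      (trans (sym (^-distribˡ-+-* 2 (length b) (length (concat bs)))) (cong (2 ^_) (sym (length-++ b))))

  module _ (bs : List (List ℤ)) (bs-length : length bs ≡ N)
           (edges : ∀ t → t < N → off t + length (nthL t bs) ≡ off (suc t))
           (dense : ∀ σ → σ < T → k (suc σ) ≤ 4 * countBig w (_⊓ k (suc σ)) (off (suc σ)) (nthL (suc σ) bs))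
           where

    private
      pointwise : ∀ zs → SameLengths zs bs → 16 ^ T * survives (concat zs) ≤ ∏ (length bs) (λ t → ψ t (nthL t zs))
      pointwise zs (len , lens) with ∏-dichotomy T (λ σ → ℤ.+ 1 ℤ.≤? linear (_⊓ k (suc σ)) 0 (concat zs))
      ... | inj₁ e = ≤-trans (≤-reflexive (trans (cong (16 ^ T *_) e) (*-zeroʳ (16 ^ T)))) z≤n
      ... | inj₂ (e , all) = begin
        16 ^ T * survives (concat zs)          ≡⟨ trans (cong (16 ^ T *_) e) (*-identityʳ (16 ^ T)) ⟩
        16 ^ T                                 ≤⟨ Tests.survival T (λ σ → u (suc σ)) (λ t σ → Yz t (nthL t zs) σ)
                                                    (λ σ p → subst (ℤ.+ 1 ℤ.≤_) (decompose σ) (all σ p)) ⟩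
        ∏ N (λ t → Tests.factor T (λ σ → u (suc σ)) (λ t σ → Yz t (nthL t zs) σ) t * 16 ^ ∑ T (Ts.ruins (nthL t zs) t))
          ≡⟨ ∏-cong N (λ t _ → cong (_* 16 ^ ∑ T (Ts.ruins (nthL t zs) t)) (local t)) ⟩
        ∏ N (λ t → ψ t (nthL t zs))            ≡⟨ cong (λ n → ∏ n (λ t → ψ t (nthL t zs))) (sym bs-length) ⟩
        ∏ (length bs) (λ t → ψ t (nthL t zs))  ∎
        where
        open ≤-Reasoning
        decompose : ∀ σ → linear (_⊓ k (suc σ)) 0 (concat zs) ≡ ∑ℤ N (λ t → Yz t (nthL t zs) σ)
        decompose σ = trans (cong (λ o → linear (_⊓ k (suc σ)) o (concat zs)) (sym off-0))
          (trans (linear-concat (_⊓ k (suc σ)) zs off λ t t< → trans (cong (off t +_) (lens t))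
                   (edges t (subst (t <_) (trans len bs-length) t<)))
                 (cong (λ n → ∑ℤ n (λ t → Yz t (nthL t zs) σ)) (trans len bs-length)))
        local : ∀ t → Tests.factor T (λ σ → u (suc σ)) (λ t σ → Yz t (nthL t zs) σ) t ≡ Ts.factor (nthL t zs) t
        local zero = refl
        local (suc σ) = refl

      block : ∀ t → t < N → sumS (nthL t bs) (ψ t) * Θ t ≤ 2 ^ length (nthL t bs) * bound t (nthL t bs)
      block zero    _ = low-block (nthL 0 bs) (edges 0 (s≤s z≤n))
      block (suc σ) t<N = by-cases (σ <? T)
        where
        b = nthL (suc σ) bs
        by-cases : Dec (σ < T) → sumS b (ψ (suc σ)) * Θ (suc σ) ≤ 2 ^ length b * bound (suc σ) b
        by-cases (yes p) = subst (λ z → sumS b (ψ (suc σ)) * Θ (suc σ) ≤ 2 ^ length b * z) (sym (bound-test σ b p))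
                                 (test-block σ b p (edges (suc σ) t<N) (dense σ p))
        by-cases (no ¬p) with ≤-antisym (≤-pred (≤-pred t<N)) (≮⇒≥ ¬p)
        ... | refl = subst (λ z → sumS b (ψ (suc σ)) * Θ (suc σ) ≤ 2 ^ length b * z) (sym (bound-high b)) (high-block b)

    -- On survivors 16^T is at most the product of the block weights. Summed over all signs the
    -- product splits, and each factor is bounded by the cost of its block.
    signs-total : 16 ^ T * sumS (concat bs) survives * ∏ N Θ
                ≤ 2 ^ length (concat bs) * ∏ N (λ t → bound t (nthL t bs))
    signs-total = begin
      16 ^ T * sumS (concat bs) survives * ∏ N Θ
        ≡⟨ cong (_* ∏ N Θ) (trans (cong (16 ^ T *_) (sumS-concat bs survives)) (sym (sumBl-*ˡ bs (16 ^ T) _))) ⟩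
      sumBl bs (λ zs → 16 ^ T * survives (concat zs)) * ∏ N Θ
        ≤⟨ *-monoˡ-≤ (∏ N Θ) (sumBl-mono bs pointwise) ⟩
      sumBl bs (λ zs → ∏ (length bs) (λ t → ψ t (nthL t zs))) * ∏ N Θ
        ≡⟨ cong (_* ∏ N Θ) (trans (sumBl-∏ bs ψ) (cong (λ n → ∏ n (λ t → sumS (nthL t bs) (ψ t))) bs-length)) ⟩
      ∏ N (λ t → sumS (nthL t bs) (ψ t)) * ∏ N Θ
        ≡⟨ sym (∏-* N (λ t → sumS (nthL t bs) (ψ t)) Θ) ⟩
      ∏ N (λ t → sumS (nthL t bs) (ψ t) * Θ t)
        ≤⟨ ∏-mono N block ⟩
      ∏ N (λ t → 2 ^ length (nthL t bs) * bound t (nthL t bs))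
        ≡⟨ ∏-* N (λ t → 2 ^ length (nthL t bs)) (λ t → bound t (nthL t bs)) ⟩
      ∏ N (λ t → 2 ^ length (nthL t bs)) * ∏ N (λ t → bound t (nthL t bs))
        ≡⟨ cong (_* ∏ N (λ t → bound t (nthL t bs))) (trans (cong (λ n → ∏ n (λ t → 2 ^ length (nthL t bs))) (sym bs-length)) (len-concat bs)) ⟩
      2 ^ length (concat bs) * ∏ N (λ t → bound t (nthL t bs)) ∎
      where open ≤-Reasoning

-- Configurations and the deletion of parts.

weight : ℕ → Cfg → ℕ
weight o []            = 0
weight o ((a , b) ∷ c) = suc o * (a + b) + weight (suc o) c

pick : Bool → ℕ × ℕ → ℕ
pick true  = proj₁
pick false = proj₂

bump : Bool → ℕ → ℕ × ℕ → ℕ × ℕ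
bump true  t (a , b) = t + a , b
bump false t (a , b) = a , t + b

ent : Bool → ℕ → Cfg → ℕ
ent s i       []      = 0
ent s zero    (p ∷ c) = pick s p
ent s (suc i) (p ∷ c) = ent s i c

add : Bool → ℕ → ℕ → Cfg → Cfg
add s i       t []      = []
add s zero    t (p ∷ c) = bump s t p ∷ c
add s (suc i) t (p ∷ c) = p ∷ add s i t c

length-add : ∀ s i t c → length (add s i t c) ≡ length c
length-add s i       t []      = refl
length-add s zero    t (p ∷ c) = refl
length-add s (suc i) t (p ∷ c) = cong suc (length-add s i t c)

weight-add : ∀ s i t o c → i < length c → weight o (add s i t c) ≡ weight o c + (suc o + i) * t
weight-add true zero t o ((a , b) ∷ c) _ = e o t a b (weight (suc o) c)
  where
  e : ∀ o t a b r → suc o * (t + a + b) + r ≡ suc o * (a + b) + r + (suc o + 0) * t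
  e = solve-∀
weight-add false zero t o ((a , b) ∷ c) _ = e o t a b (weight (suc o) c)
  where
  e : ∀ o t a b r → suc o * (a + (t + b)) + r ≡ suc o * (a + b) + r + (suc o + 0) * t
  e = solve-∀
weight-add s (suc i) t o ((a , b) ∷ c) (s≤s i<) = trans
  (cong (suc o * (a + b) +_) (trans (weight-add s i t (suc o) c i<)
    (cong (λ z → weight (suc o) c + z * t) (sym (+-suc (suc o) i)))))
  (sym (+-assoc (suc o * (a + b)) _ _))

ent-≤-weight : ∀ s i o c → ent s i c ≤ weight o c
ent-≤-weight s i o [] = z≤n
ent-≤-weight true zero o ((a , b) ∷ c) =
  ≤-trans (≤-trans (m≤m+n a b) (m≤n*m (a + b) (suc o))) (m≤m+n _ _)
ent-≤-weight false zero o ((a , b) ∷ c) =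
  ≤-trans (≤-trans (m≤n+m b a) (m≤n*m (a + b) (suc o))) (m≤m+n _ _)
ent-≤-weight s (suc i) o (p ∷ c) = ≤-trans (ent-≤-weight s i (suc o) c) (m≤n+m _ _)

∑-shift-≤ : ∀ n t (f : ℕ → ℕ) → ∑ n (λ a → 𝟙 (t ≤? a) * f a) ≤ ∑ n (λ a → f (t + a))
∑-shift-≤ n t f = ≤-trans (∑-len _ (m≤n+m n t)) (≤-trans (≤-reflexive (∑-split t n _))
  (≤-trans (+-monoˡ-≤ _ (≤-reflexive (∑-zero t λ i i<t → cong (_* f i) (𝟙-no (t ≤? i) (<⇒≱ i<t)))))
           (∑-mono n λ i _ → 𝟙*≤ (t ≤? (t + i)) (f (t + i)))))

∑-shift-≥ : ∀ n (f : ℕ → ℕ) → f n ≡ 0 → ∑ n (λ a → f (suc a)) ≤ ∑ n (λ a → 𝟙 (1 ≤? a) * f a)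
∑-shift-≥ n f e = ≤-trans (≤-reflexive (∑-cong n λ i _ → sym (+-identityʳ (f (suc i)))))
  (≤-trans (≤-reflexive (∑-last n (λ a → 𝟙 (1 ≤? a) * f a)))
    (≤-trans (+-monoʳ-≤ _ (≤-trans (𝟙*≤ (1 ≤? n) (f n)) (≤-reflexive e))) (≤-reflexive (+-identityʳ _))))

module _ (K : ℕ) where

  private
    inner : ∀ d k (F : ℕ → Cfg → ℕ) → ∑ K (λ b → sumP K d (λ c → k * F b c)) ≡ k * ∑ K (λ b → sumP K d (F b))
    inner d k F = trans (∑-cong K λ b _ → sumP-*ˡ K d k (F b)) (∑-*ˡ K k _)

  -- Substituting t + a for an entry that is at least t deletes t copies of the part. All bounds by
  -- the counts of smaller partitions come from this substitution.
  sumP-shift-≤ : ∀ s d i t (G : Cfg → ℕ) → i < d →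
    sumP K d (λ c → 𝟙 (t ≤? ent s i c) * G c) ≤ sumP K d (λ c → G (add s i t c))
  sumP-shift-≤ true (suc d) zero t G _ =
    ≤-trans (≤-reflexive (∑-cong K λ a _ → inner d (𝟙 (t ≤? a)) (λ b c → G ((a , b) ∷ c))))
            (∑-shift-≤ K t (λ a → ∑ K λ b → sumP K d λ c → G ((a , b) ∷ c)))
  sumP-shift-≤ false (suc d) zero t G _ = ∑-mono K λ a _ →
    ≤-trans (≤-reflexive (∑-cong K λ b _ → sumP-*ˡ K d (𝟙 (t ≤? b)) (λ c → G ((a , b) ∷ c))))
            (∑-shift-≤ K t (λ b → sumP K d λ c → G ((a , b) ∷ c)))
  sumP-shift-≤ s (suc d) (suc i) t G (s≤s i<d) = ∑-mono K λ a _ → ∑-mono K λ b _ →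
    sumP-shift-≤ s d i t (λ c → G ((a , b) ∷ c)) i<d

  -- Putting a part back may leave the box at its upper edge, where G is therefore required to
  -- vanish.
  sumP-shift-≥ : ∀ d i (G : Cfg → ℕ) → i < d → (∀ c → K ≤ ent true i c → G c ≡ 0) →
    sumP K d (λ c → G (add true i 1 c)) ≤ sumP K d (λ c → 𝟙 (1 ≤? ent true i c) * G c)
  sumP-shift-≥ (suc d) zero G _ h =
    ≤-trans (∑-shift-≥ K (λ a → ∑ K λ b → sumP K d λ c → G ((a , b) ∷ c))
              (∑-zero K λ b _ → trans (sumP-cong K d (λ c _ → trans (h ((K , b) ∷ c) ≤-refl) (sym (*-zeroʳ 0)))) (sumP-*ˡ K d 0 (λ _ → 0))))
            (≤-reflexive (sym (∑-cong K λ a _ → inner d (𝟙 (1 ≤? a)) (λ b c → G ((a , b) ∷ c)))))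
  sumP-shift-≥ (suc d) (suc i) G (s≤s i<d) h = ∑-mono K λ a _ → ∑-mono K λ b _ →
    sumP-shift-≥ d i (λ c → G ((a , b) ∷ c)) i<d (λ c → h ((a , b) ∷ c))

-- Ordinary partitions are encoded as configurations with all b_j = 0, where a_j is the multiplicity
-- of the part j. Partitions and Durfee configurations thus share the same sums and shifts.
allB0 : Cfg → ℕ
allB0 []                = 1
allB0 ((a , zero) ∷ c)  = allB0 c
allB0 ((a , suc b) ∷ c) = 0

allB0-add : ∀ i t c → allB0 (add true i t c) ≡ allB0 c
allB0-add i       t []                = refl
allB0-add zero    t ((a , zero) ∷ c)  = refl
allB0-add zero    t ((a , suc b) ∷ c) = refl
allB0-add (suc i) t ((a , zero) ∷ c)  = allB0-add i t c
allB0-add (suc i) t ((a , suc b) ∷ c) = refl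

-- A set of p distinct parts above o has a sum of at least o p + p (p + 1) / 2; the offset carries
-- the induction. At o = 0 this is p² ≤ 2 n.
positives : ∀ n o c → let p = ∑ n (λ i → 𝟙 (1 ≤? ent true i c)) in 2 * (o * p) + p * p ≤ 2 * weight o c
positives zero    o c  = ≤-trans (≤-reflexive (trans (+-identityʳ _) (cong (2 *_) (*-zeroʳ o)))) z≤n
positives (suc n) o [] = ≤-reflexive (trans (cong (λ z → 2 * (o * z) + z * z) (∑-zero (suc n) {λ i → 𝟙 (1 ≤? ent true i [])} λ _ _ → refl))
                                            (trans (+-identityʳ _) (cong (2 *_) (*-zeroʳ o))))
positives (suc n) o ((zero , b) ∷ c) = ≤-trans (≤-trans (≤-by (2 * p) (e o p)) (positives n (suc o) c))
  (*-monoʳ-≤ 2 (m≤n+m _ (suc o * b)))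
  where
  p = ∑ n (λ i → 𝟙 (1 ≤? ent true i c))
  e : ∀ o p → 2 * (suc o * p) + p * p ≡ 2 * (o * p) + p * p + 2 * p
  e = solve-∀
positives (suc n) o ((suc a , b) ∷ c) = begin
  2 * (o * suc p) + suc p * suc p                   ≤⟨ ≤-by 1 (e o p) ⟩
  2 * suc o + (2 * (suc o * p) + p * p)             ≤⟨ +-monoʳ-≤ (2 * suc o) (positives n (suc o) c) ⟩
  2 * suc o + 2 * weight (suc o) c                  ≤⟨ ≤-by (2 * (suc o * (a + b))) (e′ o a b (weight (suc o) c)) ⟩
  2 * (suc o * (suc a + b) + weight (suc o) c)      ∎
  where
  open ≤-Reasoning
  p = ∑ n (λ i → 𝟙 (1 ≤? ent true i c))
  e : ∀ o p → 2 * suc o + (2 * (suc o * p) + p * p) ≡ 2 * (o * suc p) + suc p * suc p + 1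
  e = solve-∀
  e′ : ∀ o a b r → 2 * (suc o * (suc a + b) + r) ≡ 2 * suc o + 2 * r + 2 * (suc o * (a + b))
  e′ = solve-∀

square-cancel : ∀ {x y} → x * x ≤ y * y → x ≤ y
square-cancel {x} {y} h with x ≤? y
... | yes p = p
... | no ¬p = contradiction h (<⇒≱ (*-mono-< (≰⇒> ¬p) (≰⇒> ¬p)))

multiples≤ : ∀ n j x → ∑ n (λ t → j * 𝟙 (j * suc t ≤? x)) ≤ x
multiples≤ zero    j x = z≤n
multiples≤ (suc n) j x with j * suc n ≤? x
... | yes p = ≤-trans (≤-trans (∑-mono (suc n) λ t _ → ≤-trans (*-monoʳ-≤ j (𝟙≤1 (j * suc t ≤? x))) (≤-reflexive (*-identityʳ j)))
                (≤-reflexive (trans (∑-const (suc n) j) (*-comm (suc n) j)))) p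
... | no ¬p = ≤-trans (≤-reflexive (trans (∑-last n (λ t → j * 𝟙 (j * suc t ≤? x)))
    (trans (cong (∑ n (λ t → j * 𝟙 (j * suc t ≤? x)) +_) (trans (cong (j *_) (𝟙-no (j * suc n ≤? x) ¬p)) (*-zeroʳ j))) (+-identityʳ _))))
  (multiples≤ n j x)

odd-sum : ∀ n → ∑ n (λ t → 2 * t + 1) ≡ n * n
odd-sum zero    = refl
odd-sum (suc n) = trans (∑-last n (λ t → 2 * t + 1)) (trans (cong (_+ (2 * n + 1)) (odd-sum n)) (e n))
  where
  e : ∀ n → n * n + (2 * n + 1) ≡ suc n * suc n
  e = solve-∀

-- The measure with weight j² (2 t + 1) at j (t + 1) has mass (j ⌊x / j⌋)² on [0 , x] when n is
-- large enough. This is the hypothesis `S≤` of `Halving` for second moments.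
squares≤ : ∀ n j x → ∑ n (λ t → j * j * (2 * t + 1) * 𝟙 (j * suc t ≤? x)) ≤ x * x
squares≤ zero    j x = z≤n
squares≤ (suc n) j x with j * suc n ≤? x
... | yes p = ≤-trans (≤-trans (∑-mono (suc n) λ t _ → ≤-trans (*-monoʳ-≤ (j * j * (2 * t + 1)) (𝟙≤1 (j * suc t ≤? x))) (≤-reflexive (*-identityʳ (j * j * (2 * t + 1)))))
                (≤-reflexive (trans (∑-*ˡ (suc n) (j * j) (λ t → 2 * t + 1)) (trans (cong (j * j *_) (odd-sum (suc n))) (*-interchange j j (suc n) (suc n))))))
                (*-mono-≤ p p)
... | no ¬p = ≤-trans (≤-reflexive (trans (∑-last n (λ t → j * j * (2 * t + 1) * 𝟙 (j * suc t ≤? x)))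
    (trans (cong (∑ n (λ t → j * j * (2 * t + 1) * 𝟙 (j * suc t ≤? x)) +_) (trans (cong (j * j * (2 * n + 1) *_) (𝟙-no (j * suc n ≤? x) ¬p)) (*-zeroʳ (j * j * (2 * n + 1))))) (+-identityʳ _))))
  (squares≤ n j x)

unary : ∀ n x → x ≤ n → x ≤ ∑ n (λ t → 𝟙 (suc t ≤? x))
unary n       zero    _       = z≤n
unary (suc n) (suc x) (s≤s p) = s≤s (≤-trans (unary n x p)
  (∑-mono n λ t _ → 𝟙-mono (suc t ≤? x) (suc (suc t) ≤? suc x) s≤s))

unary-square : ∀ n x → x ≤ n → x * x ≤ ∑ n (λ t → (2 * t + 1) * 𝟙 (suc t ≤? x))
unary-square n x x≤n = ≤-trans (≤-reflexive (sym (odd-sum x))) (≤-trans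
  (∑-mono x λ t t<x → ≤-reflexive (sym (trans (cong ((2 * t + 1) *_) (𝟙-yes (suc t ≤? x) t<x)) (*-identityʳ _))))
  (∑-len _ x≤n))

-- The partition function: decay and growth.

module Partitions (N₀ K : ℕ) (K≡ : K ≡ suc N₀) where

  N₀≤K : N₀ ≤ K
  N₀≤K = subst (N₀ ≤_) (sym K≡) (n≤1+n N₀)

  K≤⇒N₀< : ∀ {x} → K ≤ x → N₀ < x
  K≤⇒N₀< {x} = subst (_≤ x) K≡

  total? : ∀ y c → Dec (weight 0 c + y ≡ N₀)
  total? y c = weight 0 c + y ℕ.≟ N₀

  plain : ℕ → Cfg → ℕ
  plain y c = allB0 c * 𝟙 (total? y c)

  -- The number of partitions of N₀ - y.
  f : ℕ → ℕ
  f y = sumP K N₀ (plain y)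

  f-zero : ∀ y → N₀ < y → f y ≡ 0
  f-zero y N₀<y = trans (sumP-cong K N₀ (λ c _ → trans (cong (allB0 c *_) (𝟙-no (total? y c)
      λ e → <⇒≱ N₀<y (≤-trans (m≤n+m y (weight 0 c)) (≤-reflexive e)))) (*-zeroʳ (allB0 c))))
    (sumP-*ˡ K N₀ 0 (λ _ → 0))

  total-add : ∀ s i t y c → i < length c → 𝟙 (total? y (add s i t c)) ≡ 𝟙 (total? (y + suc i * t) c)
  total-add s i t y c i< = 𝟙-cong (total? y (add s i t c)) (total? (y + suc i * t) c) (trans (sym e)) (trans e)
    where
    e : weight 0 (add s i t c) + y ≡ weight 0 c + (y + suc i * t)
    e = trans (cong (_+ y) (weight-add s i t 0 c i<)) (trans (+-assoc (weight 0 c) _ y) (cong (weight 0 c +_) (+-comm _ y)))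

  plain-add : ∀ i t y c → i < length c → plain y (add true i t c) ≡ plain (y + suc i * t) c
  plain-add i t y c i< = cong₂ _*_ (allB0-add i t c) (total-add true i t y c i<)

  -- Adding a part i + 1 sends the partitions of N₀ - y - (i + 1) injectively to those partitions of
  -- N₀ - y that contain this part.
  f-shift : ∀ y i → f (y + suc i) ≤ sumP K N₀ (λ c → 𝟙 (1 ≤? ent true i c) * plain y c)
  f-shift y i with i <? N₀
  ... | no ¬p = ≤-trans (≤-reflexive (f-zero (y + suc i) (≤-trans (s≤s (≮⇒≥ ¬p)) (m≤n+m (suc i) y)))) z≤n
  ... | yes p = ≤-trans
    (≤-reflexive (sumP-cong K N₀ λ c e → sym (trans (plain-add i 1 y c (subst (i <_) (sym e) p))
      (cong (λ z → plain (y + z) c) (*-identityʳ (suc i))))))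
    (sumP-shift-≥ K N₀ i (plain y) p λ c K≤ → trans (cong (allB0 c *_) (𝟙-no (total? y c) λ e →
      <⇒≱ (≤-trans (K≤⇒N₀< K≤) (ent-≤-weight true i 0 c)) (≤-trans (m≤m+n (weight 0 c) y) (≤-reflexive e)))) (*-zeroʳ (allB0 c)))

  f-step : ∀ y → f (suc y) ≤ f y
  f-step y = ≤-trans (≤-reflexive (cong f (+-comm 1 y))) (≤-trans (f-shift y 0)
    (sumP-mono K N₀ λ c _ → 𝟙*≤ (1 ≤? ent true 0 c) (plain y c)))

  f-anti : ∀ {x y} → x ≤ y → f y ≤ f x
  f-anti {x} {y} x≤y = subst (λ z → f z ≤ f x) (m+[n∸m]≡n x≤y) (go (y ∸ x))
    where
    go : ∀ n → f (x + n) ≤ f x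
    go zero    = ≤-reflexive (cong f (+-identityʳ x))
    go (suc n) = ≤-trans (≤-reflexive (cong f (+-suc x n))) (≤-trans (f-step (x + n)) (go n))

  -- A partition of n has at most √(2n) distinct parts, and deleting one part b ≤ B from the
  -- partitions of N₀ - y reaches all partitions of N₀ - y - b.
  decay : ∀ R → 2 * N₀ ≤ R * R → ∀ B y → B * f (y + B) ≤ R * f y
  decay R 2N₀≤ B y = begin
    B * f (y + B)                               ≡⟨ sym (∑-const B (f (y + B))) ⟩
    ∑ B (λ _ → f (y + B))                       ≤⟨ ∑-mono B (λ i i<B → ≤-trans (f-anti (+-monoʳ-≤ y i<B)) (f-shift y i)) ⟩
    ∑ B (λ i → sumP K N₀ (λ c → 𝟙 (1 ≤? ent true i c) * plain y c))
      ≡⟨ sym (sumP-∑ K N₀ B _) ⟩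
    sumP K N₀ (λ c → ∑ B (λ i → 𝟙 (1 ≤? ent true i c) * plain y c))
      ≤⟨ sumP-mono K N₀ (λ c _ → ≤-trans (≤-reflexive (∑-*ʳ B (plain y c) _)) (pointwise c)) ⟩
    sumP K N₀ (λ c → R * plain y c)             ≡⟨ sumP-*ˡ K N₀ R (plain y) ⟩
    R * f y                                     ∎
    where
    open ≤-Reasoning
    pointwise : ∀ c → ∑ B (λ i → 𝟙 (1 ≤? ent true i c)) * plain y c ≤ R * plain y c
    pointwise c with total? y c
    ... | no _ rewrite *-zeroʳ (allB0 c) | *-zeroʳ (∑ B (λ i → 𝟙 (1 ≤? ent true i c))) = z≤n
    ... | yes e = *-monoˡ-≤ (allB0 c * 1) (square-cancel {∑ B (λ i → 𝟙 (1 ≤? ent true i c))} {R} (≤-trans (positives B 0 c) (≤-trans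
          (*-monoʳ-≤ 2 (≤-trans (m≤m+n (weight 0 c) y) (≤-reflexive e))) 2N₀≤)))

  private
    Λ : (ℕ → ℕ) → ℕ
    Λ φ = ∑ N₀ λ i → ∑ K λ t → suc i * φ (suc i * suc t)

    Λ-positive : Positive Λ
    Λ-positive = record
      { mono  = λ h → ∑-mono N₀ λ i _ → ∑-mono K λ t _ → *-monoʳ-≤ (suc i) (h (suc i * suc t))
      ; plus  = λ φ ψ → trans (∑-cong N₀ λ i _ → trans (∑-cong K λ t _ → *-distribˡ-+ (suc i) (φ (suc i * suc t)) (ψ (suc i * suc t)))
                  (∑-+ K (λ t → suc i * φ (suc i * suc t)) (λ t → suc i * ψ (suc i * suc t)))) (∑-+ N₀ _ _)
      ; scale = λ k φ → trans (∑-cong N₀ λ i _ → trans (∑-cong K λ t _ → e (suc i) k (φ (suc i * suc t)))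
                  (∑-*ˡ K k (λ t → suc i * φ (suc i * suc t)))) (∑-*ˡ N₀ k _)
      }
      where
      e : ∀ i k x → i * (k * x) ≡ k * (i * x)
      e = solve-∀

    -- The mass is ∑_{j ≤ x} j ⌊x / j⌋ at most: x rows, each of them at most x.
    Λ≤ : ∀ x → Λ (λ y → 𝟙 (y ≤? x)) ≤ x * x
    Λ≤ x = ≤-trans (∑-mono N₀ λ i _ → row i) (≤-trans (≤-reflexive (∑-*ʳ N₀ x (λ i → 𝟙 (suc i ≤? x))))
             (*-monoˡ-≤ x (≤-trans (∑-mono N₀ λ i _ → ≤-trans (𝟙-mono (suc i ≤? x) (1 * suc i ≤? x)
               (subst (_≤ x) (sym (*-identityˡ (suc i))))) (≤-reflexive (sym (*-identityˡ _)))) (multiples≤ N₀ 1 x))))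
      where
      row : ∀ i → ∑ K (λ t → suc i * 𝟙 (suc i * suc t ≤? x)) ≤ 𝟙 (suc i ≤? x) * x
      row i with suc i ≤? x
      ... | yes _ = ≤-trans (multiples≤ K (suc i) x) (≤-reflexive (sym (*-identityˡ x)))
      ... | no ¬p = ≤-reflexive (∑-zero K λ t _ → trans (cong (suc i *_) (𝟙-no (suc i * suc t ≤? x)
                      λ q → ¬p (≤-trans (m≤m*n (suc i) (suc t)) q))) (*-zeroʳ (suc i)))

    weight-plain : ∀ o c → allB0 c * weight o c ≤ allB0 c * ∑ (length c) (λ i → (suc o + i) * ent true i c)
    weight-plain o [] = z≤n
    weight-plain o ((a , suc b) ∷ c) = z≤n
    weight-plain o ((a , zero) ∷ c) = begin
      allB0 c * (suc o * (a + 0) + weight (suc o) c)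
        ≡⟨ *-distribˡ-+ (allB0 c) _ _ ⟩
      allB0 c * (suc o * (a + 0)) + allB0 c * weight (suc o) c
        ≤⟨ +-mono-≤ (≤-reflexive (cong (allB0 c *_) (cong₂ _*_ (sym (+-identityʳ (suc o))) (+-identityʳ a)))) (weight-plain (suc o) c) ⟩
      allB0 c * ((suc o + 0) * a) + allB0 c * ∑ (length c) (λ i → (suc (suc o) + i) * ent true i c)
        ≡⟨ sym (*-distribˡ-+ (allB0 c) _ _) ⟩
      allB0 c * ((suc o + 0) * a + ∑ (length c) (λ i → (suc (suc o) + i) * ent true i c))
        ≡⟨ cong (λ z → allB0 c * ((suc o + 0) * a + z)) (∑-cong (length c) λ i _ → cong (_* ent true i c) (sym (+-suc (suc o) i))) ⟩
      allB0 c * ((suc o + 0) * a + ∑ (length c) (λ i → (suc o + suc i) * ent true i c)) ∎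
      where open ≤-Reasoning

  -- Euler's recurrence n p(n) = ∑ j p(n - j t), as an upper bound.
  recurrence : ∀ y → (N₀ ∸ y) * f y ≤ Λ (λ z → f (y + z))
  recurrence y = begin
    (N₀ ∸ y) * f y
      ≡⟨ sym (sumP-*ˡ K N₀ (N₀ ∸ y) (plain y)) ⟩
    sumP K N₀ (λ c → (N₀ ∸ y) * plain y c)
      ≤⟨ sumP-mono K N₀ pointwise ⟩
    sumP K N₀ (λ c → ∑ N₀ λ i → ∑ K λ t → suc i * (𝟙 (suc t ≤? ent true i c) * plain y c))
      ≡⟨ trans (sumP-∑ K N₀ N₀ (λ i c → ∑ K λ t → suc i * part i t c)) (∑-cong N₀ λ i _ →
           trans (sumP-∑ K N₀ K (λ t c → suc i * part i t c)) (∑-cong K λ t _ → sumP-*ˡ K N₀ (suc i) (part i t))) ⟩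
    (∑ N₀ λ i → ∑ K λ t → suc i * sumP K N₀ (λ c → 𝟙 (suc t ≤? ent true i c) * plain y c))
      ≤⟨ ∑-mono N₀ (λ i i< → ∑-mono K λ t _ → *-monoʳ-≤ (suc i) (≤-trans (sumP-shift-≤ K true N₀ i (suc t) (plain y) i<)
           (≤-reflexive (sumP-cong K N₀ λ c e → plain-add i (suc t) y c (subst (i <_) (sym e) i<))))) ⟩
    Λ (λ z → f (y + z)) ∎
    where
    open ≤-Reasoning
    part : ℕ → ℕ → Cfg → ℕ
    part i t c = 𝟙 (suc t ≤? ent true i c) * plain y c
    pointwise : ∀ c → length c ≡ N₀ → (N₀ ∸ y) * plain y c ≤ ∑ N₀ λ i → ∑ K λ t → suc i * (𝟙 (suc t ≤? ent true i c) * plain y c)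
    pointwise c len with total? y c
    ... | no _ rewrite *-zeroʳ (allB0 c) | *-zeroʳ (N₀ ∸ y) = z≤n
    ... | yes e = begin
      (N₀ ∸ y) * (allB0 c * 1)
        ≡⟨ cong₂ _*_ (trans (cong (_∸ y) (sym e)) (m+n∸n≡m (weight 0 c) y)) (*-identityʳ (allB0 c)) ⟩
      weight 0 c * allB0 c
        ≡⟨ *-comm (weight 0 c) (allB0 c) ⟩
      allB0 c * weight 0 c
        ≤⟨ weight-plain 0 c ⟩
      allB0 c * ∑ (length c) (λ i → suc i * ent true i c)
        ≡⟨ trans (*-comm (allB0 c) _) (cong (λ n → ∑ n (λ i → suc i * ent true i c) * allB0 c) len) ⟩
      ∑ N₀ (λ i → suc i * ent true i c) * allB0 c
        ≡⟨ sym (∑-*ʳ N₀ (allB0 c) _) ⟩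
      ∑ N₀ (λ i → suc i * ent true i c * allB0 c)
        ≤⟨ ∑-mono N₀ (λ i _ → ≤-trans (*-monoˡ-≤ (allB0 c) (*-monoʳ-≤ (suc i) (unary K (ent true i c)
             (≤-trans (ent-≤-weight true i 0 c) (≤-trans (m≤m+n (weight 0 c) y) (≤-trans (≤-reflexive e) N₀≤K))))))
             (≤-reflexive (trans (*-assoc (suc i) (∑ K (ind i)) (allB0 c)) (trans (cong (suc i *_) (sym (∑-*ʳ K (allB0 c) (ind i))))
                (sym (∑-*ˡ K (suc i) (λ t → ind i t * allB0 c))))))) ⟩
      (∑ N₀ λ i → ∑ K λ t → suc i * (𝟙 (suc t ≤? ent true i c) * allB0 c))
        ≡⟨ (∑-cong N₀ λ i _ → ∑-cong K λ t _ → cong (λ z → suc i * (𝟙 (suc t ≤? ent true i c) * z)) (sym (*-identityʳ (allB0 c)))) ⟩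
      (∑ N₀ λ i → ∑ K λ t → suc i * (𝟙 (suc t ≤? ent true i c) * (allB0 c * 1))) ∎
      where
      ind : ℕ → ℕ → ℕ
      ind i t = 𝟙 (suc t ≤? ent true i c)

  module Growth (D : ℕ) (D≥1 : 1 ≤ D) (half : ∀ y → 2 * f (y + D) ≤ f y) where

    -- Euler's sum is cut at B: the near terms amount to at most B² f y, and the rest is the tail of
    -- `Halving`. So if N₀ - y exceeds B² by a constant factor, f (y + B) is at least a constant
    -- share of f y.
    growth : ∀ B y → (N₀ ∸ y) * f y ≤ B * B * f y + (B * B + 4 * (D * B) + 6 * (D * D)) * f (y + B)
    growth B y = begin
      (N₀ ∸ y) * f y
        ≤⟨ recurrence y ⟩
      Λ (λ z → f (y + z))
        ≤⟨ Positive.mono Λ-positive split ⟩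
      Λ (λ z → f y * 𝟙 (z ≤? B) + f (y + (z ⊔ B)))
        ≡⟨ trans (Positive.plus Λ-positive (λ z → f y * 𝟙 (z ≤? B)) (λ z → f (y + (z ⊔ B))))
             (cong (_+ Λ (λ z → f (y + (z ⊔ B)))) (Positive.scale Λ-positive (f y) (λ z → 𝟙 (z ≤? B)))) ⟩
      f y * Λ (λ z → 𝟙 (z ≤? B)) + Λ (λ z → f (y + (z ⊔ B)))
        ≤⟨ +-mono-≤ (≤-trans (*-monoʳ-≤ (f y) (Λ≤ B)) (≤-reflexive (*-comm (f y) (B * B))))
             (Halving.V-bound Λ Λ-positive Λ≤ (λ z → f (y + z)) (λ h → f-anti (+-monoʳ-≤ y h)) D D≥1
               (λ x → subst (λ z → 2 * f z ≤ f (y + x)) (+-assoc y x D) (half (y + x)))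
               K (λ x h → f-zero (y + x) (≤-trans (K≤⇒N₀< h) (m≤n+m x y))) B) ⟩
      B * B * f y + (B * B + 4 * (D * B) + 6 * (D * D)) * f (y + B) ∎
      where
      open ≤-Reasoning
      split : ∀ z → f (y + z) ≤ f y * 𝟙 (z ≤? B) + f (y + (z ⊔ B))
      split z with z ≤? B
      ... | yes _ = ≤-trans (f-anti (m≤m+n y z)) (≤-trans (≤-reflexive (sym (*-identityʳ (f y)))) (m≤m+n _ _))
      ... | no ¬p = ≤-trans (≤-reflexive (cong (λ x → f (y + x)) (sym (m≥n⇒m⊔n≡m (<⇒≤ (≰⇒> ¬p)))))) (m≤n+m _ _)

-- Moments of the multiplicities.

ent-add-other : ∀ s s′ i i′ t c → i ≢ i′ → ent s′ i′ (add s i t c) ≡ ent s′ i′ c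
ent-add-other s s′ i       i′       t []      _ = refl
ent-add-other s s′ zero    zero     t (p ∷ c) ≢ = contradiction refl ≢
ent-add-other s s′ zero    (suc i′) t (p ∷ c) _ = refl
ent-add-other s s′ (suc i) zero     t (p ∷ c) _ = refl
ent-add-other s s′ (suc i) (suc i′) t (p ∷ c) ≢ = ent-add-other s s′ i i′ t c (≢ ∘ cong suc)

ent-long : ∀ s i c → length c ≤ i → ent s i c ≡ 0
ent-long s i       []      _       = refl
ent-long s (suc i) (p ∷ c) (s≤s h) = ent-long s i c h

window : ∀ n lo w → ∑ n (λ a → 𝟙 ((lo ≤? a) ×-dec (a <? lo + w))) ≤ w
window n lo w = begin
  ∑ n g                                       ≤⟨ ∑-len g (m≤n+m n (lo + w)) ⟩
  ∑ (lo + w + n) g                            ≡⟨ trans (∑-split (lo + w) n g) (cong (_+ ∑ n (λ i → g (lo + w + i))) (∑-split lo w g)) ⟩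
  (∑ lo g + ∑ w (λ i → g (lo + i))) + ∑ n (λ i → g (lo + w + i))
    ≡⟨ cong₂ (λ x y → (x + ∑ w (λ i → g (lo + i))) + y)
         (∑-zero lo λ a a<lo → 𝟙-no ((lo ≤? a) ×-dec (a <? lo + w)) λ (p , _) → <⇒≱ a<lo p)
         (∑-zero n λ i _ → 𝟙-no ((lo ≤? (lo + w + i)) ×-dec ((lo + w + i) <? lo + w)) λ (_ , q) → <⇒≱ q (m≤m+n (lo + w) i)) ⟩
  ∑ w (λ i → g (lo + i)) + 0                  ≡⟨ +-identityʳ _ ⟩
  ∑ w (λ i → g (lo + i))                      ≤⟨ ∑-mono w (λ i _ → 𝟙≤1 ((lo ≤? (lo + i)) ×-dec ((lo + i) <? lo + w))) ⟩
  ∑ w (λ _ → 1)                               ≡⟨ trans (∑-const w 1) (*-identityʳ w) ⟩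
  w                                           ∎
  where
  open ≤-Reasoning
  g : ℕ → ℕ
  g a = 𝟙 ((lo ≤? a) ×-dec (a <? lo + w))

near≤ : ∀ n b α → ∑ n (λ a → 𝟙 (ℕ.∣ a - b ∣ <? α)) ≤ 2 * α
near≤ n b α = ≤-trans (∑-mono n λ a _ → 𝟙-mono (ℕ.∣ a - b ∣ <? α) (((b ∸ α) ≤? a) ×-dec (a <? (b ∸ α) + 2 * α))
    λ h → m≤n+o⇒m∸n≤o b α (≤-trans (m≤n+∣n-m∣ b a) (≤-trans (≤-reflexive (+-comm a _)) (+-monoˡ-≤ a (<⇒≤ h))))
        , ≤-trans (s≤s (m≤n+∣m-n∣ a b)) (≤-trans (≤-reflexive (sym (+-suc b _))) (≤-trans (+-monoʳ-≤ b h)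
            (≤-trans (+-monoˡ-≤ α (m≤n+m∸n b α)) (≤-reflexive (e α (b ∸ α)))))))
  (window n (b ∸ α) (2 * α))
  where
  e : ∀ α z → α + z + α ≡ z + 2 * α
  e = solve-∀

-- The telescoping estimate ∑_{j > lo} 1 / j² ≤ 1 / lo, multiplied out.
reciprocal-squares : ∀ n lo (T : ℕ → ℕ) X → (∀ i → i < n → suc (lo + i) * suc (lo + i) * T i ≤ X) → lo * ∑ n T ≤ X
reciprocal-squares zero    lo T X h = ≤-trans (≤-reflexive (*-zeroʳ lo)) z≤n
reciprocal-squares (suc n) lo T X h = *-cancelˡ-≤ (suc lo * suc lo) (begin
  suc lo * suc lo * (lo * (T 0 + R))                         ≡⟨ e₁ lo (T 0) R ⟩
  lo * (suc lo * suc lo * T 0) + lo * (suc lo * (suc lo * R))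
    ≤⟨ +-mono-≤ (*-monoʳ-≤ lo (subst (λ z → suc z * suc z * T 0 ≤ X) (+-identityʳ lo) (h 0 (s≤s z≤n))))
         (*-monoʳ-≤ lo (*-monoʳ-≤ (suc lo) (reciprocal-squares n (suc lo) (T ∘ suc) X
           λ i i<n → subst (λ z → suc z * suc z * T (suc i) ≤ X) (+-suc lo i) (h (suc i) (s≤s i<n))))) ⟩
  lo * X + lo * (suc lo * X)                                 ≤⟨ ≤-by X (e₂ lo X) ⟩
  suc lo * suc lo * X                                        ∎)
  where
  open ≤-Reasoning
  R = ∑ n (T ∘ suc)
  e₁ : ∀ lo t R → suc lo * suc lo * (lo * (t + R)) ≡ lo * (suc lo * suc lo * t) + lo * (suc lo * (suc lo * R))
  e₁ = solve-∀
  e₂ : ∀ lo X → suc lo * suc lo * X ≡ lo * X + lo * (suc lo * X) + X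
  e₂ = solve-∀

size : Cfg → ℕ
size c = length c * length c + weight 0 c

module Omega (N₀ K : ℕ) (K≡ : K ≡ suc N₀) where

  open Partitions N₀ K K≡

  ΣΩ : (Cfg → ℕ) → ℕ
  ΣΩ F = ∑ K λ d → sumP K d F

  ΣΩ-mono : ∀ {F G : Cfg → ℕ} → (∀ c → F c ≤ G c) → ΣΩ F ≤ ΣΩ G
  ΣΩ-mono h = ∑-mono K λ d _ → sumP-mono K d λ c _ → h c

  ΣΩ-cong : ∀ {F G : Cfg → ℕ} → (∀ c → F c ≡ G c) → ΣΩ F ≡ ΣΩ G
  ΣΩ-cong h = ∑-cong K λ d _ → sumP-cong K d λ c _ → h c

  ΣΩ-+ : ∀ (F G : Cfg → ℕ) → ΣΩ (λ c → F c + G c) ≡ ΣΩ F + ΣΩ G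
  ΣΩ-+ F G = trans (∑-cong K λ d _ → sumP-+ K d F G) (∑-+ K (λ d → sumP K d F) (λ d → sumP K d G))

  ΣΩ-*ˡ : ∀ k (F : Cfg → ℕ) → ΣΩ (λ c → k * F c) ≡ k * ΣΩ F
  ΣΩ-*ˡ k F = trans (∑-cong K λ d _ → sumP-*ˡ K d k F) (∑-*ˡ K k (λ d → sumP K d F))

  ΣΩ-∑ : ∀ n (F : ℕ → Cfg → ℕ) → ΣΩ (λ c → ∑ n λ i → F i c) ≡ ∑ n (λ i → ΣΩ (F i))
  ΣΩ-∑ n F = trans (∑-cong K λ d _ → sumP-∑ K d n F) (∑-swap K n λ d i → sumP K d (F i))

  exactly? : ∀ y c → Dec (size c + y ≡ N₀)
  exactly? y c = size c + y ℕ.≟ N₀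

  within? : ∀ y c → Dec (size c + y ≤ N₀)
  within? y c = size c + y ≤? N₀

  -- Invariance under enlarging the entry expresses that F ignores it, in the form that fits the
  -- substitution of `sumP-shift-≤`.
  Indep : Bool → ℕ → (Cfg → ℕ) → Set
  Indep s i F = ∀ t c → F (add s i t c) ≡ F c

  size-add : ∀ s i t y c → i < length c → size (add s i t c) + y ≡ size c + (y + suc i * t)
  size-add s i t y c i< = begin
    length (add s i t c) * length (add s i t c) + weight 0 (add s i t c) + y
      ≡⟨ cong₂ (λ p q → p * p + q + y) (length-add s i t c) (weight-add s i t 0 c i<) ⟩
    length c * length c + (weight 0 c + suc i * t) + y
      ≡⟨ e (length c * length c) (weight 0 c) (suc i * t) y ⟩
    size c + (y + suc i * t) ∎
    where
    open ≡-Reasoning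
    e : ∀ a b x y → a + (b + x) + y ≡ a + b + (y + x)
    e = solve-∀

  ΣΩ-shift : ∀ s i t y F → Indep s i F →
    ΣΩ (λ c → 𝟙 (suc t ≤? ent s i c) * (F c * 𝟙 (exactly? y c))) ≤ ΣΩ (λ c → F c * 𝟙 (exactly? (y + suc i * suc t) c))
  ΣΩ-shift s i t y F inv = ∑-mono K λ d _ → by-cases d (i <? d)
    where
    by-cases : ∀ d → Dec (i < d) → sumP K d (λ c → 𝟙 (suc t ≤? ent s i c) * (F c * 𝟙 (exactly? y c)))
                                 ≤ sumP K d (λ c → F c * 𝟙 (exactly? (y + suc i * suc t) c))
    by-cases d (yes i<d) = ≤-trans (sumP-shift-≤ K s d i (suc t) _ i<d) (≤-reflexive (sumP-cong K d λ c e →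
      cong₂ _*_ (inv (suc t) c) (𝟙-cong (exactly? y (add s i (suc t) c)) (exactly? (y + suc i * suc t) c)
        (trans (sym (size-add s i (suc t) y c (subst (i <_) (sym e) i<d))))
        (trans (size-add s i (suc t) y c (subst (i <_) (sym e) i<d))))))
    by-cases d (no i≮d) = sumP-mono K d λ c e → ≤-trans (≤-reflexive (cong (_* (F c * 𝟙 (exactly? y c)))
      (𝟙-no (suc t ≤? ent s i c) λ h → 1+n≰n (≤-trans (s≤s (z≤n {t})) (subst (suc t ≤_)
        (ent-long s i c (subst (_≤ i) (sym e) (≮⇒≥ i≮d))) h))))) z≤n

  module UpperTail (D : ℕ) (D≥1 : 1 ≤ D) (half : ∀ y → 2 * f (y + D) ≤ f y) (y₀ : ℕ) where

    -- A bound for the mean of F relative to f y. It is demanded for all y ≥ y₀ because the deletion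
    -- of parts increases y.
    Dom : (Cfg → ℕ) → ℕ → Set
    Dom F C = ∀ y → y₀ ≤ y → ΣΩ (λ c → F c * 𝟙 (exactly? y c)) ≤ C * f y

    private
      Λ : ℕ → (ℕ → ℕ) → ℕ
      Λ j φ = ∑ K λ t → j * j * (2 * t + 1) * φ (j * suc t)

      Λ-positive : ∀ j → Positive (Λ j)
      Λ-positive j = record
        { mono  = λ h → ∑-mono K λ t _ → *-monoʳ-≤ (j * j * (2 * t + 1)) (h (j * suc t))
        ; plus  = λ φ ψ → trans (∑-cong K λ t _ → *-distribˡ-+ (j * j * (2 * t + 1)) (φ (j * suc t)) (ψ (j * suc t)))
                    (∑-+ K (λ t → j * j * (2 * t + 1) * φ (j * suc t)) (λ t → j * j * (2 * t + 1) * ψ (j * suc t)))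
        ; scale = λ k φ → trans (∑-cong K λ t _ → e (j * j * (2 * t + 1)) k (φ (j * suc t)))
                    (∑-*ˡ K k (λ t → j * j * (2 * t + 1) * φ (j * suc t)))
        }
        where
        e : ∀ i k x → i * (k * x) ≡ k * (i * x)
        e = solve-∀

      second-moment-f : ∀ j y → Λ j (λ z → f (y + z)) ≤ 6 * (D * D) * f y
      second-moment-f j y = begin
        Λ j (λ z → f (y + z))         ≡⟨ (∑-cong K λ t _ → cong (λ z → j * j * (2 * t + 1) * f (y + z)) (sym (⊔-identityʳ (j * suc t)))) ⟩
        Λ j (λ z → f (y + (z ⊔ 0)))   ≤⟨ Halving.V-bound (Λ j) (Λ-positive j) (squares≤ K j) (λ z → f (y + z))
                                           (λ h → f-anti (+-monoʳ-≤ y h)) D D≥1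
                                           (λ x → subst (λ z → 2 * f z ≤ f (y + x)) (+-assoc y x D) (half (y + x)))
                                           K (λ x h → f-zero (y + x) (≤-trans (K≤⇒N₀< h) (m≤n+m x y))) 0 ⟩
        (4 * (D * 0) + 6 * (D * D)) * f (y + 0)
          ≡⟨ cong₂ (λ p q → (4 * p + 6 * (D * D)) * f q) (*-zeroʳ D) (+-identityʳ y) ⟩
        6 * (D * D) * f y             ∎
        where open ≤-Reasoning

    -- The square x² is the sum of the odd numbers 2 t + 1 with t < x. Deleting t + 1 copies of j
    -- moves y to y + j (t + 1), and the weighted sum of f over these places is at most 6 D² f y by
    -- `Halving`. So j times its multiplicity is of order D in mean square, even next to another
    -- factor F that ignores this entry.
    Dom-square : ∀ F C s i → Dom F C → Indep s i F →
      Dom (λ c → F c * (suc i * suc i * (ent s i c * ent s i c))) (6 * (D * D) * C)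
    Dom-square F C s i dom inv y y₀≤y = begin
      ΣΩ (λ c → F c * (j * j * (ent s i c * ent s i c)) * 𝟙 (exactly? y c))
        ≤⟨ ΣΩ-mono pointwise ⟩
      ΣΩ (λ c → ∑ K λ t → κ t * part t c)
        ≡⟨ trans (ΣΩ-∑ K (λ t c → κ t * part t c)) (∑-cong K λ t _ → ΣΩ-*ˡ (κ t) (part t)) ⟩
      ∑ K (λ t → κ t * ΣΩ (part t))
        ≤⟨ (∑-mono K λ t _ → *-monoʳ-≤ (κ t) (≤-trans (ΣΩ-shift s i t y F inv)
              (dom (y + j * suc t) (≤-trans y₀≤y (m≤m+n y _))))) ⟩
      ∑ K (λ t → κ t * (C * f (y + j * suc t)))
        ≡⟨ trans (∑-cong K λ t _ → e (κ t) C (f (y + j * suc t))) (∑-*ˡ K C (λ t → κ t * f (y + j * suc t))) ⟩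
      C * Λ j (λ z → f (y + z))
        ≤⟨ *-monoʳ-≤ C (second-moment-f j y) ⟩
      C * (6 * (D * D) * f y)
        ≡⟨ e′ C (6 * (D * D)) (f y) ⟩
      6 * (D * D) * C * f y ∎
      where
      open ≤-Reasoning
      j = suc i
      κ : ℕ → ℕ
      κ t = j * j * (2 * t + 1)
      part : ℕ → Cfg → ℕ
      part t c = 𝟙 (suc t ≤? ent s i c) * (F c * 𝟙 (exactly? y c))
      e : ∀ i k x → i * (k * x) ≡ k * (i * x)
      e = solve-∀
      e′ : ∀ C d x → C * (d * x) ≡ d * C * x
      e′ = solve-∀
      pointwise : ∀ c → F c * (j * j * (ent s i c * ent s i c)) * 𝟙 (exactly? y c) ≤ ∑ K λ t → κ t * part t c
      pointwise c with exactly? y c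
      ... | no _ = ≤-trans (≤-reflexive (*-zeroʳ (F c * (j * j * (ent s i c * ent s i c))))) z≤n
      ... | yes eq = begin
        F c * (j * j * (x * x)) * 1
          ≡⟨ r₁ (F c) (j * j) (x * x) ⟩
        F c * 1 * (j * j) * (x * x)
          ≤⟨ *-monoʳ-≤ (F c * 1 * (j * j)) (unary-square K x (≤-trans (ent-≤-weight s i 0 c)
               (≤-trans (≤-trans (m≤n+m (weight 0 c) (length c * length c)) (m≤m+n (size c) y)) (≤-trans (≤-reflexive eq) N₀≤K)))) ⟩
        F c * 1 * (j * j) * ∑ K (λ t → (2 * t + 1) * 𝟙 (suc t ≤? x))
          ≡⟨ sym (∑-*ˡ K (F c * 1 * (j * j)) (λ t → (2 * t + 1) * 𝟙 (suc t ≤? x))) ⟩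
        ∑ K (λ t → F c * 1 * (j * j) * ((2 * t + 1) * 𝟙 (suc t ≤? x)))
          ≡⟨ (∑-cong K λ t _ → r₂ (F c * 1) (j * j) (2 * t + 1) (𝟙 (suc t ≤? x))) ⟩
        ∑ K (λ t → κ t * (𝟙 (suc t ≤? x) * (F c * 1))) ∎
        where
        x = ent s i c
        r₁ : ∀ F j x → F * (j * x) * 1 ≡ F * 1 * j * x
        r₁ = solve-∀
        r₂ : ∀ F j t o → F * j * (t * o) ≡ j * t * (o * F)
        r₂ = solve-∀

    Dom-+ : ∀ F G C C′ → Dom F C → Dom G C′ → Dom (λ c → F c + G c) (C + C′)
    Dom-+ F G C C′ h h′ y p = ≤-trans (≤-reflexive (trans (ΣΩ-cong λ c → *-distribʳ-+ (𝟙 (exactly? y c)) (F c) (G c))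
      (ΣΩ-+ (λ c → F c * 𝟙 (exactly? y c)) (λ c → G c * 𝟙 (exactly? y c)))))
      (≤-trans (+-mono-≤ (h y p) (h′ y p)) (≤-reflexive (sym (*-distribʳ-+ (f y) C C′))))

    Dom-*ˡ : ∀ k F C → Dom F C → Dom (λ c → k * F c) (k * C)
    Dom-*ˡ k F C h y p = ≤-trans (≤-reflexive (trans (ΣΩ-cong λ c → *-assoc k (F c) (𝟙 (exactly? y c)))
      (ΣΩ-*ˡ k (λ c → F c * 𝟙 (exactly? y c)))))
      (≤-trans (*-monoʳ-≤ k (h y p)) (≤-reflexive (sym (*-assoc k C (f y)))))

    Dom-≤ : ∀ F G C C′ → (∀ c → F c ≤ G c) → C ≤ C′ → Dom G C → Dom F C′
    Dom-≤ F G C C′ F≤G C≤C′ h y p = ≤-trans (ΣΩ-mono λ c → *-monoˡ-≤ (𝟙 (exactly? y c)) (F≤G c))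
      (≤-trans (h y p) (*-monoˡ-≤ (f y) C≤C′))

    Indep-from : ℕ → (Cfg → ℕ) → Set
    Indep-from lo F = ∀ s i → lo ≤ i → Indep s i F

    squares : ℕ → Cfg → ℕ
    squares i c = ent true i c * ent true i c + ent false i c * ent false i c

    Dom-squares : ∀ F C i → Dom F C → (∀ s → Indep s i F) →
      Dom (λ c → F c * (suc i * suc i * squares i c)) (12 * (D * D) * C)
    Dom-squares F C i dom inv = Dom-≤ _ (λ c → part true c + part false c) (6 * (D * D) * C + 6 * (D * D) * C) _ (λ c → ≤-reflexive (e₁ (F c) (suc i * suc i) (ent true i c * ent true i c) (ent false i c * ent false i c)))
      (≤-reflexive (e₂ (D * D) C)) (Dom-+ (part true) (part false) (6 * (D * D) * C) (6 * (D * D) * C)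
        (Dom-square F C true i dom (inv true)) (Dom-square F C false i dom (inv false)))
      where
      part : Bool → Cfg → ℕ
      part s c = F c * (suc i * suc i * (ent s i c * ent s i c))
      e₁ : ∀ F j a b → F * (j * (a + b)) ≡ F * (j * a) + F * (j * b)
      e₁ = solve-∀
      e₂ : ∀ d C → 6 * d * C + 6 * d * C ≡ 12 * d * C
      e₂ = solve-∀

    noise₁ : ℕ → ℕ → Cfg → ℕ
    noise₁ lo n c = ∑ n λ i → suc (lo + i) * suc (lo + i) * squares (lo + i) c

    noise₀ : ℕ → ℕ → Cfg → ℕ
    noise₀ lo n c = ∑ n λ i → squares (lo + i) c

    private
      spread : ∀ n (F : Cfg → ℕ) (g : ℕ → Cfg → ℕ) y →
        ΣΩ (λ c → F c * ∑ n (λ i → g i c) * 𝟙 (exactly? y c)) ≡ ∑ n (λ i → ΣΩ (λ c → F c * g i c * 𝟙 (exactly? y c)))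
      spread n F g y = trans (ΣΩ-cong λ c → trans (cong (_* 𝟙 (exactly? y c)) (sym (∑-*ˡ n (F c) (λ i → g i c))))
          (sym (∑-*ʳ n (𝟙 (exactly? y c)) (λ i → F c * g i c))))
        (ΣΩ-∑ n (λ i c → F c * g i c * 𝟙 (exactly? y c)))

    Dom-noise₁ : ∀ F C lo n → Dom F C → Indep-from lo F → Dom (λ c → F c * noise₁ lo n c) (n * (12 * (D * D) * C))
    Dom-noise₁ F C lo n dom inv y p = begin
      ΣΩ (λ c → F c * noise₁ lo n c * 𝟙 (exactly? y c))
        ≡⟨ spread n F (λ i c → suc (lo + i) * suc (lo + i) * squares (lo + i) c) y ⟩
      ∑ n (λ i → ΣΩ (λ c → F c * (suc (lo + i) * suc (lo + i) * squares (lo + i) c) * 𝟙 (exactly? y c)))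
        ≤⟨ (∑-mono n λ i _ → Dom-squares F C (lo + i) dom (λ s → inv s (lo + i) (m≤m+n lo i)) y p) ⟩
      ∑ n (λ _ → 12 * (D * D) * C * f y)
        ≡⟨ trans (∑-const n _) (sym (*-assoc n (12 * (D * D) * C) (f y))) ⟩
      n * (12 * (D * D) * C) * f y ∎
      where open ≤-Reasoning

    -- Without j² the means decay like 12 D² / j², and beyond lo they add up to 12 D² / lo. With κ =
    -- k_t² and lo = J_t this becomes J_{t+1} · 12 D², since k_t² = J_t J_{t+1}: with the test at
    -- the geometric middle, the noise bounds for both directions agree.
    Dom-noise₀ : ∀ F C lo n κ κ′ → κ ≡ κ′ * lo → Dom F C → Indep-from lo F →
      Dom (λ c → F c * (κ * noise₀ lo n c)) (κ′ * (12 * (D * D) * C))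
    Dom-noise₀ F C lo n κ κ′ refl dom inv y p = begin
      ΣΩ (λ c → F c * (κ′ * lo * noise₀ lo n c) * 𝟙 (exactly? y c))
        ≡⟨ ΣΩ-cong (λ c → e₁ (F c) (κ′ * lo) (noise₀ lo n c) (𝟙 (exactly? y c))) ⟩
      ΣΩ (λ c → κ′ * lo * (F c * noise₀ lo n c * 𝟙 (exactly? y c)))
        ≡⟨ trans (ΣΩ-*ˡ (κ′ * lo) _) (cong (κ′ * lo *_) (spread n F (λ i c → squares (lo + i) c) y)) ⟩
      κ′ * lo * ∑ n (λ i → S i)
        ≡⟨ *-assoc κ′ lo _ ⟩
      κ′ * (lo * ∑ n S)
        ≤⟨ *-monoʳ-≤ κ′ (reciprocal-squares n lo S (12 * (D * D) * C * f y) λ i _ → begin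
             suc (lo + i) * suc (lo + i) * S i
               ≡⟨ trans (sym (ΣΩ-*ˡ (suc (lo + i) * suc (lo + i)) _)) (ΣΩ-cong λ c → e₂ (suc (lo + i) * suc (lo + i)) (F c) (squares (lo + i) c) (𝟙 (exactly? y c))) ⟩
             ΣΩ (λ c → F c * (suc (lo + i) * suc (lo + i) * squares (lo + i) c) * 𝟙 (exactly? y c))
               ≤⟨ Dom-squares F C (lo + i) dom (λ s → inv s (lo + i) (m≤m+n lo i)) y p ⟩
             12 * (D * D) * C * f y ∎) ⟩
      κ′ * (12 * (D * D) * C * f y)
        ≡⟨ sym (*-assoc κ′ (12 * (D * D) * C) (f y)) ⟩
      κ′ * (12 * (D * D) * C) * f y ∎
      where
      open ≤-Reasoning
      S : ℕ → ℕ
      S i = ΣΩ (λ c → F c * squares (lo + i) c * 𝟙 (exactly? y c))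
      e₁ : ∀ F k n o → F * (k * n) * o ≡ k * (F * n * o)
      e₁ = solve-∀
      e₂ : ∀ j F s o → j * (F * s * o) ≡ F * (j * s) * o
      e₂ = solve-∀

    noise-indep : ∀ lo n s i → lo + n ≤ i → Indep s i (noise₁ lo n) × Indep s i (noise₀ lo n)
    noise-indep lo n s i h = (λ t c → ∑-cong n λ r r<n → cong (suc (lo + r) * suc (lo + r) *_) (sq≡ t c r r<n))
                           , (λ t c → ∑-cong n λ r r<n → sq≡ t c r r<n)
      where
      sq≡ : ∀ t c r → r < n → squares (lo + r) (add s i t c) ≡ squares (lo + r) c
      sq≡ t c r r<n = cong₂ (λ a b → a * a + b * b) (ent-add-other s true i (lo + r) t c ≢) (ent-add-other s false i (lo + r) t c ≢)
        where
        ≢ : i ≢ lo + r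
        ≢ refl = <⇒≱ (+-monoʳ-< lo r<n) h

  -- Small differences |b_j - a_j| are rare.

  module LowerTail (k α h : ℕ) (h≥ : 2 * k * (6 * α) ≤ h) where

    near? : ∀ i c → Dec (ℕ.∣ ent true i c - ent false i c ∣ < α)
    near? i c = ℕ.∣ ent true i c - ent false i c ∣ <? α

    bad? : ∀ i c → Dec (i < length c × ℕ.∣ ent true i c - ent false i c ∣ < α)
    bad? i c = (i <? length c) ×-dec near? i c

    -- The total is bounded here instead of prescribed: then a_j ranges over an interval when all
    -- else is fixed, whereas a prescribed total would determine it.
    T : (Cfg → ℕ) → ℕ → ℕ
    T F y = ΣΩ (λ c → F c * 𝟙 (within? y c))

    private
      -- If a runs over an interval of y ≥ 1 admissible values, at most min (y , 2α) of them are near b,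
      -- while relaxing the constraint by h admits 6α further values.
      one-slot : ∀ j b r → 1 ≤ j → j * (6 * α) ≤ h →
        4 * ∑ K (λ a → 𝟙 (ℕ.∣ a - b ∣ <? α) * 𝟙 (j * (a + b) + r + h ≤? N₀)) ≤ ∑ K (λ a → 𝟙 (j * (a + b) + r ≤? N₀))
      one-slot j b r 1≤j jh = by-cases (j * b + r + h ≤? N₀)
        where
        by-cases : Dec (j * b + r + h ≤ N₀) → 4 * ∑ K (λ a → 𝟙 (ℕ.∣ a - b ∣ <? α) * 𝟙 (j * (a + b) + r + h ≤? N₀)) ≤ ∑ K (λ a → 𝟙 (j * (a + b) + r ≤? N₀))
        by-cases (no ¬p) = ≤-trans (≤-reflexive (trans (cong (4 *_) (∑-zero K λ a _ → trans (cong (𝟙 (ℕ.∣ a - b ∣ <? α) *_)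
              (𝟙-no (j * (a + b) + r + h ≤? N₀) λ q → ¬p (≤-trans (+-monoˡ-≤ h (+-monoˡ-≤ r (*-monoʳ-≤ j (m≤n+m b a)))) q)))
              (*-zeroʳ (𝟙 (ℕ.∣ a - b ∣ <? α))))) (*-zeroʳ 4))) z≤n
        by-cases (yes p) = begin
          4 * S                     ≡⟨ e S ⟩
          S + 3 * S                 ≤⟨ +-mono-≤ S≤Y (*-monoʳ-≤ 3 S≤2α) ⟩
          Y + 3 * (2 * α)           ≡⟨ trans (cong (Y +_) (sym (*-assoc 3 2 α))) (+-comm Y (6 * α)) ⟩
          6 * α + Y                 ≤⟨ +-mono-≤ full upper ⟩
          ∑ (6 * α) v + ∑ n (λ a → v (6 * α + a))
            ≡⟨ sym (∑-split (6 * α) n v) ⟩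
          ∑ (6 * α + n) v           ≡⟨ cong (λ z → ∑ z v) 6α+n≡K ⟩
          ∑ K v                     ∎
          where
          open ≤-Reasoning
          e : ∀ S → 4 * S ≡ S + 3 * S
          e = solve-∀
          u v : ℕ → ℕ
          u a = 𝟙 (j * (a + b) + r + h ≤? N₀)
          v a = 𝟙 (j * (a + b) + r ≤? N₀)
          S Y n : ℕ
          S = ∑ K (λ a → 𝟙 (ℕ.∣ a - b ∣ <? α) * u a)
          Y = ∑ K u
          n = K ∸ 6 * α
          S≤Y : S ≤ Y
          S≤Y = ∑-mono K λ a _ → 𝟙*≤ (ℕ.∣ a - b ∣ <? α) (u a)
          S≤2α : S ≤ 2 * α
          S≤2α = ≤-trans (∑-mono K λ a _ → ≤-trans (*-monoʳ-≤ (𝟙 (ℕ.∣ a - b ∣ <? α)) (𝟙≤1 (j * (a + b) + r + h ≤? N₀)))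
                   (≤-reflexive (*-identityʳ (𝟙 (ℕ.∣ a - b ∣ <? α))))) (near≤ K b α)
          6α≤h : 6 * α ≤ h
          6α≤h = ≤-trans (m≤n*m (6 * α) j {{>-nonZero 1≤j}}) jh
          6α+n≡K : 6 * α + n ≡ K
          6α+n≡K = m+[n∸m]≡n (≤-trans (≤-trans 6α≤h (≤-trans (m≤n+m h _) p)) N₀≤K)
          step : ∀ a a′ → j * a′ ≤ h → j * (a′ + a + b) + r ≤ j * (a + b) + r + h
          step a a′ q = ≤-trans (≤-reflexive (r₁ j a a′ b r)) (+-monoʳ-≤ (j * (a + b) + r) q)
            where
            r₁ : ∀ j a a′ b r → j * (a′ + a + b) + r ≡ j * (a + b) + r + j * a′
            r₁ = solve-∀
          full : 6 * α ≤ ∑ (6 * α) v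
          full = ≤-trans (≤-reflexive (sym (trans (∑-const (6 * α) 1) (*-identityʳ (6 * α)))))
            (∑-mono (6 * α) λ a a< → ≤-reflexive (sym (𝟙-yes (j * (a + b) + r ≤? N₀)
              (≤-trans (subst (λ z → j * (z + b) + r ≤ j * b + r + h) (+-identityʳ a)
                (step 0 a (≤-trans (*-monoʳ-≤ j (<⇒≤ a<)) jh))) p))))
          upper : Y ≤ ∑ n (λ a → v (6 * α + a))
          upper = begin
            ∑ K u                                      ≡⟨ cong (λ z → ∑ z u) (trans (sym 6α+n≡K) (+-comm (6 * α) n)) ⟩
            ∑ (n + 6 * α) u                            ≡⟨ ∑-split n (6 * α) u ⟩
            ∑ n u + ∑ (6 * α) (λ i → u (n + i))
              ≡⟨ cong (∑ n u +_) (∑-zero (6 * α) λ i _ → 𝟙-no (j * (n + i + b) + r + h ≤? N₀) λ q → <⇒≱ (n<1+n N₀) (begin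
                   suc N₀                              ≡⟨ trans (sym K≡) (trans (sym 6α+n≡K) (+-comm (6 * α) n)) ⟩
                   n + 6 * α                           ≤⟨ +-mono-≤ (m≤n*m n j {{>-nonZero 1≤j}}) 6α≤h ⟩
                   j * n + h                           ≤⟨ +-monoˡ-≤ h (≤-trans (*-monoʳ-≤ j (≤-trans (m≤m+n n i) (m≤m+n (n + i) b))) (m≤m+n _ r)) ⟩
                   j * (n + i + b) + r + h             ≤⟨ q ⟩
                   N₀                                  ∎)) ⟩
            ∑ n u + 0                                  ≡⟨ +-identityʳ _ ⟩
            ∑ n u
              ≤⟨ (∑-mono n λ a _ → 𝟙-mono (j * (a + b) + r + h ≤? N₀) (j * (6 * α + a + b) + r ≤? N₀) (≤-trans (step a (6 * α) jh))) ⟩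
            ∑ n (λ a → v (6 * α + a))                  ∎

      sumP-slot : ∀ d i o e (F : Cfg → ℕ) → i < d → Indep true i F → (suc o + i) * (6 * α) ≤ h →
        4 * sumP K d (λ c → F c * (𝟙 (near? i c) * 𝟙 (weight o c + e + h ≤? N₀))) ≤ sumP K d (λ c → F c * 𝟙 (weight o c + e ≤? N₀))
      sumP-slot (suc d) zero o e F _ inv jh = begin
        4 * ∑ K (λ a → ∑ K λ b → sumP K d (Φ a b))
          ≡⟨ cong (4 *_) (exchange Φ) ⟩
        4 * ∑ K (λ b → sumP K d λ c → ∑ K λ a → Φ a b c)
          ≡⟨ trans (sym (∑-*ˡ K 4 _)) (∑-cong K λ b _ → sym (sumP-*ˡ K d 4 _)) ⟩
        ∑ K (λ b → sumP K d λ c → 4 * ∑ K λ a → Φ a b c)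
          ≤⟨ (∑-mono K λ b _ → sumP-mono K d λ c _ → pointwise b c) ⟩
        ∑ K (λ b → sumP K d λ c → ∑ K λ a → Ψ a b c)
          ≡⟨ sym (exchange Ψ) ⟩
        ∑ K (λ a → ∑ K λ b → sumP K d (Ψ a b)) ∎
        where
        open ≤-Reasoning
        Φ Ψ : ℕ → ℕ → Cfg → ℕ
        Φ a b c = F ((a , b) ∷ c) * (𝟙 (ℕ.∣ a - b ∣ <? α) * 𝟙 (suc o * (a + b) + weight (suc o) c + e + h ≤? N₀))
        Ψ a b c = F ((a , b) ∷ c) * 𝟙 (suc o * (a + b) + weight (suc o) c + e ≤? N₀)
        exchange : ∀ (Φ : ℕ → ℕ → Cfg → ℕ) →
          ∑ K (λ a → ∑ K λ b → sumP K d (Φ a b)) ≡ ∑ K (λ b → sumP K d λ c → ∑ K λ a → Φ a b c)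
        exchange Φ = trans (∑-swap K K λ a b → sumP K d (Φ a b)) (∑-cong K λ b _ → sym (sumP-∑ K d K λ a → Φ a b))
        F≡ : ∀ a b c → F ((a , b) ∷ c) ≡ F ((0 , b) ∷ c)
        F≡ a b c = trans (cong (λ z → F ((z , b) ∷ c)) (sym (+-identityʳ a))) (inv a ((0 , b) ∷ c))
        pointwise : ∀ b c → 4 * ∑ K (λ a → Φ a b c) ≤ ∑ K (λ a → Ψ a b c)
        pointwise b c = begin
          4 * ∑ K (λ a → Φ a b c)
            ≡⟨ cong (4 *_) (∑-cong K λ a _ → cong₂ (λ x y → x * (𝟙 (ℕ.∣ a - b ∣ <? α) * 𝟙 (y + h ≤? N₀))) (F≡ a b c) (+-assoc (suc o * (a + b)) W e)) ⟩
          4 * ∑ K (λ a → F₀ * (𝟙 (ℕ.∣ a - b ∣ <? α) * 𝟙 (suc o * (a + b) + (W + e) + h ≤? N₀)))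
            ≡⟨ trans (cong (4 *_) (∑-*ˡ K F₀ _)) (r₁ F₀ (∑ K (λ a → 𝟙 (ℕ.∣ a - b ∣ <? α) * 𝟙 (suc o * (a + b) + (W + e) + h ≤? N₀)))) ⟩
          F₀ * (4 * ∑ K (λ a → 𝟙 (ℕ.∣ a - b ∣ <? α) * 𝟙 (suc o * (a + b) + (W + e) + h ≤? N₀)))
            ≤⟨ *-monoʳ-≤ F₀ (one-slot (suc o) b (W + e) (s≤s z≤n) (subst (λ z → z * (6 * α) ≤ h) (+-identityʳ (suc o)) jh)) ⟩
          F₀ * ∑ K (λ a → 𝟙 (suc o * (a + b) + (W + e) ≤? N₀))
            ≡⟨ sym (∑-*ˡ K F₀ _) ⟩
          ∑ K (λ a → F₀ * 𝟙 (suc o * (a + b) + (W + e) ≤? N₀))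
            ≡⟨ (∑-cong K λ a _ → cong₂ (λ x y → x * 𝟙 (y ≤? N₀)) (sym (F≡ a b c)) (sym (+-assoc (suc o * (a + b)) W e))) ⟩
          ∑ K (λ a → Ψ a b c) ∎
          where
          F₀ = F ((0 , b) ∷ c)
          W = weight (suc o) c
          r₁ : ∀ F x → 4 * (F * x) ≡ F * (4 * x)
          r₁ = solve-∀
      sumP-slot (suc d) (suc i) o e F (s≤s i<d) inv jh = begin
        4 * ∑ K (λ a → ∑ K λ b → sumP K d (Φ a b))
          ≡⟨ trans (sym (∑-*ˡ K 4 _)) (∑-cong K λ a _ → sym (∑-*ˡ K 4 _)) ⟩
        ∑ K (λ a → ∑ K λ b → 4 * sumP K d (Φ a b))
          ≤⟨ (∑-mono K λ a _ → ∑-mono K λ b _ → begin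
               4 * sumP K d (Φ a b)
                 ≡⟨ cong (4 *_) (sumP-cong K d λ c _ → cong (λ y → F ((a , b) ∷ c) * (𝟙 (near? i c) * 𝟙 (y + h ≤? N₀))) (r₁ (suc o * (a + b)) (weight (suc o) c) e)) ⟩
               4 * sumP K d (λ c → F ((a , b) ∷ c) * (𝟙 (near? i c) * 𝟙 (weight (suc o) c + (suc o * (a + b) + e) + h ≤? N₀)))
                 ≤⟨ sumP-slot d i (suc o) (suc o * (a + b) + e) (λ c → F ((a , b) ∷ c)) i<d (λ t c → inv t ((a , b) ∷ c))
                      (subst (λ z → z * (6 * α) ≤ h) (+-suc (suc o) i) jh) ⟩
               sumP K d (λ c → F ((a , b) ∷ c) * 𝟙 (weight (suc o) c + (suc o * (a + b) + e) ≤? N₀))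
                 ≡⟨ (sumP-cong K d λ c _ → cong (λ y → F ((a , b) ∷ c) * 𝟙 (y ≤? N₀)) (sym (r₁ (suc o * (a + b)) (weight (suc o) c) e))) ⟩
               sumP K d (λ c → F ((a , b) ∷ c) * 𝟙 (suc o * (a + b) + weight (suc o) c + e ≤? N₀)) ∎) ⟩
        ∑ K (λ a → ∑ K λ b → sumP K d (λ c → F ((a , b) ∷ c) * 𝟙 (suc o * (a + b) + weight (suc o) c + e ≤? N₀))) ∎
        where
        open ≤-Reasoning
        Φ : ℕ → ℕ → Cfg → ℕ
        Φ a b c = F ((a , b) ∷ c) * (𝟙 (near? i c) * 𝟙 (suc o * (a + b) + weight (suc o) c + e + h ≤? N₀))
        r₁ : ∀ x w e → x + w + e ≡ w + (x + e)
        r₁ = solve-∀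

    T-slot : ∀ F i y → i < 2 * k → Indep true i F → 4 * T (λ c → F c * 𝟙 (bad? i c)) (y + h) ≤ T F y
    T-slot F i y i<2k inv = ≤-trans (≤-reflexive (sym (∑-*ˡ K 4 _))) (∑-mono K λ d _ → by-cases d (i <? d))
      where
      arrange : ∀ l w y → l + w + y ≡ w + (l + y)
      arrange = solve-∀
      by-cases : ∀ d → Dec (i < d) → 4 * sumP K d (λ c → F c * 𝟙 (bad? i c) * 𝟙 (within? (y + h) c)) ≤ sumP K d (λ c → F c * 𝟙 (within? y c))
      by-cases d (no i≮d) = ≤-trans (≤-reflexive (trans (cong (4 *_) (trans (sumP-cong K d λ c e →
          cong (_* 𝟙 (within? (y + h) c)) (trans (cong (F c *_) (𝟙-no (bad? i c) λ (q , _) → i≮d (subst (i <_) e q))) (*-zeroʳ (F c))))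
          (sumP-*ˡ K d 0 (λ _ → 0)))) (*-zeroʳ 4))) z≤n
      by-cases d (yes i<d) = begin
        4 * sumP K d (λ c → F c * 𝟙 (bad? i c) * 𝟙 (within? (y + h) c))
          ≤⟨ *-monoʳ-≤ 4 (sumP-mono K d λ c e → ≤-trans (≤-reflexive (*-assoc (F c) (𝟙 (bad? i c)) _))
               (*-monoʳ-≤ (F c) (*-mono-≤ (𝟙-mono (bad? i c) (near? i c) proj₂)
                 (𝟙-mono (within? (y + h) c) (weight 0 c + (d * d + y) + h ≤? N₀)
                   (subst (_≤ N₀) (trans (cong (λ l → l * l + weight 0 c + (y + h)) e) (trans (sym (+-assoc (d * d + weight 0 c) y h)) (cong (_+ h) (arrange (d * d) (weight 0 c) y))))))))) ⟩
        4 * sumP K d (λ c → F c * (𝟙 (near? i c) * 𝟙 (weight 0 c + (d * d + y) + h ≤? N₀)))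
          ≤⟨ sumP-slot d i 0 (d * d + y) F i<d inv (≤-trans (*-monoˡ-≤ (6 * α) i<2k) h≥) ⟩
        sumP K d (λ c → F c * 𝟙 (weight 0 c + (d * d + y) ≤? N₀))
          ≤⟨ (sumP-mono K d λ c e → *-monoʳ-≤ (F c) (𝟙-mono (weight 0 c + (d * d + y) ≤? N₀) (within? y c)
               (subst (_≤ N₀) (trans (sym (arrange (d * d) (weight 0 c) y)) (cong (λ l → l * l + weight 0 c + y) (sym e)))))) ⟩
        sumP K d (λ c → F c * 𝟙 (within? y c)) ∎
        where open ≤-Reasoning

    -- This is 4 to the number of bad indices among n, the exponential moment for Markov's
    -- inequality.
    bads : ℕ → Cfg → ℕ
    bads n c = ∏ n λ r → 1 + 3 * 𝟙 (bad? (k + r) c)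

    private
      bads-indep : ∀ n → Indep true (k + n) (bads n)
      bads-indep n t c = ∏-cong n λ r r<n → cong (λ z → 1 + 3 * z) (𝟙-cong (bad? (k + r) (add true (k + n) t c)) (bad? (k + r) c)
          (λ (p , q) → subst (k + r <_) (length-add true (k + n) t c) p , subst (_< α) (same r r<n) q)
          (λ (p , q) → subst (k + r <_) (sym (length-add true (k + n) t c)) p , subst (_< α) (sym (same r r<n)) q))
        where
        same : ∀ r → r < n → ℕ.∣ ent true (k + r) (add true (k + n) t c) - ent false (k + r) (add true (k + n) t c) ∣ ≡ ℕ.∣ ent true (k + r) c - ent false (k + r) c ∣
        same r r<n = cong₂ ℕ.∣_-_∣ (ent-add-other true true (k + n) (k + r) t c ≢) (ent-add-other true false (k + n) (k + r) t c ≢)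
          where
          ≢ : k + n ≢ k + r
          ≢ e = <-irrefl (sym (+-cancelˡ-≡ k n r e)) r<n

    -- Each further index multiplies the bound by 1 + 3 · 2 / 4 = 10/4: a bad index has share 1/4 by
    -- `T-slot`, at the price of h in the total, and by `base` a price h is worth a factor 2. The
    -- hypothesis n ≤ i provides for n such payments.
    T-bads : ∀ I Env → (∀ i → i ≤ I → 2 ^ i * T (λ _ → 1) (h * i) ≤ Env) →
             ∀ n i → n ≤ k → n ≤ i → i ≤ I → 4 ^ n * (2 ^ i * T (bads n) (h * i)) ≤ 10 ^ n * Env
    T-bads I Env base zero i _ _ i≤I = *-monoʳ-≤ 1 (base i i≤I)
    T-bads I Env base (suc n) (suc i) n<k (s≤s n≤i) i<I = begin
      4 ^ suc n * (2 ^ suc i * T (bads (suc n)) (h * suc i))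
        ≡⟨ cong (λ z → 4 ^ suc n * (2 ^ suc i * z)) split ⟩
      4 ^ suc n * (2 ^ suc i * (A + 3 * Bd))
        ≡⟨ e₁ (4 ^ n) (2 ^ i) A Bd ⟩
      4 * (4 ^ n * (2 ^ suc i * A)) + 6 * (4 ^ n * (2 ^ i * (4 * Bd)))
        ≤⟨ +-mono-≤ (*-monoʳ-≤ 4 (T-bads I Env base n (suc i) (<⇒≤ n<k) (m≤n⇒m≤1+n n≤i) i<I))
             (*-monoʳ-≤ 6 (≤-trans (*-monoʳ-≤ (4 ^ n) (*-monoʳ-≤ (2 ^ i) slot)) (T-bads I Env base n i (<⇒≤ n<k) n≤i (<⇒≤ i<I)))) ⟩
      4 * (10 ^ n * Env) + 6 * (10 ^ n * Env)
        ≡⟨ e₂ (10 ^ n) Env ⟩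
      10 ^ suc n * Env ∎
      where
      open ≤-Reasoning
      A Bd : ℕ
      A  = T (bads n) (h * suc i)
      Bd = T (λ c → bads n c * 𝟙 (bad? (k + n) c)) (h * suc i)
      e₁ : ∀ p q A B → 4 * p * (2 * q * (A + 3 * B)) ≡ 4 * (p * (2 * q * A)) + 6 * (p * (q * (4 * B)))
      e₁ = solve-∀
      e₂ : ∀ p E → 4 * (p * E) + 6 * (p * E) ≡ 10 * p * E
      e₂ = solve-∀
      e₃ : ∀ F b w → F * (1 + 3 * b) * w ≡ F * w + 3 * (F * b * w)
      e₃ = solve-∀
      split : T (bads (suc n)) (h * suc i) ≡ A + 3 * Bd
      split = trans (ΣΩ-cong λ c → trans (cong (_* 𝟙 (within? (h * suc i) c)) (∏-last n (λ r → 1 + 3 * 𝟙 (bad? (k + r) c))))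
                      (e₃ (bads n c) (𝟙 (bad? (k + n) c)) (𝟙 (within? (h * suc i) c))))
        (trans (ΣΩ-+ (λ c → bads n c * 𝟙 (within? (h * suc i) c)) (λ c → 3 * (bads n c * 𝟙 (bad? (k + n) c) * 𝟙 (within? (h * suc i) c)))) (cong (A +_) (ΣΩ-*ˡ 3 (λ c → bads n c * 𝟙 (bad? (k + n) c) * 𝟙 (within? (h * suc i) c)))))
      slot : 4 * Bd ≤ T (bads n) (h * i)
      slot = subst (λ z → 4 * T (λ c → bads n c * 𝟙 (bad? (k + n) c)) z ≤ T (bads n) (h * i)) (trans (+-comm (h * i) h) (sym (*-suc h i)))
        (T-slot (bads n) (k + n) (h * i) (subst (k + n <_) (cong (k +_) (sym (+-identityʳ k))) (+-monoʳ-< k n<k)) (bads-indep n))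

-- Exchanging a_j and b_j.

absdiff : ∀ a b → ∣ ℤ.+ b ℤ.- ℤ.+ a ∣ ≡ ℕ.∣ a - b ∣
absdiff a b with ≤-total a b
... | inj₁ a≤b = trans (cong ∣_∣ (trans (ℤ.m-n≡m⊖n b a) (ℤ.⊖-≥ a≤b))) (sym (m≤n⇒∣m-n∣≡n∸m a≤b))
... | inj₂ b≤a = trans (ℤ.∣i-j∣≡∣j-i∣ (ℤ.+ b) (ℤ.+ a))
  (trans (cong ∣_∣ (trans (ℤ.m-n≡m⊖n a b) (ℤ.⊖-≥ b≤a))) (sym (m≤n⇒∣n-m∣≡n∸m b≤a)))

diff : ℕ → Cfg → ℤ
diff i c = ℤ.+ ent false i c ℤ.- ℤ.+ ent true i c

dist : ℕ → Cfg → ℕ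
dist i c = ℕ.∣ ent true i c - ent false i c ∣

sq-diff : ∀ i c → sq (diff i c) ≤ ent true i c * ent true i c + ent false i c * ent false i c
sq-diff i c = ≤-trans (≤-reflexive (cong (λ z → z * z) (absdiff a b))) (bound (≤-total a b))
  where
  a = ent true i c
  b = ent false i c
  bound : a ≤ b ⊎ b ≤ a → ℕ.∣ a - b ∣ * ℕ.∣ a - b ∣ ≤ a * a + b * b
  bound (inj₁ a≤b) = ≤-trans (*-square (≤-trans (≤-reflexive (m≤n⇒∣m-n∣≡n∸m a≤b)) (m∸n≤m b a))) (m≤n+m (b * b) (a * a))
  bound (inj₂ b≤a) = ≤-trans (*-square (≤-trans (≤-reflexive (m≤n⇒∣n-m∣≡n∸m b≤a)) (m∸n≤m a b))) (m≤m+n (a * a) (b * b))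

diffs : Cfg → List ℤ
diffs []            = []
diffs ((a , b) ∷ c) = (ℤ.+ b ℤ.- ℤ.+ a) ∷ diffs c

length-diffs : ∀ c → length (diffs c) ≡ length c
length-diffs []      = refl
length-diffs (_ ∷ c) = cong suc (length-diffs c)

sumSw : Cfg → (Cfg → ℕ) → ℕ
sumSw []            Φ = Φ []
sumSw ((a , b) ∷ c) Φ = sumSw c (λ z → Φ ((a , b) ∷ z)) + sumSw c (λ z → Φ ((b , a) ∷ z))

data Swapped : Cfg → Cfg → Set where
  []   : Swapped [] []
  keep : ∀ {a b c c′} → Swapped c c′ → Swapped ((a , b) ∷ c) ((a , b) ∷ c′)
  swap : ∀ {a b c c′} → Swapped c c′ → Swapped ((a , b) ∷ c) ((b , a) ∷ c′)

sumSw-mono : ∀ c {Φ Ψ : Cfg → ℕ} → (∀ c′ → Swapped c c′ → Φ c′ ≤ Ψ c′) → sumSw c Φ ≤ sumSw c Ψ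
sumSw-mono []            h = h [] []
sumSw-mono ((a , b) ∷ c) h = +-mono-≤ (sumSw-mono c λ c′ s → h _ (keep s)) (sumSw-mono c λ c′ s → h _ (swap s))

sumSw-*ˡ : ∀ c k (Φ : Cfg → ℕ) → sumSw c (λ z → k * Φ z) ≡ k * sumSw c Φ
sumSw-*ˡ []            k Φ = refl
sumSw-*ˡ ((a , b) ∷ c) k Φ = trans (cong₂ _+_ (sumSw-*ˡ c k (λ z → Φ ((a , b) ∷ z))) (sumSw-*ˡ c k (λ z → Φ ((b , a) ∷ z))))
  (sym (*-distribˡ-+ k (sumSw c (λ z → Φ ((a , b) ∷ z))) _))

sumSw-diffs : ∀ c (ψ : List ℤ → ℕ) → sumSw c (λ z → ψ (diffs z)) ≡ sumS (diffs c) ψ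
sumSw-diffs []            ψ = refl
sumSw-diffs ((a , b) ∷ c) ψ = cong₂ _+_ (sumSw-diffs c (λ z → ψ ((ℤ.+ b ℤ.- ℤ.+ a) ∷ z)))
  (trans (sumSw-diffs c (λ z → ψ ((ℤ.+ a ℤ.- ℤ.+ b) ∷ z))) (sumS-cong (diffs c) λ z _ → cong (λ y → ψ (y ∷ z)) (e (ℤ.+ a) (ℤ.+ b))))
  where
  e : ∀ a b → a ℤ.- b ≡ ℤ.- (b ℤ.- a)
  e = ℤSolver.solve-∀

-- Each exchange of a_j and b_j permutes the box, so summing over all 2^d exchanges multiplies a sum
-- by 2^d. This is the origin of the random signs.
sumP-swap : ∀ K d (Φ : Cfg → ℕ) → sumP K d (λ c → sumSw c Φ) ≡ 2 ^ d * sumP K d Φ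
sumP-swap K zero    Φ = sym (+-identityʳ (Φ []))
sumP-swap K (suc d) Φ = begin
  ∑ K (λ a → ∑ K λ b → sumP K d λ c → sumSw c (Φ′ a b) + sumSw c (Φ′ b a))
    ≡⟨ (∑-cong K λ a _ → trans (∑-cong K λ b _ → trans (sumP-+ K d (λ c → sumSw c (Φ′ a b)) (λ c → sumSw c (Φ′ b a)))
          (cong₂ _+_ (sumP-swap K d (Φ′ a b)) (sumP-swap K d (Φ′ b a)))) (∑-+ K (λ b → p * S a b) (λ b → p * S b a))) ⟩
  ∑ K (λ a → ∑ K (λ b → p * S a b) + ∑ K (λ b → p * S b a))
    ≡⟨ ∑-+ K (λ a → ∑ K (λ b → p * S a b)) (λ a → ∑ K (λ b → p * S b a)) ⟩
  ∑ K (λ a → ∑ K (λ b → p * S a b)) + ∑ K (λ a → ∑ K (λ b → p * S b a))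
    ≡⟨ cong (∑ K (λ a → ∑ K (λ b → p * S a b)) +_) (∑-swap K K (λ a b → p * S b a)) ⟩
  ∑ K (λ a → ∑ K (λ b → p * S a b)) + ∑ K (λ a → ∑ K (λ b → p * S a b))
    ≡⟨ cong (λ z → z + z) (trans (∑-cong K λ a _ → ∑-*ˡ K p (S a)) (∑-*ˡ K p (λ a → ∑ K (S a)))) ⟩
  p * sumP K (suc d) Φ + p * sumP K (suc d) Φ
    ≡⟨ double p _ ⟩
  2 ^ suc d * sumP K (suc d) Φ ∎
  where
  open ≡-Reasoning
  p = 2 ^ d
  Φ′ : ℕ → ℕ → Cfg → ℕ
  Φ′ a b z = Φ ((a , b) ∷ z)
  S : ℕ → ℕ → ℕ
  S a b = sumP K d (Φ′ a b)

swapped-length : ∀ {c c′} → Swapped c c′ → length c ≡ length c′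
swapped-length []       = refl
swapped-length (keep s) = cong suc (swapped-length s)
swapped-length (swap s) = cong suc (swapped-length s)

swapped-weight : ∀ {c c′} o → Swapped c c′ → weight o c ≡ weight o c′
swapped-weight o []       = refl
swapped-weight o (keep s) = cong (_ +_) (swapped-weight (suc o) s)
swapped-weight o (swap {a} {b} s) = cong₂ (λ x y → suc o * x + y) (+-comm a b) (swapped-weight (suc o) s)

swapped-dist : ∀ {c c′} i → Swapped c c′ → dist i c ≡ dist i c′
swapped-dist i       []             = refl
swapped-dist zero    (keep s)       = refl
swapped-dist zero    (swap {a} {b} s) = ∣-∣-comm a b
swapped-dist (suc i) (keep s)       = swapped-dist i s
swapped-dist (suc i) (swap s)       = swapped-dist i s

-- Cutting the list of differences into blocks.

At : ℕ → List ℤ → (ℕ → ℤ) → Set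
At o []      X = ⊤
At o (x ∷ z) X = x ≡ X o × At (suc o) z X

At-shift : ∀ o z X → At o z (X ∘ suc) → At (suc o) z X
At-shift o []      X _       = tt
At-shift o (x ∷ z) X (e , h) = e , At-shift (suc o) z X h

At-diffs : ∀ c → At 0 (diffs c) (λ i → diff i c)
At-diffs []      = tt
At-diffs (p ∷ c) = refl , At-shift 0 (diffs c) (λ i → diff i (p ∷ c)) (At-diffs c)

At-take : ∀ n o z X → At o z X → At o (take n z) X
At-take zero    o z       X _       = tt
At-take (suc n) o []      X _       = tt
At-take (suc n) o (x ∷ z) X (e , h) = e , At-take n (suc o) z X h

At-drop : ∀ n o z X → At o z X → At (o + n) (drop n z) X
At-drop zero    o z       X h       = subst (λ o → At o z X) (sym (+-identityʳ o)) h
At-drop (suc n) o []      X _       = tt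
At-drop (suc n) o (x ∷ z) X (_ , h) = subst (λ o → At o (drop n z) X) (sym (+-suc o n)) (At-drop n (suc o) z X h)

energy-At : ∀ c o z X → At o z X → energy c o z ≡ ∑ (length z) (λ i → c (suc (o + i)) * sq (X (o + i)))
energy-At c o []      X _       = refl
energy-At c o (x ∷ z) X (e , h) = cong₂ _+_
  (cong₂ (λ p y → c (suc p) * sq y) (sym (+-identityʳ o)) (trans e (cong X (sym (+-identityʳ o)))))
  (trans (energy-At c (suc o) z X h) (∑-cong (length z) λ i _ → cong (λ p → c (suc p) * sq (X p)) (sym (+-suc o i))))

countBig-At : ∀ w c o z X → At o z X → countBig w c o z ≡ ∑ (length z) (λ i → 𝟙 (w ≤? c (suc (o + i)) * ∣ X (o + i) ∣))
countBig-At w c o []      X _       = refl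
countBig-At w c o (x ∷ z) X (e , h) = cong₂ _+_
  (cong₂ (λ p y → 𝟙 (w ≤? c (suc p) * ∣ y ∣)) (sym (+-identityʳ o)) (trans e (cong X (sym (+-identityʳ o)))))
  (trans (countBig-At w c (suc o) z X h) (∑-cong (length z) λ i _ → cong (λ p → 𝟙 (w ≤? c (suc p) * ∣ X p ∣)) (sym (+-suc o i))))

chop : ℕ → (ℕ → ℕ) → List ℤ → List (List ℤ)
chop zero    off z = z ∷ []
chop (suc n) off z = take (off 1 ∸ off 0) z ∷ chop n (off ∘ suc) (drop (off 1 ∸ off 0) z)

length-chop : ∀ n off z → length (chop n off z) ≡ suc n
length-chop zero    off z = refl
length-chop (suc n) off z = cong suc (length-chop n (off ∘ suc) _)

concat-chop : ∀ n off z → concat (chop n off z) ≡ z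
concat-chop zero    off z = ++-identityʳ z
concat-chop (suc n) off z = trans (cong (take (off 1 ∸ off 0) z ++_) (concat-chop n (off ∘ suc) _))
  (take++drop≡id (off 1 ∸ off 0) z)

At-chop : ∀ n off z X → (∀ t → t < n → off t ≤ off (suc t)) → At (off 0) z X → ∀ t → t ≤ n → At (off t) (nthL t (chop n off z)) X
At-chop zero    off z X mono h zero    _         = h
At-chop (suc n) off z X mono h zero    _         = At-take (off 1 ∸ off 0) (off 0) z X h
At-chop (suc n) off z X mono h (suc t) (s≤s t≤n) = At-chop n (off ∘ suc) _ X (λ t p → mono (suc t) (s≤s p))
  (subst (λ o → At o (drop (off 1 ∸ off 0) z) X) (m+[n∸m]≡n (mono 0 (s≤s z≤n))) (At-drop (off 1 ∸ off 0) (off 0) z X h)) t t≤n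

edges-chop : ∀ n off z → (∀ t → t ≤ n → off t ≤ off (suc t)) → off 0 + length z ≡ off (suc n) →
             ∀ t → t ≤ n → off t + length (nthL t (chop n off z)) ≡ off (suc t)
edges-chop zero    off z mono e zero    _ = e
edges-chop (suc n) off z mono e t t≤ = by-cases t t≤
  where
  ℓ = off 1 ∸ off 0
  off₁ : off 0 + ℓ ≡ off 1
  off₁ = m+[n∸m]≡n (mono 0 z≤n)
  mono* : ∀ t → t ≤ n → off 1 ≤ off (suc (suc t))
  mono* zero    _ = mono 1 (s≤s z≤n)
  mono* (suc t) p = ≤-trans (mono* t (<⇒≤ p)) (mono (suc (suc t)) (s≤s p))
  ℓ≤ : ℓ ≤ length z
  ℓ≤ = +-cancelˡ-≤ (off 0) _ _ (subst₂ _≤_ (sym off₁) (sym e) (mono* n ≤-refl))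
  rest : off 1 + length (drop ℓ z) ≡ off (suc (suc n))
  rest = begin
    off 1 + length (drop ℓ z)    ≡⟨ cong (off 1 +_) (length-drop ℓ z) ⟩
    off 1 + (length z ∸ ℓ)                 ≡⟨ cong (_+ (length z ∸ ℓ)) (sym off₁) ⟩
    off 0 + ℓ + (length z ∸ ℓ)             ≡⟨ +-assoc (off 0) ℓ _ ⟩
    off 0 + (ℓ + (length z ∸ ℓ))           ≡⟨ cong (off 0 +_) (m+[n∸m]≡n ℓ≤) ⟩
    off 0 + length z                       ≡⟨ e ⟩
    off (suc (suc n))                      ∎
    where open ≡-Reasoning
  by-cases : ∀ t → t ≤ suc n → off t + length (nthL t (chop (suc n) off z)) ≡ off (suc t)
  by-cases zero    _         = trans (cong (off 0 +_) (trans (length-take ℓ z) (m≤n⇒m⊓n≡m ℓ≤))) off₁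
  by-cases (suc t) (s≤s t≤n) = edges-chop n (off ∘ suc) _ (λ t p → mono (suc t) (s≤s p)) rest t t≤n

-- Survivors among the regular configurations.

record Tail (N₀ K : ℕ) (K≡ : K ≡ suc N₀) : Set where
  open Partitions N₀ K K≡ using (f)
  open Omega N₀ K K≡ using (ΣΩ; exactly?)
  field
    D    : ℕ
    D≥1  : 1 ≤ D
    half : ∀ y → 2 * f (y + D) ≤ f y
    y₀   : ℕ
    base : ∀ y → y₀ ≤ y → ΣΩ (λ c → 1 * 𝟙 (exactly? y c)) ≤ 1 * f y

module Survivors
  (N₀ K : ℕ) (K≡ : K ≡ suc N₀) (U : Tail N₀ K K≡) (S : Setting) (α : ℕ → ℕ)
  (kα≡w : ∀ σ → σ < Setting.T S → Setting.m S * (Setting.a S (suc σ) * Setting.a S (suc σ)) * α σ ≡ Setting.w S)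
  where

  open Tail U
  open Setting S
  open Partitions N₀ K K≡
  open Omega N₀ K K≡
  open UpperTail D D≥1 half y₀

  J k Θ : ℕ → ℕ
  J t = a t * a t
  k t = m * (a t * a t)
  Θ t = e * (a t * w) * (e * (a t * w))

  lo : ℕ → ℕ
  lo zero    = 0
  lo (suc t) = J (suc t)

  -- Only the last boundary depends on the configuration, through its length d. `lo` gives the
  -- starts of the blocks independently of d, so that noise can be averaged over all lengths at
  -- once.
  off : ℕ → ℕ → ℕ
  off d zero = 0
  off d (suc t) with t ≤? T
  ... | yes _ = J (suc t)
  ... | no  _ = d

  survives : List ℤ → ℕ
  survives x = ∏ T (λ σ → 𝟙 (ℤ.+ 1 ℤ.≤? linear (_⊓ k (suc σ)) 0 x))

  -- A quarter of the k indices following k have |b_j - a_j| ≥ α = w / k. They lie in the own block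
  -- and satisfy min(j , k) = k, so each of them yields a summand of size at least w.
  dense? : ∀ σ cf → Dec (k (suc σ) ≤ 4 * ∑ (k (suc σ)) (λ i → 𝟙 (α σ ≤? dist (k (suc σ) + i) cf)))
  dense? σ cf = k (suc σ) ≤? 4 * ∑ (k (suc σ)) (λ i → 𝟙 (α σ ≤? dist (k (suc σ) + i) cf))

  dense : Cfg → ℕ
  dense cf = ∏ T (λ σ → 𝟙 (dense? σ cf))

  len : ℕ → ℕ
  len t = J (suc t) ∸ lo t

  low test high : ℕ → Cfg → ℕ
  low t cf = endCost (Θ 0) (noise₁ 0 (J 1) cf)
  test t cf = testCost (Θ t) (noise₁ (J t) (len t) cf + k t * k t * noise₀ (J t) (len t) cf)
  high t cf = endCost (Θ t) (k t * k t * noise₀ (J t) K cf)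

  -- The costs of the blocks with (b_j - a_j)² replaced by a_j² + b_j², so that the average over
  -- configurations can treat a_j and b_j separately; `Gbound` is the bound for this average.
  G : ℕ → Cfg → ℕ
  G zero    cf = low 0 cf
  G (suc σ) cf = choose (σ <? T) (test (suc σ) cf) (high (suc T) cf)

  V : ℕ
  V = 12 * (D * D)

  Gbound : ℕ → ℕ
  Gbound zero    = endCost (Θ 0) (J 1 * V)
  Gbound (suc σ) = choose (σ <? T) (testCost (Θ (suc σ)) (J (suc (suc σ)) * V + J (suc (suc σ)) * V))
                                   (endCost (Θ (suc T)) (J (suc (suc T)) * V))

  private
    m≥1 : 1 ≤ m
    m≥1 = subst (1 ≤_) (sym m≡) (≤-trans (≤-trans (s≤s z≤n) 16≤m₂) (m≤m+n m₂ _))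

    2≤m : 2 ≤ m
    2≤m = subst (2 ≤_) (sym m≡) (*-monoʳ-≤ 2 (≤-trans (s≤s z≤n) 16≤m₂))

    J-suc : ∀ t → J (suc t) ≡ m * k t
    J-suc t = trans (cong (λ z → z * z) (a-suc t)) (r m (a t))
      where
      r : ∀ m a → m * a * (m * a) ≡ m * (m * (a * a))
      r = solve-∀

    k≤J : ∀ t → k t + k t ≤ J (suc t)
    k≤J t = ≤-trans (≤-reflexive (cong (k t +_) (sym (+-identityʳ (k t))))) (≤-trans (*-monoˡ-≤ (k t) 2≤m) (≤-reflexive (sym (J-suc t))))

    J≤k : ∀ t → J t ≤ k t
    J≤k t = m≤n*m (J t) m {{>-nonZero m≥1}}

    J-step : ∀ t → J t ≤ J (suc t)
    J-step t = ≤-trans (J≤k t) (≤-trans (m≤m+n (k t) (k t)) (k≤J t))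

    lo≤J : ∀ t → lo t ≤ J (suc t)
    lo≤J zero    = z≤n
    lo≤J (suc t) = J-step (suc t)

    lo-mono : ∀ {s t} → s ≤ t → lo s ≤ lo t
    lo-mono {zero} _ = z≤n
    lo-mono {suc s} {suc t} (s≤s p) = go p
      where
      go : ∀ {s t} → s ≤ t → J (suc s) ≤ J (suc t)
      go {s} {t} p = subst (λ z → J (suc s) ≤ J (suc z)) (m+[n∸m]≡n p) (steps (t ∸ s))
        where
        steps : ∀ n → J (suc s) ≤ J (suc (s + n))
        steps zero    = ≤-reflexive (cong (J ∘ suc) (sym (+-identityʳ s)))
        steps (suc n) = ≤-trans (steps n) (≤-trans (J-step (suc (s + n))) (≤-reflexive (cong (J ∘ suc) (sym (+-suc s n)))))

    off-inner : ∀ d t → t ≤ suc T → off d t ≡ lo t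
    off-inner d zero    _ = refl
    off-inner d (suc t) (s≤s p) with t ≤? T
    ... | yes _ = refl
    ... | no ¬p = contradiction p ¬p

    off-last : ∀ d → off d (suc (suc T)) ≡ d
    off-last d with suc T ≤? T
    ... | yes p = contradiction p 1+n≰n
    ... | no  _ = refl

    G-test : ∀ σ cf → σ < T → G (suc σ) cf ≡ test (suc σ) cf
    G-test σ cf p = choose-yes (σ <? T) p

    G-high : ∀ cf → G (suc T) cf ≡ high (suc T) cf
    G-high cf = choose-no (T <? T) (<-irrefl refl)

  Gbound-test : ∀ σ → σ < T → Gbound (suc σ) ≡ testCost (Θ (suc σ)) (J (suc (suc σ)) * V + J (suc (suc σ)) * V)
  Gbound-test σ p = choose-yes (σ <? T) p

  Gbound-high : Gbound (suc T) ≡ endCost (Θ (suc T)) (J (suc (suc T)) * V)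
  Gbound-high = choose-no (T <? T) (<-irrefl refl)

  private
    Dom-cong : ∀ {F H C C′} → (∀ cf → F cf ≡ H cf) → C ≡ C′ → Dom H C → Dom F C′
    Dom-cong {F} {H} {C} {C′} p q = Dom-≤ F H C C′ (λ cf → ≤-reflexive (p cf)) (≤-reflexive q)

    Dom-const : ∀ F C θ → Dom F C → Dom (λ cf → F cf * θ) (θ * C)
    Dom-const F C θ h = Dom-cong {λ cf → F cf * θ} {λ cf → θ * F cf} {θ * C} (λ cf → *-comm (F cf) θ) refl (Dom-*ˡ θ F C h)

    module _ (F : Cfg → ℕ) (C : ℕ) where

      Dom-end : ∀ θ v (n : Cfg → ℕ) → Dom F C → Dom (λ cf → F cf * n cf) (v * C) → Dom (λ cf → F cf * endCost θ (n cf)) (C * endCost θ v)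
      Dom-end θ v n h h′ = Dom-cong {λ cf → F cf * endCost θ (n cf)} {λ cf → F cf * θ + 128 * (F cf * n cf)} {θ * C + 128 * (v * C)}
        (λ cf → trans (cong (F cf *_) (endCost-≡ θ (n cf))) (r₁ (F cf) θ (n cf)))
        (trans (r₂ θ v C) (cong (C *_) (sym (endCost-≡ θ v))))
        (Dom-+ (λ cf → F cf * θ) (λ cf → 128 * (F cf * n cf)) (θ * C) (128 * (v * C)) (Dom-const F C θ h)
          (Dom-*ˡ 128 (λ cf → F cf * n cf) (v * C) h′))
        where
        r₁ : ∀ F θ n → F * (θ + 128 * n) ≡ F * θ + 128 * (F * n)
        r₁ = solve-∀
        r₂ : ∀ θ v C → θ * C + 128 * (v * C) ≡ C * (θ + 128 * v)
        r₂ = solve-∀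

      Dom-inner : ∀ θ v (n : Cfg → ℕ) → Dom F C → Dom (λ cf → F cf * n cf) (v * C) → Dom (λ cf → F cf * testCost θ (n cf)) (C * testCost θ v)
      Dom-inner θ v n h h′ = Dom-cong {λ cf → F cf * testCost θ (n cf)} {λ cf → F cf * (9 * θ) + 2048 * (F cf * n cf)} {9 * θ * C + 2048 * (v * C)}
        (λ cf → trans (cong (F cf *_) (testCost-≡ θ (n cf))) (r₁ (F cf) (9 * θ) (n cf) 2048))
        (trans (r₂ (9 * θ) v C 2048) (cong (C *_) (sym (testCost-≡ θ v))))
        (Dom-+ (λ cf → F cf * (9 * θ)) (λ cf → 2048 * (F cf * n cf)) (9 * θ * C) (2048 * (v * C)) (Dom-const F C (9 * θ) h)
          (Dom-*ˡ 2048 (λ cf → F cf * n cf) (v * C) h′))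
        where
        r₁ : ∀ F θ n s → F * (θ + s * n) ≡ F * θ + s * (F * n)
        r₁ = solve-∀
        r₂ : ∀ θ v C s → θ * C + s * (v * C) ≡ C * (θ + s * v)
        r₂ = solve-∀

      Dom-low : Dom F C → Indep-from 0 F → Dom (λ cf → F cf * low 0 cf) (C * endCost (Θ 0) (J 1 * V))
      Dom-low h inv = Dom-end (Θ 0) (J 1 * V) (noise₁ 0 (J 1)) h
        (Dom-cong {λ cf → F cf * noise₁ 0 (J 1) cf} {λ cf → F cf * noise₁ 0 (J 1) cf} {J 1 * (V * C)} (λ _ → refl) (sym (*-assoc (J 1) V C)) (Dom-noise₁ F C 0 (J 1) h inv))

      Dom-noise₀′ : ∀ t n → Dom F C → Indep-from (J t) F → Dom (λ cf → F cf * (k t * k t * noise₀ (J t) n cf)) (J (suc t) * (V * C))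
      Dom-noise₀′ t n h inv = Dom-noise₀ F C (J t) n (k t * k t) (J (suc t)) (trans (r m (J t)) (cong (_* J t) (sym (J-suc t)))) h inv
        where
        r : ∀ m j → m * j * (m * j) ≡ m * (m * j) * j
        r = solve-∀

      Dom-test : ∀ t → Dom F C → Indep-from (J t) F → Dom (λ cf → F cf * test t cf) (C * testCost (Θ t) (J (suc t) * V + J (suc t) * V))
      Dom-test t h inv = Dom-inner (Θ t) (J (suc t) * V + J (suc t) * V) (λ cf → n₁ cf + n₂ cf) h
        (Dom-cong {λ cf → F cf * (n₁ cf + n₂ cf)} {λ cf → F cf * n₁ cf + F cf * n₂ cf} {j * (V * C) + j * (V * C)}
          (λ cf → *-distribˡ-+ (F cf) (n₁ cf) (n₂ cf)) (r j V C)
          (Dom-+ (λ cf → F cf * n₁ cf) (λ cf → F cf * n₂ cf) (j * (V * C)) (j * (V * C))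
            (Dom-≤ (λ cf → F cf * n₁ cf) (λ cf → F cf * n₁ cf) (len t * (V * C)) (j * (V * C))
               (λ _ → ≤-refl) (*-monoˡ-≤ (V * C) (m∸n≤m j (lo t))) (Dom-noise₁ F C (J t) (len t) h inv))
            (Dom-noise₀′ t (len t) h inv)))
        where
        j = J (suc t)
        n₁ n₂ : Cfg → ℕ
        n₁ = noise₁ (J t) (len t)
        n₂ cf = k t * k t * noise₀ (J t) (len t) cf
        r : ∀ j V C → j * (V * C) + j * (V * C) ≡ (j * V + j * V) * C
        r = solve-∀

      Dom-high : ∀ t → Dom F C → Indep-from (J t) F → Dom (λ cf → F cf * high t cf) (C * endCost (Θ t) (J (suc t) * V))
      Dom-high t h inv = Dom-end (Θ t) (J (suc t) * V) n₂ h
        (Dom-cong {λ cf → F cf * n₂ cf} {λ cf → F cf * n₂ cf} {J (suc t) * (V * C)} (λ _ → refl) (sym (*-assoc (J (suc t)) V C)) (Dom-noise₀′ t K h inv))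
        where
        n₂ : Cfg → ℕ
        n₂ cf = k t * k t * noise₀ (J t) K cf

    indep-≥ : ∀ t → t ≤ T → Indep-from (lo (suc t)) (G t)
    indep-≥ zero    _ s i h t cf = cong (endCost (Θ 0)) (proj₁ (noise-indep 0 (J 1) s i h) t cf)
    indep-≥ (suc σ) p s i h t cf = trans (G-test σ (add s i t cf) p) (trans
      (cong₂ (λ x y → testCost (Θ (suc σ)) (x + k (suc σ) * k (suc σ) * y)) (proj₁ ni t cf) (proj₂ ni t cf)) (sym (G-test σ cf p)))
      where
      ni = noise-indep (J (suc σ)) (len (suc σ)) s i (subst (_≤ i) (sym (m+[n∸m]≡n (lo≤J (suc σ)))) h)

    -- The constraint on the total makes the blocks dependent, so the means cannot just be
    -- multiplied. Attaching the blocks in increasing order works, because each step requires only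
    -- that the product so far ignores the entries of the next block.
    product : ∀ n → n ≤ suc T → Dom (λ cf → ∏ n (λ t → G t cf)) (∏ n Gbound) × Indep-from (lo n) (λ cf → ∏ n (λ t → G t cf))
    product zero    _ = base , (λ s i _ t cf → refl)
    product (suc n) (s≤s n≤T) =
        Dom-cong {λ cf → ∏ (suc n) (λ t → G t cf)} {λ cf → ∏ n (λ t → G t cf) * G n cf} {∏ n Gbound * Gbound n}
          (λ cf → ∏-last n (λ t → G t cf)) (sym (∏-last n Gbound)) (dom n n≤T (proj₁ ih) (proj₂ ih))
      , (λ s i h t cf → trans (∏-last n (λ t′ → G t′ (add s i t cf))) (trans
          (cong₂ _*_ (proj₂ ih s i (≤-trans (lo-mono (n≤1+n n)) h) t cf) (indep-≥ n n≤T s i h t cf)) (sym (∏-last n (λ t′ → G t′ cf)))))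
      where
      ih = product n (m≤n⇒m≤1+n n≤T)
      dom : ∀ n → n ≤ T → Dom (λ cf → ∏ n (λ t → G t cf)) (∏ n Gbound) → Indep-from (lo n) (λ cf → ∏ n (λ t → G t cf)) →
            Dom (λ cf → ∏ n (λ t → G t cf) * G n cf) (∏ n Gbound * Gbound n)
      dom zero    _ h inv = Dom-low (λ _ → 1) 1 h inv
      dom (suc σ) p h inv = Dom-cong {λ cf → F cf * G (suc σ) cf} {λ cf → F cf * test (suc σ) cf} {C * (testCost (Θ (suc σ)) (J (suc (suc σ)) * V + J (suc (suc σ)) * V))}
        (λ cf → cong (F cf *_) (G-test σ cf p)) (cong (C *_) (sym (Gbound-test σ p))) (Dom-test F C (suc σ) h inv)
        where
        F : Cfg → ℕ
        F cf = ∏ (suc σ) (λ t → G t cf)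
        C = ∏ (suc σ) Gbound

    Dom-all : Dom (λ cf → ∏ (suc (suc T)) (λ t → G t cf)) (∏ (suc (suc T)) Gbound)
    Dom-all = Dom-cong {λ cf → ∏ (suc (suc T)) (λ t → G t cf)} {λ cf → F cf * high (suc T) cf} {C * (endCost (Θ (suc T)) (J (suc (suc T)) * V))}
      (λ cf → trans (∏-last (suc T) (λ t → G t cf)) (cong (F cf *_) (G-high cf)))
      (trans (cong (C *_) (sym Gbound-high)) (sym (∏-last (suc T) Gbound)))
      (Dom-high F C (suc T) (proj₁ (product (suc T) ≤-refl)) (proj₂ (product (suc T) ≤-refl)))
      where
      F : Cfg → ℕ
      F cf = ∏ (suc T) (λ t → G t cf)
      C = ∏ (suc T) Gbound

    noise₁-bound : ∀ o z (cf : Cfg) n → At o z (λ i → diff i cf) → length z ≤ n → energy (λ j → j * j) o z ≤ noise₁ o n cf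
    noise₁-bound o z cf n at h = ≤-trans (≤-reflexive (energy-At _ o z _ at)) (≤-trans (∑-len _ h)
      (∑-mono n λ i _ → *-monoʳ-≤ (suc (o + i) * suc (o + i)) (sq-diff (o + i) cf)))

    noise₀-bound : ∀ κ o z (cf : Cfg) n → At o z (λ i → diff i cf) → length z ≤ n → energy (λ _ → κ) o z ≤ κ * noise₀ o n cf
    noise₀-bound κ o z cf n at h = ≤-trans (≤-reflexive (energy-At _ o z _ at)) (≤-trans (∑-len _ h)
      (≤-trans (∑-mono n λ i _ → *-monoʳ-≤ κ (sq-diff (o + i) cf)) (≤-reflexive (∑-*ˡ n κ _))))

    module _ (cf : Cfg) (d≥ : J (suc T) ≤ length cf) (d< : length cf ≤ K)
             (isDense : ∀ σ → σ < T → k (suc σ) ≤ 4 * ∑ (k (suc σ)) (λ i → 𝟙 (α σ ≤? dist (k (suc σ) + i) cf))) where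

      d : ℕ
      d = length cf
      bs : List (List ℤ)
      bs = chop (suc T) (off d) (diffs cf)

      off-step : ∀ t → t ≤ suc T → off d t ≤ off d (suc t)
      off-step t p with m≤n⇒m<n∨m≡n p
      ... | inj₁ (s≤s q) = subst₂ _≤_ (sym (off-inner d t p)) (sym (off-inner d (suc t) (s≤s q))) (lo-mono (n≤1+n t))
      ... | inj₂ refl    = subst₂ _≤_ (sym (off-inner d t p)) (sym (off-last d)) d≥

      at : ∀ t → t ≤ suc T → At (off d t) (nthL t bs) (λ i → diff i cf)
      at = At-chop (suc T) (off d) (diffs cf) _ (λ t p → off-step t (<⇒≤ p)) (At-diffs cf)

      edges : ∀ t → t < suc (suc T) → off d t + length (nthL t bs) ≡ off d (suc t)
      edges t (s≤s p) = edges-chop (suc T) (off d) (diffs cf) off-step (trans (length-diffs cf) (sym (off-last d))) t p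

      block-len : ∀ t → t ≤ T → length (nthL t bs) ≡ len t
      block-len t p = trans (sym (m+n∸m≡n (off d t) (length (nthL t bs))))
        (cong₂ _∸_ (trans (edges t (s≤s (m≤n⇒m≤1+n p))) (off-inner d (suc t) (s≤s p))) (off-inner d t (m≤n⇒m≤1+n p)))

      last-len : length (nthL (suc T) bs) ≤ K
      last-len = ≤-trans (≤-trans (m≤n+m _ (off d (suc T))) (≤-reflexive (trans (edges (suc T) ≤-refl) (off-last d)))) d<

      at′ : ∀ t → t ≤ suc T → At (lo t) (nthL t bs) (λ i → diff i cf)
      at′ t p = subst (λ o → At o (nthL t bs) (λ i → diff i cf)) (off-inner d t p) (at t p)

      off-mid : ∀ t → 1 ≤ t → t ≤ suc T → off d t ≡ J t
      off-mid (suc t) _ p = off-inner d (suc t) p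

      big-blocks : ∀ σ → σ < T → k (suc σ) ≤ 4 * countBig w (_⊓ k (suc σ)) (off d (suc σ)) (nthL (suc σ) bs)
      big-blocks σ p = ≤-trans (isDense σ p) (*-monoʳ-≤ 4 (begin
        ∑ κ (λ i → 𝟙 (α σ ≤? dist (κ + i) cf))
          ≤⟨ (∑-mono κ λ i _ → 𝟙-mono (α σ ≤? dist (κ + i) cf) (w ≤? (suc (κ + i) ⊓ κ) * ∣ diff (κ + i) cf ∣) λ h → begin
               w                                             ≡⟨ sym (kα≡w σ p) ⟩
               κ * α σ                                       ≤⟨ *-monoʳ-≤ κ h ⟩
               κ * dist (κ + i) cf
                 ≡⟨ cong₂ _*_ (sym (m≥n⇒m⊓n≡n (m≤n⇒m≤1+n (m≤m+n κ i)))) (sym (absdiff (ent true (κ + i) cf) (ent false (κ + i) cf))) ⟩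
               (suc (κ + i) ⊓ κ) * ∣ diff (κ + i) cf ∣       ∎) ⟩
        ∑ κ (λ i → g (κ + i))
          ≡⟨ (∑-cong κ λ i _ → cong g (trans (cong (_+ i) (sym o+r)) (+-assoc o r i))) ⟩
        ∑ κ (λ i → g (o + (r + i)))
          ≤⟨ ≤-trans (m≤n+m _ (∑ r (λ i → g (o + i)))) (≤-reflexive (sym (∑-split r κ (λ i → g (o + i))))) ⟩
        ∑ (r + κ) (λ i → g (o + i))
          ≤⟨ ∑-len _ (≤-trans fits (≤-reflexive (sym (block-len (suc σ) p)))) ⟩
        ∑ (length (nthL (suc σ) bs)) (λ i → g (o + i))
          ≡⟨ sym (countBig-At w (_⊓ κ) o (nthL (suc σ) bs) _ (at′ (suc σ) (m≤n⇒m≤1+n p))) ⟩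
        countBig w (_⊓ κ) o (nthL (suc σ) bs)
          ≡⟨ cong (λ z → countBig w (_⊓ κ) z (nthL (suc σ) bs)) (sym (off-inner d (suc σ) (m≤n⇒m≤1+n p))) ⟩
        countBig w (_⊓ κ) (off d (suc σ)) (nthL (suc σ) bs) ∎))
        where
        open ≤-Reasoning
        κ o r : ℕ
        κ = k (suc σ)
        o = J (suc σ)
        r = κ ∸ o
        g : ℕ → ℕ
        g j = 𝟙 (w ≤? (suc j ⊓ κ) * ∣ diff j cf ∣)
        o+r : o + r ≡ κ
        o+r = m+[n∸m]≡n (J≤k (suc σ))
        fits : r + κ ≤ len (suc σ)
        fits = +-cancelˡ-≤ o _ _ (≤-trans (≤-reflexive (trans (sym (+-assoc o r κ)) (cong (_+ κ) o+r)))
                 (≤-trans (k≤J (suc σ)) (≤-reflexive (sym (m+[n∸m]≡n (J-step (suc σ)))))))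

      noiseP noiseQ : ℕ → ℕ
      noiseP t = Signs.noiseP S (off d) refl off-mid t (nthL t bs)
      noiseQ t = Signs.noiseQ S (off d) refl off-mid t (nthL t bs)

      noiseP≤ : ∀ t → t ≤ T → noiseP t ≤ noise₁ (lo t) (len t) cf
      noiseP≤ t p = subst (λ o → energy (λ j → j * j) o (nthL t bs) ≤ noise₁ (lo t) (len t) cf) (sym (off-inner d t (m≤n⇒m≤1+n p)))
        (noise₁-bound (lo t) (nthL t bs) cf (len t) (at′ t (m≤n⇒m≤1+n p)) (≤-reflexive (block-len t p)))

      noiseQ≤ : ∀ t n → t ≤ suc T → length (nthL t bs) ≤ n → noiseQ t ≤ k t * k t * noise₀ (lo t) n cf
      noiseQ≤ t n p h = subst (λ o → energy (λ _ → k t * k t) o (nthL t bs) ≤ k t * k t * noise₀ (lo t) n cf) (sym (off-inner d t p))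
        (noise₀-bound (k t * k t) (lo t) (nthL t bs) cf n (at′ t p) h)

      bounds : ∀ t → t < suc (suc T) → Signs.bound S (off d) refl off-mid t (nthL t bs) ≤ G t cf
      bounds zero _ = endCost-mono (Θ 0) (noiseP≤ 0 z≤n)
      bounds (suc σ) q = by-cases (σ <? T)
        where
        by-cases : Dec (σ < T) → Signs.bound S (off d) refl off-mid (suc σ) (nthL (suc σ) bs) ≤ G (suc σ) cf
        by-cases (yes p) = ≤-trans (≤-reflexive (Signs.bound-test S (off d) refl off-mid σ (nthL (suc σ) bs) p))
          (≤-trans (testCost-mono (Θ (suc σ)) (+-mono-≤ (noiseP≤ (suc σ) p)
            (noiseQ≤ (suc σ) (len (suc σ)) (≤-pred q) (≤-reflexive (block-len (suc σ) p)))))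
          (≤-reflexive (sym (G-test σ cf p))))
        by-cases (no ¬p) with ≤-antisym (≤-pred (≤-pred q)) (≮⇒≥ ¬p)
        ... | refl = ≤-trans (≤-reflexive (Signs.bound-high S (off d) refl off-mid (nthL (suc T) bs)))
          (≤-trans (endCost-mono (Θ (suc T)) (noiseQ≤ (suc T) K ≤-refl last-len))
          (≤-reflexive (sym (G-high cf))))

      signs-bound : 16 ^ T * sumS (diffs cf) survives * ∏ (suc (suc T)) Θ ≤ 2 ^ d * ∏ (suc (suc T)) (λ t → G t cf)
      signs-bound = begin
        16 ^ T * sumS (diffs cf) survives * ∏ (suc (suc T)) Θ
          ≡⟨ cong (λ z → 16 ^ T * sumS z survives * ∏ (suc (suc T)) Θ) (sym (concat-chop (suc T) (off d) (diffs cf))) ⟩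
        16 ^ T * sumS (concat bs) survives * ∏ (suc (suc T)) Θ
          ≤⟨ Signs.signs-total S (off d) refl off-mid bs (length-chop (suc T) (off d) (diffs cf)) edges big-blocks ⟩
        2 ^ length (concat bs) * ∏ (suc (suc T)) (λ t → Signs.bound S (off d) refl off-mid t (nthL t bs))
          ≤⟨ *-mono-≤ (≤-reflexive (cong (2 ^_) (trans (cong length (concat-chop (suc T) (off d) (diffs cf))) (length-diffs cf))))
               (∏-mono (suc (suc T)) bounds) ⟩
        2 ^ d * ∏ (suc (suc T)) (λ t → G t cf) ∎
        where open ≤-Reasoning

  long? : ∀ (cf : Cfg) → Dec (J (suc T) ≤ length cf)
  long? cf = J (suc T) ≤? length cf

  regular : Cfg → ℕ
  regular cf = 𝟙 (long? cf) * dense cf * 𝟙 (exactly? y₀ cf)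

  private
    -- Regularity depends only on the length, the weight and the |b_j - a_j|, so restricting to it
    -- leaves the signs uniform.
    swapped-regular : ∀ {cf cf′} → Swapped cf cf′ → regular cf′ ≡ regular cf
    swapped-regular {cf} {cf′} s = cong₂ _*_ (cong₂ _*_
        (cong (λ z → 𝟙 (J (suc T) ≤? z)) (sym (swapped-length s)))
        (∏-cong T λ σ _ → cong (λ z → 𝟙 (k (suc σ) ≤? 4 * z)) (∑-cong (k (suc σ)) λ i _ → cong (λ z → 𝟙 (α σ ≤? z)) (sym (swapped-dist (k (suc σ) + i) s)))))
      (cong₂ (λ x y → 𝟙 (x * x + y + y₀ ℕ.≟ N₀)) (sym (swapped-length s)) (sym (swapped-weight 0 s)))

    per-config : ∀ d (cf : Cfg) → d < K → length cf ≡ d →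
      16 ^ T * ∏ (suc (suc T)) Θ * sumSw cf (λ z → regular z * survives (diffs z)) ≤ 2 ^ d * (∏ (suc (suc T)) (λ t → G t cf) * 𝟙 (exactly? y₀ cf))
    per-config d cf d<K refl = begin
      A * sumSw cf (λ z → regular z * survives (diffs z))
        ≤⟨ *-monoʳ-≤ A (sumSw-mono cf λ z s → ≤-reflexive (cong (_* survives (diffs z)) (swapped-regular s))) ⟩
      A * sumSw cf (λ z → regular cf * survives (diffs z))
        ≡⟨ cong (A *_) (trans (sumSw-*ˡ cf (regular cf) (λ z → survives (diffs z))) (cong (regular cf *_) (sumSw-diffs cf survives))) ⟩
      A * (regular cf * sumS (diffs cf) survives)
        ≤⟨ core (long? cf) (∏-dichotomy T (λ σ → dense? σ cf)) ⟩
      2 ^ d * (∏ (suc (suc T)) (λ t → G t cf) * 𝟙 (exactly? y₀ cf)) ∎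
      where
      open ≤-Reasoning
      A = 16 ^ T * ∏ (suc (suc T)) Θ
      zeroed : ∀ x → regular cf ≡ 0 → A * (regular cf * x) ≤ 2 ^ d * (∏ (suc (suc T)) (λ t → G t cf) * 𝟙 (exactly? y₀ cf))
      zeroed x e = ≤-trans (≤-reflexive (trans (cong (λ z → A * (z * x)) e) (*-zeroʳ A))) z≤n
      r₁ : ∀ A Θ o S → A * Θ * (o * S) ≡ A * S * Θ * o
      r₁ = solve-∀
      core : Dec (J (suc T) ≤ length cf) →
             dense cf ≡ 0 ⊎ (dense cf ≡ 1 × (∀ σ → σ < T → k (suc σ) ≤ 4 * ∑ (k (suc σ)) (λ i → 𝟙 (α σ ≤? dist (k (suc σ) + i) cf)))) →
             A * (regular cf * sumS (diffs cf) survives) ≤ 2 ^ d * (∏ (suc (suc T)) (λ t → G t cf) * 𝟙 (exactly? y₀ cf))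
      core (no ¬p) _ = zeroed _ (cong (λ z → z * dense cf * 𝟙 (exactly? y₀ cf)) (𝟙-no (long? cf) ¬p))
      core (yes _) (inj₁ e) = zeroed _ (cong (_* 𝟙 (exactly? y₀ cf)) (trans (cong (𝟙 (long? cf) *_) e) (*-zeroʳ (𝟙 (long? cf)))))
      core (yes p) (inj₂ (e , good)) = begin
        A * (regular cf * sumS (diffs cf) survives)
          ≡⟨ cong (λ z → A * (z * 𝟙 (exactly? y₀ cf) * sumS (diffs cf) survives)) (cong₂ _*_ (𝟙-yes (long? cf) p) e) ⟩
        A * (1 * 𝟙 (exactly? y₀ cf) * sumS (diffs cf) survives)
          ≡⟨ cong (λ z → A * (z * sumS (diffs cf) survives)) (*-identityˡ (𝟙 (exactly? y₀ cf))) ⟩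
        A * (𝟙 (exactly? y₀ cf) * sumS (diffs cf) survives)
          ≡⟨ r₁ (16 ^ T) (∏ (suc (suc T)) Θ) (𝟙 (exactly? y₀ cf)) (sumS (diffs cf) survives) ⟩
        16 ^ T * sumS (diffs cf) survives * ∏ (suc (suc T)) Θ * 𝟙 (exactly? y₀ cf)
          ≤⟨ *-monoˡ-≤ (𝟙 (exactly? y₀ cf)) (signs-bound cf p (<⇒≤ d<K) good) ⟩
        2 ^ d * ∏ (suc (suc T)) (λ t → G t cf) * 𝟙 (exactly? y₀ cf)
          ≡⟨ *-assoc (2 ^ d) _ (𝟙 (exactly? y₀ cf)) ⟩
        2 ^ d * (∏ (suc (suc T)) (λ t → G t cf) * 𝟙 (exactly? y₀ cf)) ∎

  -- Averaging over the exchanges introduces the signs, `signs-bound` sums them out, and `Dom-all`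
  -- averages the squares that remain.
  survivors : 16 ^ T * ∏ (suc (suc T)) Θ * ΣΩ (λ cf → regular cf * survives (diffs cf)) ≤ ∏ (suc (suc T)) Gbound * f y₀
  survivors = ≤-trans (≤-trans (≤-reflexive (sym (∑-*ˡ K A _))) (∑-mono K λ d d<K → *-cancelˡ-≤ (2 ^ d) {{m^n≢0 2 d}} (begin
      2 ^ d * (A * sumP K d Φ)                    ≡⟨ trans (r (2 ^ d) A _) (cong (A *_) (sym (sumP-swap K d Φ))) ⟩
      A * sumP K d (λ cf → sumSw cf Φ)            ≡⟨ sym (sumP-*ˡ K d A _) ⟩
      sumP K d (λ cf → A * sumSw cf Φ)            ≤⟨ sumP-mono K d (λ cf e → per-config d cf d<K e) ⟩
      sumP K d (λ cf → 2 ^ d * Ψ cf)              ≡⟨ sumP-*ˡ K d (2 ^ d) Ψ ⟩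
      2 ^ d * sumP K d Ψ                          ∎)))
    (Dom-all y₀ ≤-refl)
    where
    open ≤-Reasoning
    A = 16 ^ T * ∏ (suc (suc T)) Θ
    Φ Ψ : Cfg → ℕ
    Φ cf = regular cf * survives (diffs cf)
    Ψ cf = ∏ (suc (suc T)) (λ t → G t cf) * 𝟙 (exactly? y₀ cf)
    r : ∀ p A x → p * (A * x) ≡ A * (p * x)
    r = solve-∀

-- Short and sparse configurations are rare.

power-compare : ∀ n → 2 ^ n * (10000 ^ n * 10000 ^ n) ≤ 16384 ^ n * 16384 ^ n
power-compare n = begin
  2 ^ n * (10000 ^ n * 10000 ^ n)   ≡⟨ cong (2 ^ n *_) (sym (^-distribʳ-* n 10000 10000)) ⟩
  2 ^ n * 100000000 ^ n             ≡⟨ sym (^-distribʳ-* n 2 100000000) ⟩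
  200000000 ^ n                     ≤⟨ ^-monoˡ-≤ n (m≤m+n 200000000 68435456) ⟩
  268435456 ^ n                     ≡⟨ ^-distribʳ-* n 16384 16384 ⟩
  16384 ^ n * 16384 ^ n             ∎
  where open ≤-Reasoning

module Irregular
  (N₀ K : ℕ) (K≡ : K ≡ suc N₀)
  (base : ∀ y → Omega.ΣΩ N₀ K K≡ (λ c → 𝟙 (Omega.exactly? N₀ K K≡ y c)) ≤ Partitions.f N₀ K K≡ y)
  (h I : ℕ) (grow : ∀ y → y ≤ h * I → Partitions.f N₀ K K≡ y ≤ 128 * Partitions.f N₀ K K≡ (y + h * 7))
  where

  open Partitions N₀ K K≡
  open Omega N₀ K K≡

  private
    -- A bounded total takes one of at most K values, each with at most f y configurations.
    within-bound : ∀ y → ΣΩ (λ c → 1 * 𝟙 (within? y c)) ≤ K * f y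
    within-bound y = begin
      ΣΩ (λ c → 1 * 𝟙 (within? y c))
        ≤⟨ ΣΩ-mono (λ c → ≤-trans (≤-reflexive (*-identityˡ (𝟙 (within? y c)))) (pointwise c)) ⟩
      ΣΩ (λ c → ∑ K λ z → 𝟙 (exactly? (y + z) c))
        ≡⟨ ΣΩ-∑ K (λ z c → 𝟙 (exactly? (y + z) c)) ⟩
      ∑ K (λ z → ΣΩ (λ c → 𝟙 (exactly? (y + z) c)))
        ≤⟨ (∑-mono K λ z _ → ≤-trans (base (y + z)) (f-anti (m≤m+n y z))) ⟩
      ∑ K (λ _ → f y)
        ≡⟨ ∑-const K (f y) ⟩
      K * f y ∎
      where
      open ≤-Reasoning
      pointwise : ∀ c → 𝟙 (within? y c) ≤ ∑ K λ z → 𝟙 (exactly? (y + z) c)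
      pointwise c = by-cases (within? y c)
        where
        by-cases : (d : Dec (size c + y ≤ N₀)) → 𝟙 d ≤ ∑ K λ z → 𝟙 (exactly? (y + z) c)
        by-cases (no _)  = z≤n
        by-cases (yes p) = ≤-trans (≤-reflexive (sym (𝟙-yes (exactly? (y + z) c) (trans (sym (+-assoc (size c) y z)) (m+[n∸m]≡n p)))))
          (∑-term K (λ z → 𝟙 (exactly? (y + z) c)) (subst (z <_) (sym K≡) (s≤s (m∸n≤m N₀ (size c + y)))))
          where
          z = N₀ ∸ (size c + y)

    -- A jump by 7 h costs 128 = 2⁷, so a step h costs 2. Since only multiples of 7 steps are
    -- available, the chain may pass I by up to 7, whence I + 7 in the exponent.
    growth : ∀ r i → i + r * 7 ≤ I + 7 → I ≤ i + r * 7 → 2 ^ i * f (h * i) ≤ 2 ^ (I + 7) * f (h * I)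
    growth zero i le ge = *-mono-≤ (^-monoʳ-≤ 2 (subst (_≤ I + 7) (+-identityʳ i) le))
      (f-anti (*-monoʳ-≤ h (subst (I ≤_) (+-identityʳ i) ge)))
    growth (suc r) i le ge = begin
      2 ^ i * f (h * i)
        ≤⟨ *-monoʳ-≤ (2 ^ i) (grow (h * i) (*-monoʳ-≤ h i≤I)) ⟩
      2 ^ i * (128 * f (h * i + h * 7))
        ≡⟨ trans (sym (*-assoc (2 ^ i) 128 _)) (cong₂ _*_ (sym (^-distribˡ-+-* 2 i 7)) (cong f (sym (*-distribˡ-+ h i 7)))) ⟩
      2 ^ (i + 7) * f (h * (i + 7))
        ≤⟨ growth r (i + 7) (subst (_≤ I + 7) (sym (+-assoc i 7 (r * 7))) le) (subst (I ≤_) (sym (+-assoc i 7 (r * 7))) ge) ⟩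
      2 ^ (I + 7) * f (h * I) ∎
      where
      open ≤-Reasoning
      i≤I : i ≤ I
      i≤I = +-cancelʳ-≤ 7 i I (≤-trans (+-monoʳ-≤ i (m≤m+n 7 (r * 7))) le)

    steps : ∀ j i → I ≤ i + j → i ≤ I → ∃ λ r → i + r * 7 ≤ I + 7 × I ≤ i + r * 7
    steps zero    i h₁ h₂ = 0 , ≤-trans (≤-reflexive (+-identityʳ i)) (≤-trans h₂ (m≤m+n I 7)) , h₁
    steps (suc j) i h₁ h₂ with i + 7 ≤? I
    ... | yes p = let (r , q₁ , q₂) = steps j (i + 7) (≤-trans h₁ (≤-trans (≤-reflexive (+-suc i j)) (≤-trans (+-monoˡ-≤ j (≤-trans (≤-reflexive (+-comm 1 i)) (+-monoʳ-≤ i (s≤s (z≤n {6}))))) ≤-refl))) p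
                  in suc r , subst (_≤ I + 7) (+-assoc i 7 (r * 7)) q₁ , subst (I ≤_) (+-assoc i 7 (r * 7)) q₂
    ... | no ¬p = 1 , +-monoˡ-≤ 7 h₂ , <⇒≤ (≰⇒> ¬p)

  module _ (J k k₈ α : ℕ) (k≡ : k ≡ 8 * k₈) (h≥ : 2 * k * (6 * α) ≤ h) (k≤I : k ≤ I) (2k≤J : k + k ≤ J) where

    open LowerTail k α h h≥

    private
      long? : ∀ (c : Cfg) → Dec (J ≤ length c)
      long? c = J ≤? length c

    dense? : ∀ (c : Cfg) → Dec (k ≤ 4 * ∑ k (λ i → 𝟙 (α ≤? dist (k + i) c)))
    dense? c = k ≤? 4 * ∑ k (λ i → 𝟙 (α ≤? dist (k + i) c))

    private
      n₄ : ℕ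
      n₄ = 2 * k₈

      k≡4n : k ≡ n₄ + 3 * n₄
      k≡4n = trans k≡ (r k₈)
        where
        r : ∀ x → 8 * x ≡ 2 * x + 3 * (2 * x)
        r = solve-∀

      many-bad : ∀ (c : Cfg) → J ≤ length c → ¬ (k ≤ 4 * ∑ k (λ i → 𝟙 (α ≤? dist (k + i) c))) → 4 ^ (3 * n₄) ≤ bads k c
      many-bad c long sparse = begin
        4 ^ (3 * n₄)
          ≤⟨ ^-monoʳ-≤ 4 (+-cancelˡ-≤ n₄ _ _ (≤-trans (≤-reflexive (trans (sym k≡4n) (sym total))) (+-monoˡ-≤ (∑ k b) few))) ⟩
        4 ^ ∑ k b
          ≡⟨ sym (∏-^ k 4 b) ⟩
        ∏ k (λ i → 4 ^ b i)
          ≡⟨ (∏-cong k λ i _ → flip (bad? (k + i) c)) ⟩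
        bads k c ∎
        where
        open ≤-Reasoning
        g b : ℕ → ℕ
        g i = 𝟙 (α ≤? dist (k + i) c)
        b i = 𝟙 (bad? (k + i) c)
        flip : ∀ {P : Set} (d : Dec P) → 4 ^ 𝟙 d ≡ 1 + 3 * 𝟙 d
        flip (yes _) = refl
        flip (no _)  = refl
        few : ∑ k g ≤ n₄
        few = <⇒≤ (*-cancelˡ-< 4 (∑ k g) n₄ (≤-trans (≰⇒> sparse) (≤-reflexive (trans k≡4n (r n₄)))))
          where
          r : ∀ x → x + 3 * x ≡ 4 * x
          r = solve-∀
        complement : ∀ i → i < k → g i + b i ≡ 1
        complement i i<k with α ≤? dist (k + i) c
        ... | yes p = cong suc (𝟙-no (bad? (k + i) c) λ (_ , q) → <⇒≱ q p)
        ... | no ¬p = 𝟙-yes (bad? (k + i) c) (≤-trans (+-monoʳ-< k i<k) (≤-trans 2k≤J long) , ≰⇒> ¬p)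
        total : ∑ k g + ∑ k b ≡ k
        total = trans (sym (∑-+ k g b)) (trans (∑-cong k complement) (trans (∑-const k 1) (*-identityʳ k)))

    -- Markov's inequality for `bads`: a configuration that is not dense has at least 3 k / 4 bad
    -- indices and weight at least 4^(3 k / 4), against a mean of order (10/4)^k. Eight indices gain
    -- 4¹⁴ / 10⁸ = 16384² / 10000² > 2, whence 2^k₈ with k = 8 k₈. The factor 128 K comes from
    -- `growth` and `within-bound`.
    irregular : 2 ^ k₈ * ΣΩ (λ c → 𝟙 (long? c) * 𝟙 (¬? (dense? c)) * 𝟙 (exactly? (h * I) c)) ≤ 128 * (K * f (h * I))
    irregular = *-cancelˡ-≤ (2 ^ I * (P * P)) {{m*n≢0 (2 ^ I) (P * P) {{m^n≢0 2 I}} {{m*n≢0 P P {{m^n≢0 10000 k₈}} {{m^n≢0 10000 k₈}}}}}} (begin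
      2 ^ I * (P * P) * (2 ^ k₈ * S)           ≡⟨ r₁ (2 ^ I) P (2 ^ k₈) S ⟩
      2 ^ I * (2 ^ k₈ * (P * P)) * S           ≤⟨ *-monoˡ-≤ S (*-monoʳ-≤ (2 ^ I) (power-compare k₈)) ⟩
      2 ^ I * (Q * Q) * S                      ≡⟨ r₂ (2 ^ I) (Q * Q) S ⟩
      Q * Q * (2 ^ I * S)                      ≡⟨ cong (_* (2 ^ I * S)) Q² ⟩
      4 ^ k * 4 ^ (3 * n₄) * (2 ^ I * S)       ≡⟨ r₃ (4 ^ k) (4 ^ (3 * n₄)) (2 ^ I) S ⟩
      4 ^ k * (2 ^ I * (4 ^ (3 * n₄) * S))     ≤⟨ *-monoʳ-≤ (4 ^ k) (*-monoʳ-≤ (2 ^ I) (≤-trans (≤-reflexive (sym (ΣΩ-*ˡ (4 ^ (3 * n₄)) _))) (ΣΩ-mono pointwise))) ⟩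
      4 ^ k * (2 ^ I * T (bads k) (h * I))     ≤⟨ T-bads I (K * (2 ^ (I + 7) * f (h * I))) envelope k I ≤-refl k≤I ≤-refl ⟩
      10 ^ k * (K * (2 ^ (I + 7) * f (h * I))) ≡⟨ cong₂ _*_ P² (cong (λ z → K * (z * f (h * I))) (^-distribˡ-+-* 2 I 7)) ⟩
      P * P * (K * (2 ^ I * 128 * f (h * I)))  ≡⟨ r₄ (P * P) K (2 ^ I) (f (h * I)) ⟩
      2 ^ I * (P * P) * (128 * (K * f (h * I))) ∎)
      where
      open ≤-Reasoning
      S P Q : ℕ
      S = ΣΩ (λ c → 𝟙 (long? c) * 𝟙 (¬? (dense? c)) * 𝟙 (exactly? (h * I) c))
      P = 10000 ^ k₈
      Q = 16384 ^ k₈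
      r₁ : ∀ p q t S → p * (q * q) * (t * S) ≡ p * (t * (q * q)) * S
      r₁ = solve-∀
      r₂ : ∀ p q S → p * q * S ≡ q * (p * S)
      r₂ = solve-∀
      r₃ : ∀ p q t S → p * q * (t * S) ≡ p * (t * (q * S))
      r₃ = solve-∀
      r₄ : ∀ p K t f → p * (K * (t * 128 * f)) ≡ t * p * (128 * (K * f))
      r₄ = solve-∀
      Q² : Q * Q ≡ 4 ^ k * 4 ^ (3 * n₄)
      Q² = trans (sym (^-distribˡ-+-* 16384 k₈ k₈)) (trans (^-*-assoc 4 7 (k₈ + k₈))
        (trans (cong (4 ^_) (trans (e k₈) (cong (_+ 3 * n₄) (sym k≡)))) (^-distribˡ-+-* 4 k (3 * n₄))))
        where
        e : ∀ x → 7 * (x + x) ≡ 8 * x + 3 * (2 * x)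
        e = solve-∀
      P² : 10 ^ k ≡ P * P
      P² = trans (cong (10 ^_) (trans k≡ (e k₈))) (trans (sym (^-*-assoc 10 4 (k₈ + k₈))) (^-distribˡ-+-* 10000 k₈ k₈))
        where
        e : ∀ x → 8 * x ≡ 4 * (x + x)
        e = solve-∀
      envelope : ∀ i → i ≤ I → 2 ^ i * T (λ _ → 1) (h * i) ≤ K * (2 ^ (I + 7) * f (h * I))
      envelope i i≤I = begin
        2 ^ i * T (λ _ → 1) (h * i)       ≤⟨ *-monoʳ-≤ (2 ^ i) (within-bound (h * i)) ⟩
        2 ^ i * (K * f (h * i))           ≡⟨ e (2 ^ i) K (f (h * i)) ⟩
        K * (2 ^ i * f (h * i))           ≤⟨ *-monoʳ-≤ K (let (r , q₁ , q₂) = steps I i (m≤n+m I i) i≤I in growth r i q₁ q₂) ⟩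
        K * (2 ^ (I + 7) * f (h * I))     ∎
        where
        e : ∀ p K f → p * (K * f) ≡ K * (p * f)
        e = solve-∀
      pointwise : ∀ c → 4 ^ (3 * n₄) * (𝟙 (long? c) * 𝟙 (¬? (dense? c)) * 𝟙 (exactly? (h * I) c)) ≤ bads k c * 𝟙 (within? (h * I) c)
      pointwise c = by-cases (long? c) (dense? c)
        where
        by-cases : (p : Dec (J ≤ length c)) (q : Dec (k ≤ 4 * ∑ k (λ i → 𝟙 (α ≤? dist (k + i) c)))) →
          4 ^ (3 * n₄) * (𝟙 p * 𝟙 (¬? q) * 𝟙 (exactly? (h * I) c)) ≤ bads k c * 𝟙 (within? (h * I) c)
        by-cases (no _)  _       = ≤-trans (≤-reflexive (*-zeroʳ (4 ^ (3 * n₄)))) z≤n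
        by-cases (yes _) (yes _) = ≤-trans (≤-reflexive (*-zeroʳ (4 ^ (3 * n₄)))) z≤n
        by-cases (yes p) (no ¬q) = *-mono-≤ (many-bad c p ¬q) (≤-trans (≤-reflexive (*-identityˡ (𝟙 (exactly? (h * I) c))))
          (𝟙-mono (exactly? (h * I) c) (within? (h * I) c) ≤-reflexive))

  -- Counting all choices of the entries is good enough: J log K will be small against √n, while
  -- p(n) is at least exponential in √n.
  short : ∀ J → ΣΩ (λ c → 𝟙 (¬? (J ≤? length c)) * 𝟙 (exactly? (h * I) c)) ≤ J * (K * K) ^ J
  short J = begin
    ∑ K (λ d → sumP K d (λ c → 𝟙 (¬? (J ≤? length c)) * 𝟙 (exactly? (h * I) c)))
      ≤⟨ (∑-mono K λ d _ → ≤-trans (sumP-mono K d λ c e → ≤-trans (*-monoʳ-≤ (𝟙 (¬? (J ≤? length c))) (𝟙≤1 (exactly? (h * I) c)))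
            (≤-reflexive (trans (*-identityʳ (𝟙 (¬? (J ≤? length c)))) (cong (λ l → 𝟙 (¬? (J ≤? l))) e))))
            (≤-reflexive (sumP-const K d (𝟙 (¬? (J ≤? d)))))) ⟩
    ∑ K (λ d → (K * K) ^ d * 𝟙 (¬? (J ≤? d)))
      ≤⟨ ∑-len _ (m≤n+m K J) ⟩
    ∑ (J + K) (λ d → (K * K) ^ d * 𝟙 (¬? (J ≤? d)))
      ≡⟨ ∑-split J K _ ⟩
    ∑ J (λ d → (K * K) ^ d * 𝟙 (¬? (J ≤? d))) + ∑ K (λ i → (K * K) ^ (J + i) * 𝟙 (¬? (J ≤? (J + i))))
      ≡⟨ cong (∑ J (λ d → (K * K) ^ d * 𝟙 (¬? (J ≤? d))) +_) (∑-zero K λ i _ → trans (cong ((K * K) ^ (J + i) *_)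
           (𝟙-no (¬? (J ≤? (J + i))) λ ¬p → ¬p (m≤m+n J i))) (*-zeroʳ ((K * K) ^ (J + i)))) ⟩
    ∑ J (λ d → (K * K) ^ d * 𝟙 (¬? (J ≤? d))) + 0
      ≤⟨ ≤-trans (≤-reflexive (+-identityʳ _)) (∑-mono J λ d d<J → ≤-trans (*-monoʳ-≤ ((K * K) ^ d) (𝟙≤1 (¬? (J ≤? d))))
           (≤-trans (≤-reflexive (*-identityʳ ((K * K) ^ d))) (^-monoʳ-≤ (K * K) {{m*n≢0 K K {{K≢0}} {{K≢0}}}} (<⇒≤ d<J)))) ⟩
    ∑ J (λ _ → (K * K) ^ J)
      ≡⟨ ∑-const J ((K * K) ^ J) ⟩
    J * (K * K) ^ J ∎
    where
    open ≤-Reasoning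
    K≢0 : NonZero K
    K≢0 = >-nonZero (subst (0 <_) (sym K≡) (s≤s z≤n))

-- Injections between lists, and the Durfee square.

pigeonhole : ∀ {A C : Set} (R : A → C → Set) (xs : List A) (ys : List C) → Unique xs →
  (∀ {x} → x ∈ xs → ∃ λ y → y ∈ ys × R x y) → (∀ {x x′ y} → R x y → R x′ y → x ≡ x′) → length xs ≤ length ys
pigeonhole R []       ys u h inj = z≤n
pigeonhole R (x ∷ xs) ys (x∉ ∷ u) h inj with h (here refl)
... | y , y∈ys , Rxy with ∈-∃++ y∈ys
...   | as , bs , refl = ≤-trans (s≤s (pigeonhole R xs (as ++ bs) u h′ inj))
          (≤-reflexive (trans (cong suc (length-++ as)) (trans (sym (+-suc (length as) (length bs))) (sym (length-++ as)))))
  where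
  h′ : ∀ {x′} → x′ ∈ xs → ∃ λ y′ → y′ ∈ as ++ bs × R x′ y′
  h′ {x′} x′∈ with h (there x′∈)
  ... | y′ , y′∈ , Rx′y′ with ∈-++⁻ as y′∈
  ...   | inj₁ p           = y′ , ∈-++⁺ˡ p , Rx′y′
  ...   | inj₂ (there p)   = y′ , ∈-++⁺ʳ as p , Rx′y′
  ...   | inj₂ (here refl) = contradiction (inj Rxy Rx′y′) (All.lookup x∉ x′∈)

tops : ℕ → List ℕ → List ℕ
tops d []       = []
tops d (a ∷ as) = (d + sum (a ∷ as)) ∷ tops d as

-- This builds both the parts below the square and, with offset 0, a whole partition from its
-- multiplicities.
parts : ℕ → List ℕ → List ℕ
parts o []       = []
parts o (b ∷ bs) = parts (suc o) bs ++ replicate b (suc o)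

-- The partition with a Durfee square of side length c, rows i ≤ d of length d + ∑_{j ≥ i} a_j,
-- and b_j further parts equal to j.
durfee : Cfg → List ℕ
durfee c = tops (length c) (map proj₁ c) ++ parts 0 (map proj₂ c)

Sorted : List ℕ → Set
Sorted = Linked _≥_

length-tops : ∀ d as → length (tops d as) ≡ length as
length-tops d []       = refl
length-tops d (a ∷ as) = cong suc (length-tops d as)

tops-≥ : ∀ d as → All (d ≤_) (tops d as)
tops-≥ d []       = []
tops-≥ d (a ∷ as) = m≤m+n d _ ∷ tops-≥ d as

tops-sorted : ∀ d as → Sorted (tops d as)
tops-sorted d []            = []
tops-sorted d (a ∷ [])      = [-]
tops-sorted d (a ∷ a′ ∷ as) = +-monoʳ-≤ d (m≤n+m _ a) ∷ tops-sorted d (a′ ∷ as)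

all-replicate : ∀ {P : ℕ → Set} n {x} → P x → All P (replicate n x)
all-replicate zero    p = []
all-replicate (suc n) p = p ∷ all-replicate n p

all-++ : ∀ {P : ℕ → Set} {xs ys} → All P xs → All P ys → All P (xs ++ ys)
all-++ []       q = q
all-++ (p ∷ ps) q = p ∷ all-++ ps q

all-++ˡ : ∀ {P : ℕ → Set} xs {ys} → All P (xs ++ ys) → All P xs
all-++ˡ []       _       = []
all-++ˡ (x ∷ xs) (p ∷ h) = p ∷ all-++ˡ xs h

all-++ʳ : ∀ {P : ℕ → Set} xs {ys} → All P (xs ++ ys) → All P ys
all-++ʳ []       h       = h
all-++ʳ (x ∷ xs) (p ∷ h) = all-++ʳ xs h

sorted-++ : ∀ {xs ys} x → Sorted xs → Sorted ys → All (x ≤_) xs → All (_≤ x) ys → Sorted (xs ++ ys)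
sorted-++ x []      s′ _        _        = s′
sorted-++ {ys = []}     x [-] s′ (p ∷ []) _ = [-]
sorted-++ {ys = z ∷ zs} x [-] s′ (p ∷ []) (q ∷ _) = ≤-trans q p ∷ s′
sorted-++ x (r ∷ s) s′ (p ∷ ps) qs       = r ∷ sorted-++ x s s′ ps qs

sorted-tail : ∀ {x xs} → Sorted (x ∷ xs) → Sorted xs
sorted-tail [-]     = []
sorted-tail (_ ∷ s) = s

sorted-head : ∀ {x xs} → Sorted (x ∷ xs) → All (_≤ x) xs
sorted-head [-]     = []
sorted-head (p ∷ s) = p ∷ All.map (λ q → ≤-trans q p) (sorted-head s)

sorted-cons : ∀ {x xs} → All (_≤ x) xs → Sorted xs → Sorted (x ∷ xs)
sorted-cons {xs = []}    _       _ = [-]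
sorted-cons {xs = _ ∷ _} (p ∷ _) s = p ∷ s

sorted-replicate : ∀ n x → Sorted (replicate n x)
sorted-replicate zero          x = []
sorted-replicate (suc zero)    x = [-]
sorted-replicate (suc (suc n)) x = ≤-refl ∷ sorted-replicate (suc n) x

sorted-prefix : ∀ xs {ys} → Sorted (xs ++ ys) → Sorted xs
sorted-prefix []       s = []
sorted-prefix (x ∷ xs) s = sorted-cons (all-++ˡ xs (sorted-head s)) (sorted-prefix xs (sorted-tail s))

sorted-suffix : ∀ xs {ys} → Sorted (xs ++ ys) → Sorted ys
sorted-suffix []       s = s
sorted-suffix (x ∷ xs) s = sorted-suffix xs (sorted-tail s)

parts-> : ∀ o bs → All (o <_) (parts o bs)
parts-> o []       = []
parts-> o (b ∷ bs) = all-++ (All.map <⇒≤ (parts-> (suc o) bs)) (all-replicate b ≤-refl)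

parts-≤ : ∀ o bs → All (_≤ o + length bs) (parts o bs)
parts-≤ o []       = []
parts-≤ o (b ∷ bs) = all-++ (All.map (λ p → ≤-trans p (≤-reflexive (sym (+-suc o (length bs))))) (parts-≤ (suc o) bs))
  (all-replicate b (≤-trans (s≤s (m≤m+n o (length bs))) (≤-reflexive (sym (+-suc o (length bs))))))

parts-sorted : ∀ o bs → Sorted (parts o bs)
parts-sorted o []       = []
parts-sorted o (b ∷ bs) = sorted-++ (suc o) (parts-sorted (suc o) bs) (sorted-replicate b (suc o))
  (All.map <⇒≤ (parts-> (suc o) bs)) (all-replicate b ≤-refl)

wsum : (ℕ → ℕ) → ℕ → List ℕ → ℕ
wsum g o []       = 0
wsum g o (b ∷ bs) = g (suc o) * b + wsum g (suc o) bs

sum-replicate : ∀ (g : ℕ → ℕ) n x → sum (map g (replicate n x)) ≡ g x * n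
sum-replicate g zero    x = sym (*-zeroʳ (g x))
sum-replicate g (suc n) x = trans (cong (g x +_) (sum-replicate g n x)) (sym (*-suc (g x) n))

map-++′ : ∀ (g : ℕ → ℕ) xs ys → sum (map g (xs ++ ys)) ≡ sum (map g xs) + sum (map g ys)
map-++′ g []       ys = refl
map-++′ g (x ∷ xs) ys = trans (cong (g x +_) (map-++′ g xs ys)) (sym (+-assoc (g x) _ _))

sum-parts : ∀ g o bs → sum (map g (parts o bs)) ≡ wsum g o bs
sum-parts g o []       = refl
sum-parts g o (b ∷ bs) = trans (map-++′ g (parts (suc o) bs) (replicate b (suc o)))
  (trans (cong₂ _+_ (sum-parts g (suc o) bs) (sum-replicate g b (suc o))) (+-comm (wsum g (suc o) bs) _))

map-id′ : ∀ (xs : List ℕ) → map (λ x → x) xs ≡ xs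
map-id′ []       = refl
map-id′ (x ∷ xs) = cong (x ∷_) (map-id′ xs)

sum-parts-id : ∀ o bs → sum (parts o bs) ≡ wsum (λ j → j) o bs
sum-parts-id o bs = trans (cong sum (sym (map-id′ (parts o bs)))) (sum-parts (λ j → j) o bs)

wsum-suc : ∀ o as → wsum (λ j → j) (suc o) as ≡ sum as + wsum (λ j → j) o as
wsum-suc o []       = refl
wsum-suc o (a ∷ as) = trans (cong (suc (suc o) * a +_) (wsum-suc (suc o) as)) (e o a (sum as) (wsum (λ j → j) (suc o) as))
  where
  e : ∀ o a s r → suc (suc o) * a + (s + r) ≡ a + s + (suc o * a + r)
  e = solve-∀

sum-tops : ∀ d as → sum (tops d as) ≡ d * length as + wsum (λ j → j) 0 as
sum-tops d []       = sym (trans (+-identityʳ _) (*-zeroʳ d))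
sum-tops d (a ∷ as) = trans (cong (d + (a + sum as) +_) (sum-tops d as))
  (trans (e d a (sum as) (length as) (wsum (λ j → j) 0 as)) (cong (λ z → d * suc (length as) + (1 * a + z)) (sym (wsum-suc 0 as))))
  where
  e : ∀ d a s l r → d + (a + s) + (d * l + r) ≡ d * suc l + (1 * a + (s + r))
  e = solve-∀

weight-wsum : ∀ o (c : Cfg) → weight o c ≡ wsum (λ j → j) o (map proj₁ c) + wsum (λ j → j) o (map proj₂ c)
weight-wsum o []            = refl
weight-wsum o ((a , b) ∷ c) = trans (cong (suc o * (a + b) +_) (weight-wsum (suc o) c)) (e (suc o) a b _ _)
  where
  e : ∀ o a b x y → o * (a + b) + (x + y) ≡ o * a + x + (o * b + y)
  e = solve-∀

sum-durfee : ∀ (c : Cfg) → sum (durfee c) ≡ size c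
sum-durfee c = begin
  sum (tops (length c) (map proj₁ c) ++ parts 0 (map proj₂ c))
    ≡⟨ sum-++ (tops (length c) (map proj₁ c)) _ ⟩
  sum (tops (length c) (map proj₁ c)) + sum (parts 0 (map proj₂ c))
    ≡⟨ cong₂ _+_ (trans (sum-tops (length c) (map proj₁ c)) (cong (λ l → length c * l + wsum (λ j → j) 0 (map proj₁ c)) (length-map proj₁ c)))
         (sum-parts-id 0 (map proj₂ c)) ⟩
  length c * length c + wsum (λ j → j) 0 (map proj₁ c) + wsum (λ j → j) 0 (map proj₂ c)
    ≡⟨ trans (+-assoc (length c * length c) _ _) (cong (length c * length c +_) (sym (weight-wsum 0 c))) ⟩
  size c ∎
  where open ≡-Reasoning

durfee-low : ∀ (c : Cfg) → All (_≤ length c) (parts 0 (map proj₂ c))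
durfee-low c = subst (λ l → All (_≤ l) (parts 0 (map proj₂ c))) (length-map proj₂ c) (parts-≤ 0 (map proj₂ c))

durfee-sorted : ∀ (c : Cfg) → Sorted (durfee c)
durfee-sorted c = sorted-++ (length c) (tops-sorted (length c) (map proj₁ c)) (parts-sorted 0 (map proj₂ c))
  (tops-≥ (length c) (map proj₁ c)) (durfee-low c)

durfee-positive : ∀ (c : Cfg) → All (0 <_) (durfee c)
durfee-positive []      = []
durfee-positive (p ∷ c) = all-++ (All.map (≤-trans (s≤s z≤n)) (tops-≥ (length (p ∷ c)) (map proj₁ (p ∷ c)))) (parts-> 0 (map proj₂ (p ∷ c)))

-- Uniqueness of the Durfee decomposition

straddle : ∀ (xs ys xs′ ys′ : List ℕ) → xs ++ ys ≡ xs′ ++ ys′ → length xs < length xs′ → ∃ λ z → z ∈ xs′ × z ∈ ys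
straddle []       ys (x′ ∷ xs′) ys′ e _ = x′ , here refl , subst (x′ ∈_) (sym e) (here refl)
straddle (x ∷ xs) ys (x′ ∷ xs′) ys′ e (s≤s p) =
  let (z , q , r) = straddle xs ys xs′ ys′ (proj₂ (∷-injective e)) p in z , there q , r

++-split : ∀ (xs ys xs′ ys′ : List ℕ) → xs ++ ys ≡ xs′ ++ ys′ → length xs ≡ length xs′ → xs ≡ xs′ × ys ≡ ys′
++-split []       ys []         ys′ e _ = refl , e
++-split (x ∷ xs) ys (x′ ∷ xs′) ys′ e l =
  let (p , q) = ++-split xs ys xs′ ys′ (proj₂ (∷-injective e)) (suc-injective l) in cong₂ _∷_ (proj₁ (∷-injective e)) p , q

parts-injective : ∀ o bs bs′ → length bs ≡ length bs′ → parts o bs ≡ parts o bs′ → bs ≡ bs′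
parts-injective o []       []         _ _ = refl
parts-injective o (b ∷ bs) (b′ ∷ bs′) l e with <-cmp (length (parts (suc o) bs)) (length (parts (suc o) bs′))
... | tri< p _ _ = let (z , q , r) = straddle (parts (suc o) bs) (replicate b (suc o)) (parts (suc o) bs′) (replicate b′ (suc o)) e p in
        contradiction (All.lookup (parts-> (suc o) bs′) q) (≤⇒≯ (All.lookup (all-replicate {λ y → y ≤ suc o} b ≤-refl) r))
... | tri> _ _ p = let (z , q , r) = straddle (parts (suc o) bs′) (replicate b′ (suc o)) (parts (suc o) bs) (replicate b (suc o)) (sym e) p in
        contradiction (All.lookup (parts-> (suc o) bs) q) (≤⇒≯ (All.lookup (all-replicate {λ y → y ≤ suc o} b′ ≤-refl) r))
... | tri≈ _ p _ = let (q , r) = ++-split (parts (suc o) bs) (replicate b (suc o)) (parts (suc o) bs′) (replicate b′ (suc o)) e p in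
        cong₂ _∷_ (trans (sym (length-replicate b)) (trans (cong length r) (length-replicate b′))) (parts-injective (suc o) bs bs′ (suc-injective l) q)

tops-injective : ∀ d as as′ → tops d as ≡ tops d as′ → as ≡ as′
tops-injective d []       []         _ = refl
tops-injective d (a ∷ as) (a′ ∷ as′) e with tops-injective d as as′ (proj₂ (∷-injective e))
... | refl = cong (_∷ as) (+-cancelʳ-≡ (sum as) a a′ (+-cancelˡ-≡ d _ _ (proj₁ (∷-injective e))))

pairs-≡ : ∀ (c c′ : Cfg) → map proj₁ c ≡ map proj₁ c′ → map proj₂ c ≡ map proj₂ c′ → c ≡ c′
pairs-≡ []      []        _ _ = refl
pairs-≡ (p ∷ c) (p′ ∷ c′) e f =
  cong₂ _∷_ (cong₂ _,_ (proj₁ (∷-injective e)) (proj₁ (∷-injective f))) (pairs-≡ c c′ (proj₂ (∷-injective e)) (proj₂ (∷-injective f)))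

-- If the sides differed, `straddle` would give a part z that is a row of the larger square and lies
-- below the smaller one: length c′ ≤ z ≤ length c.
durfee-side : ∀ (c c′ : Cfg) → durfee c ≡ durfee c′ → ¬ (length c < length c′)
durfee-side c c′ e p =
  let (z , q , r) = straddle (tops (length c) (map proj₁ c)) (parts 0 (map proj₂ c)) (tops (length c′) (map proj₁ c′)) (parts 0 (map proj₂ c′)) e
                      (subst₂ _<_ (sym (len c)) (sym (len c′)) p)
  in <⇒≱ p (≤-trans (All.lookup (tops-≥ (length c′) (map proj₁ c′)) q) (All.lookup (durfee-low c) r))
  where
  len : ∀ (c : Cfg) → length (tops (length c) (map proj₁ c)) ≡ length c
  len c = trans (length-tops (length c) (map proj₁ c)) (length-map proj₁ c)

durfee-injective : ∀ (c c′ : Cfg) → durfee c ≡ durfee c′ → c ≡ c′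
durfee-injective c c′ e = pairs-≡ c c′ (tops-injective (length c) _ _ (trans (proj₁ split) (cong (λ l → tops l (map proj₁ c′)) (sym l≡))))
    (parts-injective 0 _ _ (trans (length-map proj₂ c) (trans l≡ (sym (length-map proj₂ c′)))) (proj₂ split))
  where
  l≡ : length c ≡ length c′
  l≡ = ≤-antisym (≮⇒≥ (durfee-side c′ c (sym e))) (≮⇒≥ (durfee-side c c′ e))
  split = ++-split (tops (length c) (map proj₁ c)) (parts 0 (map proj₂ c)) (tops (length c′) (map proj₁ c′)) (parts 0 (map proj₂ c′)) e
    (trans (trans (length-tops (length c) (map proj₁ c)) (length-map proj₁ c)) (trans l≡ (sym (trans (length-tops (length c′) (map proj₁ c′)) (length-map proj₁ c′)))))

-- Existence of the Durfee decomposition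

split-min : ∀ o xs → Sorted xs → All (o <_) xs →
  ∃ λ ys → ∃ λ b → xs ≡ ys ++ replicate b (suc o) × Sorted ys × All (suc o <_) ys
split-min o []       s _        = [] , 0 , refl , [] , []
split-min o (x ∷ xs) s (p ∷ ps) with split-min o xs (sorted-tail s) ps | suc o <? x
... | ys , b , refl , s′ , h | yes q = x ∷ ys , b , refl , sorted-cons (all-++ˡ ys (sorted-head s)) s′ , q ∷ h
... | [] , b , refl , s′ , h | no ¬q = [] , suc b , cong (_∷ replicate b (suc o)) (≤-antisym (≮⇒≥ ¬q) p) , [] , []
... | y ∷ ys , b , refl , s′ , (h ∷ _) | no ¬q =
      contradiction (<-≤-trans h (≤-trans (All.lookup (sorted-head s) (here refl)) (≮⇒≥ ¬q))) (<-irrefl refl)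

parts-surjective : ∀ n o xs → Sorted xs → All (o <_) xs → All (_≤ o + n) xs → ∃ λ bs → length bs ≡ n × parts o bs ≡ xs
parts-surjective zero o []       _ _       _       = [] , refl , refl
parts-surjective zero o (x ∷ xs) _ (p ∷ _) (q ∷ _) = contradiction (≤-trans q (≤-reflexive (+-identityʳ o))) (<⇒≱ p)
parts-surjective (suc n) o xs s p q with split-min o xs s p
... | ys , b , refl , s′ , h with parts-surjective n (suc o) ys s′ h (All.map (λ r → ≤-trans r (≤-reflexive (+-suc o n))) (all-++ˡ ys q))
...   | bs , e , f = b ∷ bs , cong suc e , cong (_++ replicate b (suc o)) f

tops-surjective : ∀ d xs → Sorted xs → All (d ≤_) xs → ∃ λ as → length as ≡ length xs × tops d as ≡ xs
tops-surjective d []           _ _        = [] , refl , refl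
tops-surjective d (x ∷ [])     _ (p ∷ []) = (x ∸ d) ∷ [] , refl , cong (_∷ []) (trans (cong (d +_) (+-identityʳ (x ∸ d))) (m+[n∸m]≡n p))
tops-surjective d (x ∷ y ∷ xs) (x≥y ∷ s) (_ ∷ ps) with tops-surjective d (y ∷ xs) s ps
... | a ∷ as , e , f = (x ∸ y) ∷ a ∷ as , cong suc e , cong₂ _∷_ (trans (r d (x ∸ y) (sum (a ∷ as)))
        (trans (cong ((x ∸ y) +_) (proj₁ (∷-injective f))) (m∸n+n≡m x≥y))) f
  where
  r : ∀ d z s → d + (z + s) ≡ z + (d + s)
  r = solve-∀

-- Here k rows have been taken already, and the next row joins the square exactly if it is longer
-- than k. So k + length μ is the side of the finished square.
durfee-split : ∀ k xs → Sorted xs → ∃ λ μ → ∃ λ ν → xs ≡ μ ++ ν × All (k + length μ ≤_) μ × All (_≤ k + length μ) ν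
durfee-split k []       s = [] , [] , refl , [] , []
durfee-split k (x ∷ xs) s with x ≤? k
... | yes p = [] , x ∷ xs , refl , [] , All.map (λ q → ≤-trans q (≤-trans p (m≤m+n k 0))) (≤-refl ∷ sorted-head s)
... | no ¬p with durfee-split (suc k) xs (sorted-tail s)
...   | μ , ν , refl , h , h′ = x ∷ μ , ν , refl
        , subst (λ z → All (z ≤_) (x ∷ μ)) (sym (+-suc k (length μ))) (first μ h (all-++ˡ μ (sorted-head s)) ∷ h)
        , subst (λ z → All (_≤ z) ν) (sym (+-suc k (length μ))) h′
  where
  first : ∀ μ → All (suc k + length μ ≤_) μ → All (_≤ x) μ → suc k + length μ ≤ x
  first []      _       _       = subst (_< x) (sym (+-identityʳ k)) (≰⇒> ¬p)
  first (y ∷ μ) (q ∷ _) (r ∷ _) = ≤-trans q r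

zipPairs : List ℕ → List ℕ → Cfg
zipPairs (a ∷ as) (b ∷ bs) = (a , b) ∷ zipPairs as bs
zipPairs _        _        = []

zip-proj : ∀ as bs → length as ≡ length bs → map proj₁ (zipPairs as bs) ≡ as × map proj₂ (zipPairs as bs) ≡ bs
zip-proj []       []       _ = refl , refl
zip-proj (a ∷ as) (b ∷ bs) l = let (p , q) = zip-proj as bs (suc-injective l) in cong (a ∷_) p , cong (b ∷_) q

durfee-surjective : ∀ xs → Sorted xs → All (0 <_) xs → ∃ λ c → durfee c ≡ xs
durfee-surjective xs s pos with durfee-split 0 xs s
... | μ , ν , refl , h , h′ with tops-surjective (length μ) μ (sorted-prefix μ s) h
                               | parts-surjective (length μ) 0 ν (sorted-suffix μ s) (all-++ʳ μ pos) h′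
...   | as , la , fa | bs , lb , fb = zipPairs as bs , cong₂ _++_ (trans (cong₂ tops len (proj₁ z)) fa) (trans (cong (parts 0) (proj₂ z)) fb)
  where
  z = zip-proj as bs (trans la (sym lb))
  len : length (zipPairs as bs) ≡ length μ
  len = trans (sym (length-map proj₁ (zipPairs as bs))) (trans (cong length (proj₁ z)) la)

-- The Erdős-Gallai inequality.

ext : ∀ n → (Fin n → ℕ) → ℕ → ℕ
ext zero    f i       = 0
ext (suc n) f zero    = f Fin.zero
ext (suc n) f (suc i) = ext n (λ x → f (Fin.suc x)) i

ext-fromℕ< : ∀ n f i (p : i < n) → ext n f i ≡ f (Fin.fromℕ< p)
ext-fromℕ< (suc n) f zero    p       = refl
ext-fromℕ< (suc n) f (suc i) (s≤s p) = ext-fromℕ< n (λ x → f (Fin.suc x)) i p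

sum-allFin : ∀ n (f : Fin n → ℕ) → sum (map f (allFin n)) ≡ ∑ n (ext n f)
sum-allFin n f = trans (cong sum (map-tabulate id f)) (go n f)
  where
  go : ∀ n (f : Fin n → ℕ) → sum (tabulate f) ≡ ∑ n (ext n f)
  go zero    f = refl
  go (suc n) f = cong (f Fin.zero +_) (go n (λ x → f (Fin.suc x)))

at : ℕ → List ℕ → ℕ
at i       []       = 0
at zero    (x ∷ xs) = x
at (suc i) (x ∷ xs) = at i xs

lookup-at : ∀ xs i (p : i < length xs) → lookup xs (Fin.fromℕ< p) ≡ at i xs
lookup-at (x ∷ xs) zero    p       = refl
lookup-at (x ∷ xs) (suc i) (s≤s p) = lookup-at xs i p

∑-at : ∀ g xs → ∑ (length xs) (λ i → g (at i xs)) ≡ sum (map g xs)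
∑-at g []       = refl
∑-at g (x ∷ xs) = cong (g x +_) (∑-at g xs)

at-++ˡ : ∀ xs ys i → i < length xs → at i (xs ++ ys) ≡ at i xs
at-++ˡ (x ∷ xs) ys zero    _       = refl
at-++ˡ (x ∷ xs) ys (suc i) (s≤s p) = at-++ˡ xs ys i p

at-++ʳ : ∀ xs ys i → at (length xs + i) (xs ++ ys) ≡ at i ys
at-++ʳ []       ys i = refl
at-++ʳ (x ∷ xs) ys i = at-++ʳ xs ys i

missing-one : ∀ n g i → i < n → g i ≡ 0 → (∀ j → g j ≤ 1) → suc (∑ n g) ≤ n
missing-one (suc n) g zero    _       e h = s≤s (≤-trans (≤-reflexive (cong (_+ ∑ n (g ∘ suc)) e))
  (≤-trans (∑-mono n λ j _ → h (suc j)) (≤-reflexive (trans (∑-const n 1) (*-identityʳ n)))))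
missing-one (suc n) g (suc i) (s≤s p) e h = ≤-trans (≤-reflexive (sym (+-suc (g 0) _))) (+-mono-≤ (h 0) (missing-one n (g ∘ suc) i p e (h ∘ suc)))

-- Double counting of the adjacencies of the first k = length μ vertices: without loops each has at
-- most k - 1 neighbours among them, and a later vertex accounts for at most its degree and at most
-- k.
erdős-gallai : ∀ μ ν → Graphical (μ ++ ν) →
  sum μ + length μ ≤ length μ * length μ + sum (map (_⊓ length μ) ν)
erdős-gallai μ ν (Gr , deg) = begin
  sum μ + k
    ≡⟨ cong₂ _+_ (trans (cong sum (sym (map-id′ μ))) (sym (∑-at (λ x → x) μ))) (sym (trans (∑-const k 1) (*-identityʳ k))) ⟩
  ∑ k (λ i → at i μ) + ∑ k (λ _ → 1)
    ≡⟨ sym (∑-+ k (λ i → at i μ) (λ _ → 1)) ⟩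
  ∑ k (λ i → at i μ + 1)
    ≤⟨ ∑-mono k row ⟩
  ∑ k (λ i → k + ∑ r (λ j → E i (k + j)))
    ≡⟨ trans (∑-+ k (λ _ → k) _) (cong₂ _+_ (∑-const k k) (∑-swap k r (λ i j → E i (k + j)))) ⟩
  k * k + ∑ r (λ j → ∑ k (λ i → E i (k + j)))
    ≤⟨ +-monoʳ-≤ (k * k) (∑-mono r column) ⟩
  k * k + ∑ r (λ j → at j ν ⊓ k)
    ≡⟨ cong (k * k +_) (∑-at (_⊓ k) ν) ⟩
  k * k + sum (map (_⊓ k) ν) ∎
  where
  open ≤-Reasoning
  k = length μ
  r = length ν
  n = length (μ ++ ν)
  n≡ : n ≡ k + r
  n≡ = length-++ μ
  e : Fin n → Fin n → ℕ
  e i j = if SimpleGraph.adj Gr i j then 1 else 0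
  E : ℕ → ℕ → ℕ
  E i j = ext n (λ x → ext n (e x) j) i
  E≡ : ∀ i j (p : i < n) (q : j < n) → E i j ≡ e (Fin.fromℕ< p) (Fin.fromℕ< q)
  E≡ i j p q = trans (ext-fromℕ< n _ i p) (ext-fromℕ< n _ j q)
  bit : ∀ b → (if b then 1 else 0) ≤ 1
  bit true  = ≤-refl
  bit false = z≤n
  ext≤1 : ∀ n f → (∀ x → f x ≤ 1) → ∀ i → ext n f i ≤ 1
  ext≤1 zero    f h i       = z≤n
  ext≤1 (suc n) f h zero    = h Fin.zero
  ext≤1 (suc n) f h (suc i) = ext≤1 n (λ x → f (Fin.suc x)) (λ x → h (Fin.suc x)) i
  E≤1 : ∀ i j → E i j ≤ 1
  E≤1 i j = ext≤1 n _ (λ x → ext≤1 n (e x) (λ y → bit (SimpleGraph.adj Gr x y)) j) i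
  E-sym : ∀ i j → i < n → j < n → E i j ≡ E j i
  E-sym i j p q = trans (E≡ i j p q) (trans (cong (if_then 1 else 0) (SimpleGraph.symm Gr _ _)) (sym (E≡ j i q p)))
  E-irrefl : ∀ i → i < n → E i i ≡ 0
  E-irrefl i p = trans (E≡ i i p p) (cong (if_then 1 else 0) (SimpleGraph.irrefl Gr _))
  degree≡ : ∀ i → i < n → ∑ n (E i) ≡ at i (μ ++ ν)
  degree≡ i p = trans (∑-cong n λ j _ → ext-fromℕ< n _ i p) (trans (sym (sum-allFin n (e (Fin.fromℕ< p))))
    (trans (deg (Fin.fromℕ< p)) (lookup-at (μ ++ ν) i p)))
  k≤n : k ≤ n
  k≤n = ≤-trans (m≤m+n k r) (≤-reflexive (sym n≡))
  row : ∀ i → i < k → at i μ + 1 ≤ k + ∑ r (λ j → E i (k + j))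
  row i i<k = begin
    at i μ + 1                                         ≡⟨ +-comm (at i μ) 1 ⟩
    suc (at i μ)                                       ≡⟨ cong suc (sym (trans (degree≡ i (≤-trans i<k k≤n)) (at-++ˡ μ ν i i<k))) ⟩
    suc (∑ n (E i))                                    ≡⟨ cong suc (trans (cong (λ z → ∑ z (E i)) n≡) (∑-split k r (E i))) ⟩
    suc (∑ k (E i)) + ∑ r (λ j → E i (k + j))          ≤⟨ +-monoˡ-≤ _ (missing-one k (E i) i i<k (E-irrefl i (≤-trans i<k k≤n)) (E≤1 i)) ⟩
    k + ∑ r (λ j → E i (k + j))                        ∎
  column : ∀ j → j < r → ∑ k (λ i → E i (k + j)) ≤ at j ν ⊓ k
  column j j<r = ⊓-glb
    (begin
      ∑ k (λ i → E i (k + j))      ≡⟨ (∑-cong k λ i i<k → E-sym i (k + j) (≤-trans i<k k≤n) kj<n) ⟩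
      ∑ k (E (k + j))              ≤⟨ ∑-len (E (k + j)) k≤n ⟩
      ∑ n (E (k + j))              ≡⟨ trans (degree≡ (k + j) kj<n) (at-++ʳ μ ν j) ⟩
      at j ν                       ∎)
    (≤-trans (∑-mono k λ i _ → E≤1 i (k + j)) (≤-reflexive (trans (∑-const k 1) (*-identityʳ k))))
    where
    kj<n : k + j < n
    kj<n = subst (k + j <_) (sym n≡) (+-monoʳ-< k j<r)

wsum-⊓0 : ∀ o as → wsum (_⊓ 0) o as ≡ 0
wsum-⊓0 o []       = refl
wsum-⊓0 o (a ∷ as) = wsum-⊓0 (suc o) as

wsum-⊓suc : ∀ k o as → wsum (_⊓ suc k) (suc o) as ≡ sum as + wsum (_⊓ k) o as
wsum-⊓suc k o []       = refl
wsum-⊓suc k o (a ∷ as) = trans (cong (suc (suc o ⊓ k) * a +_) (wsum-⊓suc k (suc o) as)) (e (suc o ⊓ k) a (sum as) (wsum (_⊓ k) (suc o) as))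
  where
  e : ∀ m a s r → suc m * a + (s + r) ≡ a + s + (m * a + r)
  e = solve-∀

-- A column of length j to the right of the square meets the first k rows in min(j , k) cells.
sum-take-tops : ∀ k d as → k ≤ length as → sum (take k (tops d as)) ≡ k * d + wsum (_⊓ k) 0 as
sum-take-tops zero    d as       _       = sym (wsum-⊓0 0 as)
sum-take-tops (suc k) d (a ∷ as) (s≤s p) = trans (cong (d + (a + sum as) +_) (sum-take-tops k d as p))
  (trans (e d a (sum as) (k * d) (wsum (_⊓ k) 0 as)) (cong (λ z → d + k * d + (a + 0 + z)) (sym (wsum-⊓suc k 0 as))))
  where
  e : ∀ d a s x r → d + (a + s) + (x + r) ≡ d + x + (a + 0 + (s + r))
  e = solve-∀

sum-⊓≤ : ∀ k xs → sum (map (_⊓ k) xs) ≤ length xs * k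
sum-⊓≤ k []       = z≤n
sum-⊓≤ k (x ∷ xs) = +-mono-≤ (m⊓n≤n x k) (sum-⊓≤ k xs)

linear-diffs : ∀ g o c → linear g o (diffs c) ≡ ℤ.+ wsum g o (map proj₂ c) ℤ.- ℤ.+ wsum g o (map proj₁ c)
linear-diffs g o []            = refl
linear-diffs g o ((a , b) ∷ c) = begin
  ℤ.+ κ ℤ.* (ℤ.+ b ℤ.- ℤ.+ a) ℤ.+ linear g (suc o) (diffs c)
    ≡⟨ cong (ℤ._+_ (ℤ.+ κ ℤ.* (ℤ.+ b ℤ.- ℤ.+ a))) (linear-diffs g (suc o) c) ⟩
  ℤ.+ κ ℤ.* (ℤ.+ b ℤ.- ℤ.+ a) ℤ.+ (ℤ.+ y ℤ.- ℤ.+ x)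
    ≡⟨ e (ℤ.+ κ) (ℤ.+ a) (ℤ.+ b) (ℤ.+ x) (ℤ.+ y) ⟩
  (ℤ.+ κ ℤ.* ℤ.+ b ℤ.+ ℤ.+ y) ℤ.- (ℤ.+ κ ℤ.* ℤ.+ a ℤ.+ ℤ.+ x)
    ≡⟨ cong₂ ℤ._-_ (combine b y) (combine a x) ⟩
  ℤ.+ (κ * b + y) ℤ.- ℤ.+ (κ * a + x) ∎
  where
  open ≡-Reasoning
  κ = g (suc o)
  x = wsum g (suc o) (map proj₁ c)
  y = wsum g (suc o) (map proj₂ c)
  e : ∀ k a b x y → k ℤ.* (b ℤ.- a) ℤ.+ (y ℤ.- x) ≡ (k ℤ.* b ℤ.+ y) ℤ.- (k ℤ.* a ℤ.+ x)
  e = ℤSolver.solve-∀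
  combine : ∀ b y → ℤ.+ κ ℤ.* ℤ.+ b ℤ.+ ℤ.+ y ≡ ℤ.+ (κ * b + y)
  combine b y = trans (cong (ℤ._+ ℤ.+ y) (sym (ℤ.pos-* κ b))) (sym (ℤ.pos-+ (κ * b) y))

-- Erdős-Gallai for the k longest rows. Each of the other d - k rows of the square counts at most k,
-- so together with k² they give k d, which cancels the k d cells of the first rows inside the
-- square. What remains is ∑ min(j , k) (b_j - a_j) ≥ k ≥ 1.
graphical-test : ∀ (c : Cfg) k → 1 ≤ k → k ≤ length c → Graphical (durfee c) →
  ℤ.+ 1 ℤ.≤ linear (_⊓ k) 0 (diffs c)
graphical-test c k 1≤k k≤d gr = subst (ℤ.+ 1 ℤ.≤_)
    (sym (trans (linear-diffs (_⊓ k) 0 c) (trans (ℤ.m-n≡m⊖n β′ α′) (ℤ.⊖-≥ (<⇒≤ α<β)))))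
    (ℤ.+≤+ (m<n⇒0<n∸m α<β))
  where
  d = length c
  as = map proj₁ c
  bs = map proj₂ c
  α′ = wsum (_⊓ k) 0 as
  β′ = wsum (_⊓ k) 0 bs
  las : length as ≡ d
  las = length-map proj₁ c
  μ ν : List ℕ
  μ = take k (tops d as)
  ν = drop k (tops d as) ++ parts 0 bs
  ltops : length (tops d as) ≡ d
  ltops = trans (length-tops d as) las
  lμ : length μ ≡ k
  lμ = trans (length-take k (tops d as)) (trans (cong (k ⊓_) ltops) (m≤n⇒m⊓n≡m k≤d))
  μν : durfee c ≡ μ ++ ν
  μν = trans (cong (_++ parts 0 bs) (sym (take++drop≡id k (tops d as)))) (++-assoc μ (drop k (tops d as)) (parts 0 bs))
  eg : sum μ + k ≤ k * k + sum (map (_⊓ k) ν)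
  eg = subst (λ z → sum μ + z ≤ z * z + sum (map (_⊓ z) ν)) lμ (erdős-gallai μ ν (subst Graphical μν gr))
  ν≤ : sum (map (_⊓ k) ν) ≤ (d ∸ k) * k + β′
  ν≤ = ≤-trans (≤-reflexive (map-++′ (_⊓ k) (drop k (tops d as)) (parts 0 bs)))
    (+-mono-≤ (≤-trans (sum-⊓≤ k (drop k (tops d as))) (≤-reflexive (cong (_* k) (trans (length-drop k (tops d as)) (cong (_∸ k) ltops)))))
              (≤-reflexive (sum-parts (_⊓ k) 0 bs)))
  main : α′ + k ≤ β′
  main = +-cancelˡ-≤ (k * d) _ _ (begin
    k * d + (α′ + k)                     ≡⟨ sym (+-assoc (k * d) α′ k) ⟩
    k * d + α′ + k                       ≡⟨ cong (_+ k) (sym (sum-take-tops k d as (subst (k ≤_) (sym las) k≤d))) ⟩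
    sum μ + k                            ≤⟨ ≤-trans eg (+-monoʳ-≤ (k * k) ν≤) ⟩
    k * k + ((d ∸ k) * k + β′)           ≡⟨ trans (sym (+-assoc (k * k) ((d ∸ k) * k) β′)) (cong (_+ β′) (trans (sym (*-distribʳ-+ k k (d ∸ k)))
                                              (trans (cong (_* k) (m+[n∸m]≡n k≤d)) (*-comm d k)))) ⟩
    k * d + β′                           ∎)
    where open ≤-Reasoning
  α<β : α′ < β′
  α<β = ≤-trans (≤-trans (≤-reflexive (+-comm 1 α′)) (+-monoʳ-≤ α′ 1≤k)) main

-- From enumerations to sums over configurations.

sumL : {A : Set} → List A → (A → ℕ) → ℕ
sumL []       F = 0
sumL (x ∷ xs) F = F x + sumL xs F

sumL-++ : {A : Set} (xs ys : List A) (F : A → ℕ) → sumL (xs ++ ys) F ≡ sumL xs F + sumL ys F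
sumL-++ []       ys F = refl
sumL-++ (x ∷ xs) ys F = trans (cong (F x +_) (sumL-++ xs ys F)) (sym (+-assoc (F x) _ _))

sumL-map : {A C : Set} (g : A → C) (xs : List A) (F : C → ℕ) → sumL (map g xs) F ≡ sumL xs (F ∘ g)
sumL-map g []       F = refl
sumL-map g (x ∷ xs) F = cong (F (g x) +_) (sumL-map g xs F)

sumL-product : {A C E : Set} (g : A → C → E) (xs : List A) (ys : List C) (F : E → ℕ) →
  sumL (cartesianProductWith g xs ys) F ≡ sumL xs (λ x → sumL ys (λ y → F (g x y)))
sumL-product g []       ys F = refl
sumL-product g (x ∷ xs) ys F = trans (sumL-++ (map (g x) ys) _ F) (cong₂ _+_ (sumL-map (g x) ys F) (sumL-product g xs ys F))

sumL-upTo : ∀ n (F : ℕ → ℕ) → sumL (upTo n) F ≡ ∑ n F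
sumL-upTo n F = go n id
  where
  go : ∀ n (g : ℕ → ℕ) → sumL (applyUpTo g n) F ≡ ∑ n (F ∘ g)
  go zero    g = refl
  go (suc n) g = cong (F (g 0) +_) (go n (g ∘ suc))

length-filter-sumL : {A : Set} {P : A → Set} (P? : ∀ x → Dec (P x)) (xs : List A) →
  length (filter P? xs) ≡ sumL xs (λ x → 𝟙 (P? x))
length-filter-sumL P? []       = refl
length-filter-sumL P? (x ∷ xs) with P? x
... | yes _ = cong suc (length-filter-sumL P? xs)
... | no  _ = length-filter-sumL P? xs

Below : ℕ → Cfg → Set
Below K = All (λ p → proj₁ p < K × proj₂ p < K)

box : ℕ → ℕ → List Cfg
box K zero    = [] ∷ []
box K (suc d) = cartesianProductWith _∷_ (cartesianProductWith _,_ (upTo K) (upTo K)) (box K d)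

box-unique : ∀ K d → Unique (box K d)
box-unique K zero    = [] ∷ []
box-unique K (suc d) = Unique.cartesianProductWith⁺ _∷_ ∷-injective
  (Unique.cartesianProductWith⁺ _,_ (λ { refl → refl , refl }) (Unique.upTo⁺ K) (Unique.upTo⁺ K)) (box-unique K d)

∈-box : ∀ K c → Below K c → c ∈ box K (length c)
∈-box K []            []            = here refl
∈-box K ((a , b) ∷ c) ((p , q) ∷ h) = ∈-cartesianProductWith⁺ _∷_ (∈-cartesianProductWith⁺ _,_ (∈-upTo⁺ p) (∈-upTo⁺ q)) (∈-box K c h)

box-length : ∀ K d {c} → c ∈ box K d → length c ≡ d
box-length K zero    (here refl) = refl
box-length K (suc d) c∈ with ∈-cartesianProductWith⁻ _∷_ (cartesianProductWith _,_ (upTo K) (upTo K)) (box K d) c∈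
... | _ , _ , _ , c′∈ , refl = cong suc (box-length K d c′∈)

sumL-box : ∀ K d (F : Cfg → ℕ) → sumL (box K d) F ≡ sumP K d F
sumL-box K zero    F = +-identityʳ (F [])
sumL-box K (suc d) F = trans (sumL-product _∷_ (cartesianProductWith _,_ (upTo K) (upTo K)) (box K d) F) (trans (sumL-product _,_ (upTo K) (upTo K) _)
  (trans (sumL-upTo K _) (∑-cong K λ a _ → trans (sumL-upTo K _) (∑-cong K λ b _ → sumL-box K d (λ c → F ((a , b) ∷ c))))))

levels : ℕ → ℕ → List Cfg
levels K zero    = []
levels K (suc n) = box K n ++ levels K n

levels-length : ∀ K n {c} → c ∈ levels K n → length c < n
levels-length K (suc n) c∈ with ∈-++⁻ (box K n) c∈
... | inj₁ p = s≤s (≤-reflexive (box-length K n p))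
... | inj₂ p = m≤n⇒m≤1+n (levels-length K n p)

levels-unique : ∀ K n → Unique (levels K n)
levels-unique K zero    = []
levels-unique K (suc n) = Unique.++⁺ (box-unique K n) (levels-unique K n)
  λ (p , q) → <-irrefl (box-length K n p) (levels-length K n q)

∈-levels : ∀ K n c → Below K c → length c < n → c ∈ levels K n
∈-levels K (suc n) c h (s≤s p) with m≤n⇒m<n∨m≡n p
... | inj₁ q    = ∈-++⁺ʳ (box K n) (∈-levels K n c h q)
... | inj₂ refl = ∈-++⁺ˡ (∈-box K c h)

sumL-levels : ∀ K n (F : Cfg → ℕ) → sumL (levels K n) F ≡ ∑ n (λ d → sumP K d F)
sumL-levels K zero    F = refl
sumL-levels K (suc n) F = trans (sumL-++ (box K n) (levels K n) F) (trans (cong₂ _+_ (sumL-box K n F) (sumL-levels K n F))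
  (trans (+-comm (sumP K n F) _) (sym (∑-last n (λ d → sumP K d F)))))

below-weight : ∀ K o c → weight o c < K → Below K c
below-weight K o []            _ = []
below-weight K o ((a , b) ∷ c) h =
    (≤-<-trans (≤-trans (m≤m+n a b) (≤-trans (m≤n*m (a + b) (suc o)) (m≤m+n _ _))) h
    , ≤-<-trans (≤-trans (m≤n+m b a) (≤-trans (m≤n*m (a + b) (suc o)) (m≤m+n _ _))) h)
  ∷ below-weight K (suc o) c (≤-<-trans (m≤n+m _ _) h)

fromMults : List ℕ → Cfg
fromMults = map (λ a → a , 0)

fromMults-proj₁ : ∀ bs → map proj₁ (fromMults bs) ≡ bs
fromMults-proj₁ []       = refl
fromMults-proj₁ (b ∷ bs) = cong (b ∷_) (fromMults-proj₁ bs)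

fromMults-weight : ∀ o bs → weight o (fromMults bs) ≡ wsum (λ j → j) o bs
fromMults-weight o []       = refl
fromMults-weight o (b ∷ bs) = cong₂ (λ x y → suc o * x + y) (+-identityʳ b) (fromMults-weight (suc o) bs)

allB0-fromMults : ∀ bs → allB0 (fromMults bs) ≡ 1
allB0-fromMults []       = refl
allB0-fromMults (b ∷ bs) = allB0-fromMults bs

allB0-inverse : ∀ c → allB0 c ≡ 1 → fromMults (map proj₁ c) ≡ c
allB0-inverse []               _ = refl
allB0-inverse ((a , zero) ∷ c) e = cong ((a , 0) ∷_) (allB0-inverse c e)

allB0-𝟙 : ∀ c → allB0 c ≡ 𝟙 (allB0 c ℕ.≟ 1)
allB0-𝟙 []                = refl
allB0-𝟙 ((a , zero) ∷ c)  = allB0-𝟙 c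
allB0-𝟙 ((a , suc b) ∷ c) = refl

𝟙-×-dec : {P Q : Set} (p : Dec P) (q : Dec Q) → 𝟙 (p ×-dec q) ≡ 𝟙 p * 𝟙 q
𝟙-×-dec (yes _) (yes _) = refl
𝟙-×-dec (yes _) (no _)  = refl
𝟙-×-dec (no _)  q       = refl

parts≤sum : ∀ xs → All (_≤ sum xs) xs
parts≤sum []       = []
parts≤sum (x ∷ xs) = m≤m+n x (sum xs) ∷ All.map (λ p → ≤-trans p (m≤n+m (sum xs) x)) (parts≤sum xs)

module Counting (N₀ K : ℕ) (K≡ : K ≡ suc N₀) where

  open Partitions N₀ K K≡
  open Omega N₀ K K≡

  private
    plain? : ∀ y (c : Cfg) → Dec (allB0 c ≡ 1 × weight 0 c + y ≡ N₀)
    plain? y c = (allB0 c ℕ.≟ 1) ×-dec total? y c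

    plains : ℕ → List Cfg
    plains y = filter (plain? y) (box K N₀)

    length-plains : ∀ y → length (plains y) ≡ f y
    length-plains y = trans (length-filter-sumL (plain? y) (box K N₀)) (trans (sumL-box K N₀ _)
      (sumP-cong K N₀ λ c _ → trans (𝟙-×-dec (allB0 c ℕ.≟ 1) (total? y c)) (cong (_* 𝟙 (total? y c)) (sym (allB0-𝟙 c)))))

    <K : ∀ {x y} → x + y ≡ N₀ → x < K
    <K {x} {y} e = subst (x <_) (sym K≡) (s≤s (≤-trans (m≤m+n x y) (≤-reflexive e)))

  -- A Durfee configuration is sent to its partition, and this to the multiplicities of its parts, a
  -- list of length N₀; uniqueness of the Durfee decomposition makes the map injective. Inequalities
  -- suffice for the theorem, so this and the next two comparisons are each made in one direction.
  configurations≤partitions : ∀ y → ΣΩ (λ c → 𝟙 (exactly? y c)) ≤ f y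
  configurations≤partitions y = subst₂ _≤_
      (trans (length-filter-sumL (exactly? y) (levels K K)) (sumL-levels K K _)) (length-plains y)
      (pigeonhole R (filter (exactly? y) (levels K K)) (plains y) (Unique.filter⁺ (exactly? y) (levels-unique K K)) image
        (λ {c} {c′} p q → durfee-injective c c′ (trans p (sym q))))
    where
    R : Cfg → Cfg → Set
    R c p = durfee c ≡ parts 0 (map proj₁ p)
    image : ∀ {c} → c ∈ filter (exactly? y) (levels K K) → ∃ λ p → p ∈ plains y × R c p
    image {c} c∈ with ∈-filter⁻ (exactly? y) {xs = levels K K} c∈
    ... | _ , e with parts-surjective N₀ 0 (durfee c) (durfee-sorted c) (durfee-positive c)
                       (All.map (λ p → ≤-trans p (≤-trans (≤-reflexive (sum-durfee c)) (≤-trans (m≤m+n (size c) y) (≤-reflexive e)))) (parts≤sum (durfee c)))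
    ...   | bs , l , q = fromMults bs
          , ∈-filter⁺ (plain? y) (subst (λ d → fromMults bs ∈ box K d) (trans (length-map _ bs) l) (∈-box K (fromMults bs) (below-weight K 0 _ (<K tot))))
              (allB0-fromMults bs , tot)
          , trans (sym q) (cong (parts 0) (sym (fromMults-proj₁ bs)))
      where
      tot : weight 0 (fromMults bs) + y ≡ N₀
      tot = trans (cong (_+ y) (trans (fromMults-weight 0 bs) (trans (sym (sum-parts-id 0 bs)) (trans (cong sum q) (sum-durfee c))))) e

  partitions≤enumeration : ∀ y n → n + y ≡ N₀ → ∀ Lp → Enumerates (IsPartition n) Lp → f y ≤ length Lp
  partitions≤enumeration y n n+y Lp (_ , Lp⇔) = subst (_≤ length Lp) (length-plains y)
    (pigeonhole R (plains y) Lp (Unique.filter⁺ (plain? y) (box-unique K N₀)) image injective)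
    where
    R : Cfg → List ℕ → Set
    R p xs = length p ≡ N₀ × allB0 p ≡ 1 × parts 0 (map proj₁ p) ≡ xs
    image : ∀ {p} → p ∈ plains y → ∃ λ xs → xs ∈ Lp × R p xs
    image {p} p∈ with ∈-filter⁻ (plain? y) {xs = box K N₀} p∈
    ... | q , b0 , e = parts 0 (map proj₁ p)
          , Equivalence.from (Lp⇔ _) (parts-sorted 0 (map proj₁ p) , parts-> 0 (map proj₁ p)
            , trans (sum-parts-id 0 (map proj₁ p)) (trans (sym (trans (cong (weight 0) (sym (allB0-inverse p b0))) (fromMults-weight 0 (map proj₁ p))))
                (+-cancelʳ-≡ y _ _ (trans e (sym n+y)))))
          , box-length K N₀ q , b0 , refl
    injective : ∀ {p p′ xs} → R p xs → R p′ xs → p ≡ p′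
    injective {p} {p′} (l , b , e) (l′ , b′ , e′) = trans (sym (allB0-inverse p b)) (trans
      (cong fromMults (parts-injective 0 _ _ (trans (length-map proj₁ p) (trans l (trans (sym l′) (sym (length-map proj₁ p′))))) (trans e (sym e′))))
      (allB0-inverse p′ b′))

  -- This uses the existence of the Durfee decomposition. P is a necessary condition for being
  -- graphical, later `Passes`.
  graphical≤configurations : ∀ y n → n + y ≡ N₀ → ∀ Lg → Enumerates (λ x → IsPartition n x × Graphical x) Lg →
    {P : Cfg → Set} (P? : ∀ c → Dec (P c)) → (∀ c → Graphical (durfee c) → P c) →
    length Lg ≤ ΣΩ (λ c → 𝟙 (P? c) * 𝟙 (exactly? y c))
  graphical≤configurations y n n+y Lg (uniq , Lg⇔) {P} P? graph⇒P = ≤-trans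
      (pigeonhole (λ xs c → durfee c ≡ xs) Lg (filter Q? (levels K K)) uniq image (λ p q → trans (sym p) q))
      (≤-reflexive (trans (length-filter-sumL Q? (levels K K)) (trans (sumL-levels K K _)
        (ΣΩ-cong λ c → 𝟙-×-dec (P? c) (exactly? y c)))))
    where
    Q? : ∀ c → Dec (P c × size c + y ≡ N₀)
    Q? c = P? c ×-dec exactly? y c
    image : ∀ {xs} → xs ∈ Lg → ∃ λ c → c ∈ filter Q? (levels K K) × durfee c ≡ xs
    image {xs} xs∈ with Equivalence.to (Lg⇔ xs) xs∈
    ... | (sorted , pos , total) , gr with durfee-surjective xs sorted pos
    ...   | c , refl = c , ∈-filter⁺ Q? (∈-levels K K c (below-weight K 0 c (<K w≡)) (≤-<-trans (l≤ c) (<K ex))) (graph⇒P c gr , ex) , refl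
      where
      ex : size c + y ≡ N₀
      ex = trans (cong (_+ y) (trans (sym (sum-durfee c)) total)) n+y
      w≡ : weight 0 c + (length c * length c + y) ≡ N₀
      w≡ = trans (trans (sym (+-assoc (weight 0 c) _ y)) (cong (_+ y) (+-comm (weight 0 c) _))) ex
      l≤ : ∀ (c : Cfg) → length c ≤ size c
      l≤ []      = z≤n
      l≤ (p ∷ c) = ≤-trans (m≤m*n (suc (length c)) (suc (length c))) (m≤m+n _ _)

-- Choice of the scales and the constants.

all-or-some : ∀ n {p} {A : ℕ → Set p} (A? : ∀ i → Dec (A i)) →
              1 ≤ ∏ n (λ i → 𝟙 (A? i)) + ∑ n (λ i → 𝟙 (¬? (A? i)))
all-or-some zero    A? = ≤-refl
all-or-some (suc n) A? with A? 0
... | no  _ = s≤s z≤n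
... | yes _ = ≤-trans (all-or-some n (A? ∘ suc)) (+-monoˡ-≤ _ (≤-reflexive (sym (+-identityʳ (∏ n (λ i → 𝟙 (A? (suc i))))))))

square-cancel-< : ∀ {x y} → x * x < y * y → x < y
square-cancel-< {x} {y} h with x <? y
... | yes p = p
... | no ¬p = contradiction h (≤⇒≯ (*-square (≮⇒≥ ¬p)))

scaled-root : ∀ b → 1 ≤ b → ∀ n → ∃ λ z → b * z * (b * z) ≤ n × n < b * suc z * (b * suc z)
scaled-root b b≥1 zero    = 0 , ≤-reflexive (trans (cong (_* (b * 0)) (*-zeroʳ b)) refl) , *-mono-≤ b′ b′
  where
  b′ : 1 ≤ b * 1
  b′ = ≤-trans b≥1 (≤-reflexive (sym (*-identityʳ b)))
scaled-root b b≥1 (suc n) with scaled-root b b≥1 n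
... | z , lower , upper with b * suc z * (b * suc z) ≤? suc n
...   | no ¬p = z , m≤n⇒m≤1+n lower , ≰⇒> ¬p
...   | yes p = suc z , p , ≤-trans (s≤s upper) (*-mono-< bigger bigger)
  where
  bigger : b * suc z < b * suc (suc z)
  bigger = *-monoʳ-< b {{>-nonZero b≥1}} (n<1+n (suc z))

scaled-log : ∀ b → 2 ≤ b → ∀ n → 1 ≤ n → ∃ λ l → b ^ l ≤ n × n < b ^ suc l
scaled-log b b≥2 (suc zero)    _ = 0 , ≤-refl , ≤-trans b≥2 (≤-reflexive (sym (*-identityʳ b)))
scaled-log b b≥2 (suc (suc n)) _ with scaled-log b b≥2 (suc n) (s≤s z≤n)
... | l , lower , upper with b ^ suc l ≤? suc (suc n)
...   | no ¬p = l , m≤n⇒m≤1+n lower , ≰⇒> ¬p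
...   | yes p = suc l , p , ≤-trans (s≤s upper) (^-monoʳ-< b b≥2 (n<1+n (suc l)))

suc≤^ : ∀ b → 2 ≤ b → ∀ n → suc n ≤ b ^ n
suc≤^ b b≥2 zero    = ≤-refl
suc≤^ b b≥2 (suc n) = begin
  suc (suc n)       ≤⟨ s≤s (m≤n+m (suc n) n) ⟩
  suc n + suc n     ≡⟨ cong (suc n +_) (sym (+-identityʳ (suc n))) ⟩
  2 * suc n         ≤⟨ *-mono-≤ b≥2 (suc≤^ b b≥2 n) ⟩
  b * b ^ n         ∎
  where open ≤-Reasoning

sumP-zeros : ∀ K d (F : Cfg → ℕ) → 1 ≤ K → F (replicate d (0 , 0)) ≤ sumP K d F
sumP-zeros K zero    F _   = ≤-refl
sumP-zeros K (suc d) F K≥1 = ≤-trans (sumP-zeros K d (λ c → F ((0 , 0) ∷ c)) K≥1)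
  (≤-trans (∑-term K (λ b → sumP K d λ c → F ((0 , b) ∷ c)) K≥1)
           (∑-term K (λ a → ∑ K λ b → sumP K d λ c → F ((a , b) ∷ c)) K≥1))

zeros-weight : ∀ o d → weight o (replicate d (0 , 0)) ≡ 0
zeros-weight o zero    = refl
zeros-weight o (suc d) = cong₂ _+_ (*-zeroʳ (suc o)) (zeros-weight (suc o) d)

zeros-plain : ∀ d → allB0 (replicate d (0 , 0)) ≡ 1
zeros-plain zero    = refl
zeros-plain (suc d) = zeros-plain d

-- The constant is 2178000 = 132 · 16500. One factor m of m M pays for it, and the bound m l ≤ M
-- remains for z.
z-large : ∀ m l M z → m * M < 132 * suc z → m * l ≤ M → 2178000 ≤ m → m * l * 16500 ≤ z
z-large m l M z z-bound ml≤M m-large = by-cases (m * l * 16500 ≤? z)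
  where
  open ≤-Reasoning
  by-cases : Dec (m * l * 16500 ≤ z) → m * l * 16500 ≤ z
  by-cases (yes p) = p
  by-cases (no ¬p) = contradiction z-bound (≤⇒≯ (begin
    132 * suc z                ≡⟨ *-comm 132 (suc z) ⟩
    suc z * 132                ≤⟨ *-monoˡ-≤ 132 (≰⇒> ¬p) ⟩
    m * l * 16500 * 132        ≡⟨ *-assoc (m * l) 16500 132 ⟩
    m * l * 2178000            ≤⟨ *-monoʳ-≤ (m * l) m-large ⟩
    m * l * m                  ≡⟨ *-comm (m * l) m ⟩
    m * (m * l)                ≤⟨ *-monoʳ-≤ m ml≤M ⟩
    m * M                      ∎))

square-scale : ∀ c x → c * x * (c * x) ≡ x * x * (c * c)
square-scale = solve-∀

-- With 132 = 11 · 12 and 143 = 11 · 13, rounding costs a factor 13/12, as 12 (z + 1) ≤ 13 z. So w =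
-- kT z satisfies 132 w ≤ √n ≤ 143 w; the squares are 17424 and 20449.
root-upper : ∀ kT z n → 12 ≤ z → n < 132 * kT * suc z * (132 * kT * suc z) → n ≤ kT * z * (kT * z) * 20449
root-upper kT z n 12≤z n< = *-cancelʳ-≤ _ _ 144 (begin
  n * 144                                             ≤⟨ *-monoˡ-≤ 144 (<⇒≤ n<) ⟩
  132 * kT * suc z * (132 * kT * suc z) * (12 * 12)   ≡⟨ sym (square-scale 12 (132 * kT * suc z)) ⟩
  12 * (132 * kT * suc z) * (12 * (132 * kT * suc z)) ≤⟨ *-square (≤-trans (≤-reflexive (r kT (suc z))) (≤-trans (*-monoʳ-≤ 132 (*-monoʳ-≤ kT 12z)) (≤-reflexive (r′ kT z)))) ⟩
  12 * (143 * (kT * z)) * (12 * (143 * (kT * z)))     ≡⟨ square-scale 12 (143 * (kT * z)) ⟩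
  143 * (kT * z) * (143 * (kT * z)) * (12 * 12)       ≡⟨ cong (_* (12 * 12)) (square-scale 143 (kT * z)) ⟩
  kT * z * (kT * z) * 20449 * 144                     ∎)
  where
  open ≤-Reasoning
  12z : 12 * suc z ≤ 13 * z
  12z = ≤-trans (≤-reflexive (*-suc 12 z)) (+-monoˡ-≤ (12 * z) 12≤z)
  r : ∀ k z → 12 * (132 * k * z) ≡ 132 * (k * (12 * z))
  r = solve-∀
  r′ : ∀ k z → 132 * (k * (13 * z)) ≡ 12 * (143 * (k * z))
  r′ = solve-∀

root-lower : ∀ kT z n → 132 * kT * z * (132 * kT * z) ≤ n → kT * z * (kT * z) * 17424 ≤ n
root-lower kT z n h = ≤-trans (≤-reflexive (trans (sym (square-scale 132 (kT * z))) (cong (λ x → x * x) (sym (*-assoc 132 kT z))))) h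

-- m = 2⁵⁰; consecutive tests are a factor m² apart.
module Core
  (m m₂ c e : ℕ) (m≡ : m ≡ 2 * m₂) (16≤m₂ : 16 ≤ m₂) (cm≡4e : c * m ≡ 4 * e)
  (km≡ : m * 1 ≡ 4 * ((32 * c) * (32 * c))) (c≥1 : 1 ≤ c) (e≡ : e ≡ m * 131072) (m≥2 : 2 ≤ m)
  (l′ T n z w h y₀ N₀ K D : ℕ)
  (w≡ : m * (m ^ (l′ + T) * m ^ (l′ + T)) * z ≡ w) (w≥1 : 1 ≤ w) (12≤z : 12 ≤ z)
  (w-lower : w * w * 17424 ≤ n) (n-upper : n ≤ w * w * 20449)
  (h≡ : h ≡ 12 * w) (y₀≡ : y₀ ≡ h * (m * (m ^ (l′ + T) * m ^ (l′ + T)))) (N₀≡ : N₀ ≡ n + y₀)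
  (K≡ : K ≡ suc N₀) (D≡ : D ≡ 432 * w)
  where

  m≢0 : NonZero m
  m≢0 = >-nonZero (≤-trans (s≤s z≤n) m≥2)

  a : ℕ → ℕ
  a t = m ^ (l′ + t)

  a-suc : ∀ t → a (suc t) ≡ m * a t
  a-suc t = cong (m ^_) (+-suc l′ t)

  a≥1 : ∀ t → 1 ≤ a t
  a≥1 t = m^n>0 m {{m≢0}} (l′ + t)

  J kT : ℕ
  J  = a (suc T) * a (suc T)
  kT = m * (a T * a T)

  mkT≡J : m * kT ≡ J
  mkT≡J = trans (r m (a T)) (cong (λ z → z * z) (sym (a-suc T)))
    where
    r : ∀ m a → m * (m * (a * a)) ≡ m * a * (m * a)
    r = solve-∀

  y₀≤w² : y₀ ≤ w * w
  y₀≤w² = begin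
    y₀            ≡⟨ trans y₀≡ (cong (_* kT) h≡) ⟩
    12 * w * kT   ≡⟨ r w kT ⟩
    w * (kT * 12) ≤⟨ *-monoʳ-≤ w (*-monoʳ-≤ kT 12≤z) ⟩
    w * (kT * z)  ≡⟨ cong (w *_) w≡ ⟩
    w * w         ∎
    where
    open ≤-Reasoning
    r : ∀ w k → 12 * w * k ≡ w * (k * 12)
    r = solve-∀

  -- From N₀ ≤ (143² + 1) w² = 20450 w² and 2 · 20450 ≤ 216². Hence R = 216 w in `decay`, and D = 2
  -- R = 432 w halves f.
  2N₀≤ : 2 * N₀ ≤ 216 * w * (216 * w)
  2N₀≤ = begin
    2 * N₀                                  ≡⟨ cong (2 *_) N₀≡ ⟩
    2 * (n + y₀)                            ≤⟨ *-monoʳ-≤ 2 (+-mono-≤ n-upper y₀≤w²) ⟩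
    2 * (w * w * 20449 + w * w)             ≡⟨ r (w * w) 20449 ⟩
    w * w * 40900                           ≤⟨ *-monoʳ-≤ (w * w) (m≤m+n 40900 5756) ⟩
    w * w * (216 * 216)                     ≡⟨ sym (square-scale 216 w) ⟩
    216 * w * (216 * w)                     ∎
    where
    open ≤-Reasoning
    r : ∀ x c → 2 * (x * c + x) ≡ x * (2 * (c + 1))
    r = solve-∀

  open Partitions N₀ K K≡
  open Omega N₀ K K≡
  open Counting N₀ K K≡

  half : ∀ y → 2 * f (y + D) ≤ f y
  half y = *-cancelˡ-≤ (216 * w) {{m*n≢0 216 w {{_}} {{>-nonZero w≥1}}}}
    (≤-trans (≤-reflexive (trans (r w (f (y + D))) (cong (_* f (y + D)) (sym D≡)))) (decay (216 * w) 2N₀≤ D y))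
    where
    r : ∀ w x → 216 * w * (2 * x) ≡ 432 * w * x
    r = solve-∀

  D≥1 : 1 ≤ D
  D≥1 = ≤-trans w≥1 (≤-trans (m≤n*m w 432) (≤-reflexive (sym D≡)))

  private
    -- With B = 7 h = 84 w, B² takes 84² = 7056 of the 17424 on the left and leaves 10368. The
    -- coefficient on the right is 7056 + 4 · 432 · 84 + 6 · 432² = 1271952, and the ratio is below
    -- 128.
    cancel-growth : ∀ w x y → w * w * 17424 * x ≤ 12 * w * 7 * (12 * w * 7) * x
      + (12 * w * 7 * (12 * w * 7) + 4 * (432 * w * (12 * w * 7)) + 6 * (432 * w * (432 * w))) * y → 1 ≤ w → x ≤ 128 * y
    cancel-growth w x y hyp w≥1 = *-cancelˡ-≤ (w * w * 10368) {{m*n≢0 (w * w) 10368 {{m*n≢0 w w {{>-nonZero w≥1}} {{>-nonZero w≥1}}}}}}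
      (+-cancelʳ-≤ (w * w * 7056 * x) _ _ (begin
        w * w * 10368 * x + w * w * 7056 * x                      ≡⟨ r₁ (w * w) x 10368 7056 ⟩
        w * w * 17424 * x                                         ≤⟨ hyp ⟩
        12 * w * 7 * (12 * w * 7) * x + (12 * w * 7 * (12 * w * 7) + 4 * (432 * w * (12 * w * 7)) + 6 * (432 * w * (432 * w))) * y
          ≡⟨ cong₂ (λ p q → p * x + q * y) (r₂ w 12 7) (r₃ w 12 7 432 4 6) ⟩
        w * w * 7056 * x + w * w * 1271952 * y                    ≤⟨ +-monoʳ-≤ (w * w * 7056 * x) (*-monoˡ-≤ y (*-monoʳ-≤ (w * w) (m≤m+n 1271952 55152))) ⟩
        w * w * 7056 * x + w * w * (10368 * 128) * y              ≡⟨ r₄ (w * w) x y 7056 10368 128 ⟩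
        w * w * 10368 * (128 * y) + w * w * 7056 * x              ∎))
      where
      open ≤-Reasoning
      r₁ : ∀ v f p q → v * p * f + v * q * f ≡ v * (p + q) * f
      r₁ = solve-∀
      r₂ : ∀ w p q → p * w * q * (p * w * q) ≡ w * w * (p * q * (p * q))
      r₂ = solve-∀
      r₃ : ∀ w p q d s t → p * w * q * (p * w * q) + s * (d * w * (p * w * q)) + t * (d * w * (d * w)) ≡ w * w * (p * q * (p * q) + s * (d * (p * q)) + t * (d * d))
      r₃ = solve-∀
      r₄ : ∀ v x y p q s → v * p * x + v * (q * s) * y ≡ v * q * (s * y) + v * p * x
      r₄ = solve-∀

  grow : ∀ y → y ≤ h * kT → f y ≤ 128 * f (y + h * 7)
  grow y y≤ = cancel-growth w (f y) (f (y + h * 7)) (begin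
    w * w * 17424 * f y
      ≤⟨ *-monoˡ-≤ (f y) (≤-trans w-lower (≤-trans (≤-reflexive (sym (m+n∸n≡m n y₀)))
           (≤-trans (≤-reflexive (cong (_∸ y₀) (sym N₀≡))) (∸-monoʳ-≤ N₀ (≤-trans y≤ (≤-reflexive (sym y₀≡))))))) ⟩
    (N₀ ∸ y) * f y
      ≤⟨ Growth.growth D D≥1 half (h * 7) y ⟩
    h * 7 * (h * 7) * f y + (h * 7 * (h * 7) + 4 * (D * (h * 7)) + 6 * (D * D)) * f (y + h * 7)
      ≡⟨ cong₂ (λ h D → h * 7 * (h * 7) * f y + (h * 7 * (h * 7) + 4 * (D * (h * 7)) + 6 * (D * D)) * x) h≡ D≡ ⟩
    12 * w * 7 * (12 * w * 7) * f y + (12 * w * 7 * (12 * w * 7) + 4 * (432 * w * (12 * w * 7)) + 6 * (432 * w * (432 * w))) * x ∎) w≥1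
    where
    open ≤-Reasoning
    x = f (y + h * 7)

  -- The quotient w / k has to be exact for every test at once. Every k divides kT, so it suffices
  -- that w is a multiple kT z; this is why the root of n is approximated by multiples of 132 kT.
  α : ℕ → ℕ
  α σ = m ^ (T ∸ suc σ) * m ^ (T ∸ suc σ) * z

  k : ℕ → ℕ
  k σ = m * (a (suc σ) * a (suc σ))

  kα≡w : ∀ σ → σ < T → k σ * α σ ≡ w
  kα≡w σ σ<T = trans (trans (r m (a (suc σ)) (m ^ (T ∸ suc σ)) z) (cong (λ x → m * (x * x) * z)
    (trans (sym (^-distribˡ-+-* m (l′ + suc σ) (T ∸ suc σ))) (cong (m ^_) (trans (+-assoc l′ (suc σ) _) (cong (l′ +_) (m+[n∸m]≡n σ<T))))))) w≡
    where
    r : ∀ m a b z → m * (a * a) * (b * b * z) ≡ m * (a * b * (a * b)) * z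
    r = solve-∀

  setting : Setting
  setting = record
    { T = T ; m = m ; m₂ = m₂ ; c = c ; e = e ; w = w ; a = a ; a-suc = a-suc ; a≥1 = a≥1
    ; m≡ = m≡ ; 16≤m₂ = 16≤m₂ ; cm≡4e = cm≡4e ; w≥1 = w≥1 ; c≥1 = c≥1 ; km≡ = km≡ }

  tail : Tail N₀ K K≡
  tail = record
    { D = D ; D≥1 = D≥1 ; half = half ; y₀ = y₀
    ; base = λ y _ → ≤-trans (≤-reflexive (ΣΩ-cong λ cf → *-identityˡ (𝟙 (exactly? y cf))))
        (≤-trans (configurations≤partitions y) (≤-reflexive (sym (*-identityˡ (f y))))) }

  module Sv = Survivors N₀ K K≡ tail setting α kα≡w

  module Ir = Irregular N₀ K K≡ configurations≤partitions h kT grow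

  k≥1 : ∀ σ → 1 ≤ k σ
  k≥1 σ = *-mono-≤ (≤-trans (s≤s z≤n) m≥2) (*-mono-≤ (a≥1 (suc σ)) (a≥1 (suc σ)))

  k≤kT : ∀ σ → σ < T → k σ ≤ kT
  k≤kT σ σ<T = *-monoʳ-≤ m (*-square (^-monoʳ-≤ m {{m≢0}} (+-monoʳ-≤ l′ σ<T)))

  2k≤J : ∀ σ → σ < T → k σ + k σ ≤ J
  2k≤J σ σ<T = begin
    k σ + k σ     ≡⟨ cong (k σ +_) (sym (+-identityʳ (k σ))) ⟩
    2 * k σ       ≤⟨ *-mono-≤ m≥2 (k≤kT σ σ<T) ⟩
    m * kT        ≡⟨ mkT≡J ⟩
    J             ∎
    where open ≤-Reasoning

  sparse : ℕ → Cfg → ℕ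
  sparse σ cf = 𝟙 (Sv.long? cf) * 𝟙 (¬? (Sv.dense? σ cf)) * 𝟙 (exactly? y₀ cf)

  Passes : Cfg → Set
  Passes cf = ¬ (J ≤ length cf) ⊎ Sv.survives (diffs cf) ≡ 1

  passes? : ∀ cf → Dec (Passes cf)
  passes? cf = ¬? (Sv.long? cf) ⊎-dec (Sv.survives (diffs cf) ℕ.≟ 1)

  graphical⇒passes : ∀ cf → Graphical (durfee cf) → Passes cf
  graphical⇒passes cf gr = by-cases (Sv.long? cf)
    where
    by-cases : Dec (J ≤ length cf) → Passes cf
    by-cases (no ¬p) = inj₁ ¬p
    by-cases (yes p) = inj₂ (trans (∏-cong T λ σ σ<T → 𝟙-yes (ℤ.+ 1 ℤ.≤? linear (_⊓ k σ) 0 (diffs cf))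
        (graphical-test cf (k σ) (k≥1 σ) (≤-trans (≤-trans (m≤m+n (k σ) (k σ)) (2k≤J σ σ<T)) p) gr))
      (trans (∏-const T 1) (^-zeroˡ T)))

  S-short S-sparse S-regular : ℕ
  S-short   = ΣΩ (λ cf → 𝟙 (¬? (Sv.long? cf)) * 𝟙 (exactly? y₀ cf))
  S-sparse  = ∑ T (λ σ → ΣΩ (sparse σ))
  S-regular = ΣΩ (λ cf → Sv.regular cf * Sv.survives (diffs cf))

  module _ (Lg : List (List ℕ)) (enum : Enumerates (λ x → IsPartition n x × Graphical x) Lg) where

    graphical≤ : length Lg ≤ S-short + (S-sparse + S-regular)
    graphical≤ = begin
      length Lg
        ≤⟨ graphical≤configurations y₀ n (sym N₀≡) Lg enum passes? graphical⇒passes ⟩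
      ΣΩ (λ cf → 𝟙 (passes? cf) * 𝟙 (exactly? y₀ cf))
        ≤⟨ ΣΩ-mono pointwise ⟩
      ΣΩ (λ cf → 𝟙 (¬? (Sv.long? cf)) * 𝟙 (exactly? y₀ cf) + (∑ T (λ σ → sparse σ cf) + Sv.regular cf * Sv.survives (diffs cf)))
        ≡⟨ trans (ΣΩ-+ _ _) (cong (S-short +_) (trans (ΣΩ-+ _ _) (cong (_+ S-regular) (ΣΩ-∑ T sparse)))) ⟩
      S-short + (S-sparse + S-regular) ∎
      where
      open ≤-Reasoning
      pointwise : ∀ cf → 𝟙 (passes? cf) * 𝟙 (exactly? y₀ cf)
                ≤ 𝟙 (¬? (Sv.long? cf)) * 𝟙 (exactly? y₀ cf) + (∑ T (λ σ → sparse σ cf) + Sv.regular cf * Sv.survives (diffs cf))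
      pointwise cf = by-cases (Sv.long? cf) (Sv.survives (diffs cf) ℕ.≟ 1)
        where
        E = 𝟙 (exactly? y₀ cf)
        by-cases : (p : Dec (J ≤ length cf)) (q : Dec (Sv.survives (diffs cf) ≡ 1)) →
          𝟙 (¬? p ⊎-dec q) * E ≤ 𝟙 (¬? p) * E + (∑ T (λ σ → 𝟙 p * 𝟙 (¬? (Sv.dense? σ cf)) * E) + 𝟙 p * Sv.dense cf * E * Sv.survives (diffs cf))
        by-cases (no _)  _      = m≤m+n _ _
        by-cases (yes _) (no _) = z≤n
        by-cases (yes _) (yes s) = begin
          1 * E
            ≤⟨ *-monoˡ-≤ E (all-or-some T (λ σ → Sv.dense? σ cf)) ⟩
          (Sv.dense cf + ∑ T (λ σ → 𝟙 (¬? (Sv.dense? σ cf)))) * E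
            ≡⟨ trans (*-distribʳ-+ E (Sv.dense cf) _) (+-comm (Sv.dense cf * E) _) ⟩
          ∑ T (λ σ → 𝟙 (¬? (Sv.dense? σ cf))) * E + Sv.dense cf * E
            ≡⟨ cong₂ _+_ (trans (sym (∑-*ʳ T E _)) (∑-cong T λ σ _ → cong (_* E) (sym (+-identityʳ (𝟙 (¬? (Sv.dense? σ cf)))))))
                 (trans (sym (*-identityʳ _)) (cong₂ (λ x y → x * E * y) (sym (+-identityʳ (Sv.dense cf))) (sym s))) ⟩
          ∑ T (λ σ → 1 * 𝟙 (¬? (Sv.dense? σ cf)) * E) + 1 * Sv.dense cf * E * Sv.survives (diffs cf) ∎

  private
    X : ℕ → ℕ
    X t = m * (a t * w) * (m * (a t * w))

    -- In units of (m a_t w)² the squared threshold is 131072² = 2³⁴, while the noise in `JV≡` is 12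
    -- · 432² = 2239488, smaller by a factor above 7000.
    Θ≡ : ∀ t → Sv.Θ t ≡ X t * 17179869184
    Θ≡ t = trans (cong (λ e → e * (a t * w) * (e * (a t * w))) e≡) (r m (a t * w) 131072)
      where
      r : ∀ m y q → m * q * y * (m * q * y) ≡ m * y * (m * y) * (q * q)
      r = solve-∀

    JV≡ : ∀ t → a (suc t) * a (suc t) * Sv.V ≡ X t * 2239488
    JV≡ t = trans (cong₂ (λ b d → b * b * (12 * (d * d))) (a-suc t) D≡) (r m (a t) w 12 432)
      where
      r : ∀ m a w p q → m * a * (m * a) * (p * (q * w * (q * w))) ≡ m * (a * w) * (m * (a * w)) * (p * (q * q))
      r = solve-∀

    -- The ratio is 9 + 2 · 2048 · 2239488 / 2³⁴ ≈ 9.53, below 48/5. Divided by the 16 that each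
    -- test demands, this is the factor 3/5 per test.
    test-ratio : ∀ σ → σ < T → 5 * Sv.Gbound (suc σ) ≤ 48 * Sv.Θ (suc σ)
    test-ratio σ p = begin
      5 * Sv.Gbound (suc σ)                  ≡⟨ cong (5 *_) (Sv.Gbound-test σ p) ⟩
      5 * testCost (Sv.Θ (suc σ)) (J′ + J′)
        ≡⟨ cong (5 *_) (testCost-≡ (Sv.Θ (suc σ)) (J′ + J′)) ⟩
      5 * (9 * Sv.Θ (suc σ) + 2048 * (J′ + J′))
        ≡⟨ cong₂ (λ x y → 5 * (9 * x + 2048 * (y + y))) (Θ≡ (suc σ)) (JV≡ (suc σ)) ⟩
      5 * (9 * (x * 17179869184) + 2048 * (x * 2239488 + x * 2239488))
        ≡⟨ r x 17179869184 2239488 5 9 2048 ⟩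
      x * (5 * (9 * 17179869184 + 2048 * (2239488 + 2239488)))
        ≤⟨ *-monoʳ-≤ x (≤ᵇ⇒≤ 818958827520 824633720832 tt) ⟩
      x * 824633720832                       ≡⟨ sym (r′ x 17179869184 48) ⟩
      48 * (x * 17179869184)                 ≡⟨ cong (48 *_) (sym (Θ≡ (suc σ))) ⟩
      48 * Sv.Θ (suc σ)                      ∎
      where
      open ≤-Reasoning
      x = X (suc σ)
      J′ = a (suc (suc σ)) * a (suc (suc σ)) * Sv.V
      r : ∀ x q v s t u → s * (t * (x * q) + u * (x * v + x * v)) ≡ x * (s * (t * q + u * (v + v)))
      r = solve-∀
      r′ : ∀ x q s → s * (x * q) ≡ x * (s * q)
      r′ = solve-∀

    end-ratio : ∀ t → endCost (Sv.Θ t) (a (suc t) * a (suc t) * Sv.V) ≤ 2 * Sv.Θ t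
    end-ratio t = begin
      endCost (Sv.Θ t) (a (suc t) * a (suc t) * Sv.V)
        ≡⟨ endCost-≡ (Sv.Θ t) (a (suc t) * a (suc t) * Sv.V) ⟩
      Sv.Θ t + 128 * (a (suc t) * a (suc t) * Sv.V)
        ≡⟨ cong₂ (λ x y → x + 128 * y) (Θ≡ t) (JV≡ t) ⟩
      X t * 17179869184 + 128 * (X t * 2239488)   ≡⟨ r (X t) 17179869184 2239488 128 ⟩
      X t * (17179869184 + 128 * 2239488)         ≤⟨ *-monoʳ-≤ (X t) (≤ᵇ⇒≤ 17466523648 34359738368 tt) ⟩
      X t * 34359738368                           ≡⟨ sym (r′ (X t) 17179869184 2) ⟩
      2 * (X t * 17179869184)                     ≡⟨ cong (2 *_) (sym (Θ≡ t)) ⟩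
      2 * Sv.Θ t                                  ∎
      where
      open ≤-Reasoning
      r : ∀ x q v s → x * q + s * (x * v) ≡ x * (q + s * v)
      r = solve-∀
      r′ : ∀ x q s → s * (x * q) ≡ x * (s * q)
      r′ = solve-∀

    ∏-ends : ∀ (g : ℕ → ℕ) → ∏ (suc (suc T)) g ≡ g 0 * (∏ T (λ σ → g (suc σ)) * g (suc T))
    ∏-ends g = cong (g 0 *_) (∏-last T (λ σ → g (suc σ)))

    products : 5 ^ T * ∏ (suc (suc T)) Sv.Gbound ≤ 4 * 48 ^ T * ∏ (suc (suc T)) Sv.Θ
    products = begin
      5 ^ T * ∏ (suc (suc T)) Sv.Gbound
        ≡⟨ cong₂ _*_ (sym (∏-const T 5)) (∏-ends Sv.Gbound) ⟩
      ∏ T (λ _ → 5) * (Sv.Gbound 0 * (∏ T (λ σ → Sv.Gbound (suc σ)) * Sv.Gbound (suc T)))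
        ≡⟨ r (∏ T (λ _ → 5)) (Sv.Gbound 0) (∏ T (λ σ → Sv.Gbound (suc σ))) (Sv.Gbound (suc T)) ⟩
      Sv.Gbound 0 * (∏ T (λ _ → 5) * ∏ T (λ σ → Sv.Gbound (suc σ)) * Sv.Gbound (suc T))
        ≤⟨ *-mono-≤ (end-ratio 0) (*-mono-≤
             (≤-trans (≤-reflexive (sym (∏-* T (λ _ → 5) (λ σ → Sv.Gbound (suc σ))))) (≤-trans (∏-mono T test-ratio) (≤-reflexive (∏-* T (λ _ → 48) (λ σ → Sv.Θ (suc σ))))))
             (≤-trans (≤-reflexive Sv.Gbound-high) (end-ratio (suc T)))) ⟩
      2 * Sv.Θ 0 * (∏ T (λ _ → 48) * ∏ T (λ σ → Sv.Θ (suc σ)) * (2 * Sv.Θ (suc T)))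
        ≡⟨ r′ (Sv.Θ 0) (∏ T (λ _ → 48)) (∏ T (λ σ → Sv.Θ (suc σ))) (Sv.Θ (suc T)) ⟩
      4 * ∏ T (λ _ → 48) * (Sv.Θ 0 * (∏ T (λ σ → Sv.Θ (suc σ)) * Sv.Θ (suc T)))
        ≡⟨ cong₂ (λ x y → 4 * x * y) (∏-const T 48) (sym (∏-ends Sv.Θ)) ⟩
      4 * 48 ^ T * ∏ (suc (suc T)) Sv.Θ ∎
      where
      open ≤-Reasoning
      r : ∀ p g b h → p * (g * (b * h)) ≡ g * (p * b * h)
      r = solve-∀
      r′ : ∀ u p b h → 2 * u * (p * b * (2 * h)) ≡ 4 * p * (u * (b * h))
      r′ = solve-∀

    Θ≥1 : ∀ t → 1 ≤ Sv.Θ t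
    Θ≥1 t = *-mono-≤ ew ew
      where
      ew : 1 ≤ e * (a t * w)
      ew = *-mono-≤ (subst (1 ≤_) (sym e≡) (*-mono-≤ (≤-trans (s≤s z≤n) m≥2) (s≤s (z≤n {131071})))) (*-mono-≤ (a≥1 t) w≥1)

  regular-bound : 5 ^ T * S-regular ≤ 4 * (3 ^ T * f y₀)
  regular-bound = *-cancelˡ-≤ (16 ^ T * Π) {{m*n≢0 (16 ^ T) Π {{m^n≢0 16 T}} {{>-nonZero (∏-≥1 (suc (suc T)) (λ t _ → Θ≥1 t))}}}} (begin
      16 ^ T * Π * (5 ^ T * S-regular)          ≡⟨ r₁ (16 ^ T * Π) (5 ^ T) S-regular ⟩
      5 ^ T * (16 ^ T * Π * S-regular)          ≤⟨ *-monoʳ-≤ (5 ^ T) Sv.survivors ⟩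
      5 ^ T * (∏ (suc (suc T)) Sv.Gbound * f y₀) ≡⟨ sym (*-assoc (5 ^ T) _ (f y₀)) ⟩
      5 ^ T * ∏ (suc (suc T)) Sv.Gbound * f y₀  ≤⟨ *-monoˡ-≤ (f y₀) products ⟩
      4 * 48 ^ T * Π * f y₀                     ≡⟨ cong (λ x → 4 * x * Π * f y₀) (^-distribʳ-* T 16 3) ⟩
      4 * (16 ^ T * 3 ^ T) * Π * f y₀           ≡⟨ r₂ (16 ^ T) (3 ^ T) Π (f y₀) ⟩
      16 ^ T * Π * (4 * (3 ^ T * f y₀))         ∎)
    where
    open ≤-Reasoning
    Π = ∏ (suc (suc T)) Sv.Θ
    r₁ : ∀ p q s → p * (q * s) ≡ q * (p * s)
    r₁ = solve-∀
    r₂ : ∀ x y p f → 4 * (x * y) * p * f ≡ x * p * (4 * (y * f))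
    r₂ = solve-∀

  private
    f-power : ∀ j y → 2 ^ j * f (y + j * D) ≤ f y
    f-power zero    y = ≤-reflexive (trans (+-identityʳ _) (cong f (+-identityʳ y)))
    f-power (suc j) y = begin
      2 * 2 ^ j * f (y + (D + j * D))     ≡⟨ r (2 ^ j) _ ⟩
      2 * (2 ^ j * f (y + (D + j * D)))   ≡⟨ cong (λ x → 2 * (2 ^ j * f x)) (sym (+-assoc y D (j * D))) ⟩
      2 * (2 ^ j * f (y + D + j * D))     ≤⟨ *-monoʳ-≤ 2 (f-power j (y + D)) ⟩
      2 * f (y + D)                       ≤⟨ half y ⟩
      f y                                 ∎
      where
      open ≤-Reasoning
      r : ∀ p x → 2 * p * x ≡ 2 * (p * x)
      r = solve-∀

    f-N₀ : 1 ≤ f N₀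
    f-N₀ = ≤-trans (≤-reflexive (sym (cong₂ _*_ (zeros-plain N₀) (𝟙-yes (total? N₀ (replicate N₀ (0 , 0))) (cong (_+ N₀) (zeros-weight 0 N₀))))))
      (sumP-zeros K N₀ (plain N₀) (subst (1 ≤_) (sym K≡) (s≤s z≤n)))

    -- Since n ≥ 132² w², w steps of length D = 432 w fit between y₀ and N₀, and f at least doubles
    -- with each of them, from the value f N₀ ≥ 1.
    f-large : 2 ^ w ≤ f y₀
    f-large = ≤-trans (≤-reflexive (sym (*-identityʳ (2 ^ w)))) (≤-trans (*-monoʳ-≤ (2 ^ w) (≤-trans f-N₀ (f-anti (begin
      y₀ + w * D           ≡⟨ cong (λ d → y₀ + w * d) D≡ ⟩
      y₀ + w * (432 * w)   ≡⟨ cong (y₀ +_) (r w 432) ⟩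
      y₀ + w * w * 432     ≤⟨ +-monoʳ-≤ y₀ (≤-trans (*-monoʳ-≤ (w * w) (m≤m+n 432 16992)) w-lower) ⟩
      y₀ + n               ≡⟨ trans (+-comm y₀ n) (sym N₀≡) ⟩
      N₀                   ∎)))) (f-power w y₀))
      where
      open ≤-Reasoning
      r : ∀ w p → w * (p * w) ≡ w * w * p
      r = solve-∀

    5≤6 : 5 ^ T ≤ 2 ^ T * 3 ^ T
    5≤6 = ≤-trans (^-monoˡ-≤ T (m≤m+n 5 1)) (≤-reflexive (^-distribʳ-* T 2 3))

    -- As 5 ≤ 2 · 3, an exceptional set of share 2^(-T) is within the allowance (3/5)^T.
    absorb : ∀ S → 2 ^ T * S ≤ f y₀ → 5 ^ T * S ≤ 3 ^ T * f y₀
    absorb S h = begin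
      5 ^ T * S              ≤⟨ *-monoˡ-≤ S 5≤6 ⟩
      2 ^ T * 3 ^ T * S      ≡⟨ r (2 ^ T) (3 ^ T) S ⟩
      3 ^ T * (2 ^ T * S)    ≤⟨ *-monoʳ-≤ (3 ^ T) h ⟩
      3 ^ T * f y₀           ∎
      where
      open ≤-Reasoning
      r : ∀ p q s → p * q * s ≡ q * (p * s)
      r = solve-∀

    n≤2^n : ∀ n → n ≤ 2 ^ n
    n≤2^n n = ≤-trans (n≤1+n n) (suc≤^ 2 ≤-refl n)

  module _ (κ : ℕ) (K≤ : K ≤ 2 ^ κ) (T≥1 : 1 ≤ T) (z≥ : m * (T + 1 + (κ + κ)) ≤ z) (κ≤ : 8 * (T + T + (7 + κ)) ≤ m * suc l′) where

    -- The crude count has at most J (1 + 2 κ) bits, against the w = kT z bits of `f-large`. As J =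
    -- m kT, the comparison reduces to m (T + 1 + 2 κ) ≤ z.
    short-bound : 5 ^ T * S-short ≤ 3 ^ T * f y₀
    short-bound = absorb S-short (begin
      2 ^ T * S-short
        ≤⟨ *-monoʳ-≤ (2 ^ T) (subst (λ y → ΣΩ (λ cf → 𝟙 (¬? (Sv.long? cf)) * 𝟙 (exactly? y cf)) ≤ J * (K * K) ^ J) (sym y₀≡) (Ir.short J)) ⟩
      2 ^ T * (J * (K * K) ^ J)
        ≤⟨ *-monoʳ-≤ (2 ^ T) (*-mono-≤ (n≤2^n J) (^-monoˡ-≤ J (*-mono-≤ K≤ K≤))) ⟩
      2 ^ T * (2 ^ J * (2 ^ κ * 2 ^ κ) ^ J)
        ≡⟨ cong (λ x → 2 ^ T * (2 ^ J * x)) (trans (cong (_^ J) (sym (^-distribˡ-+-* 2 κ κ))) (^-*-assoc 2 (κ + κ) J)) ⟩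
      2 ^ T * (2 ^ J * 2 ^ ((κ + κ) * J))
        ≡⟨ trans (cong (2 ^ T *_) (sym (^-distribˡ-+-* 2 J ((κ + κ) * J)))) (sym (^-distribˡ-+-* 2 T (J + (κ + κ) * J))) ⟩
      2 ^ (T + (J + (κ + κ) * J))
        ≤⟨ ^-monoʳ-≤ 2 exponent ⟩
      2 ^ w
        ≤⟨ f-large ⟩
      f y₀ ∎)
      where
      open ≤-Reasoning
      J≥1 : 1 ≤ J
      J≥1 = *-mono-≤ (a≥1 (suc T)) (a≥1 (suc T))
      exponent : T + (J + (κ + κ) * J) ≤ w
      exponent = *-cancelˡ-≤ m {{m≢0}} (begin
        m * (T + (J + (κ + κ) * J))         ≤⟨ *-monoʳ-≤ m (+-monoˡ-≤ _ (m≤n*m T J {{>-nonZero J≥1}})) ⟩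
        m * (J * T + (J + (κ + κ) * J))     ≡⟨ r m J T (κ + κ) ⟩
        J * (m * (T + 1 + (κ + κ)))         ≤⟨ *-monoʳ-≤ J z≥ ⟩
        J * z                               ≡⟨ trans (cong (_* z) (sym mkT≡J)) (*-assoc m kT z) ⟩
        m * (kT * z)                        ≡⟨ cong (m *_) w≡ ⟩
        m * w                               ∎)
        where
        r : ∀ m J T κ → m * (J * T + (J + κ * J)) ≡ J * (m * (T + 1 + κ))
        r = solve-∀

    -- Every test has an exceptional share of at most 128 K / 2^k₈, and T of these must stay below
    -- 2^(-T); so k₈ ≥ 2 T + 7 + κ is required even of the smallest test. Therefore a_t starts at
    -- m^l′ and not at 1: already the first scale is then large against log n.
    sparse-bound : 5 ^ T * S-sparse ≤ 3 ^ T * f y₀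
    sparse-bound = absorb S-sparse (*-cancelˡ-≤ T {{>-nonZero T≥1}} (begin
      T * (2 ^ T * S-sparse)
        ≡⟨ trans (sym (*-assoc T (2 ^ T) S-sparse)) (sym (∑-*ˡ T (T * 2 ^ T) (λ σ → ΣΩ (sparse σ)))) ⟩
      ∑ T (λ σ → T * 2 ^ T * ΣΩ (sparse σ))
        ≤⟨ ∑-mono T one ⟩
      ∑ T (λ _ → f y₀)
        ≡⟨ ∑-const T (f y₀) ⟩
      T * f y₀ ∎))
      where
      open ≤-Reasoning
      k₈ : ℕ → ℕ
      k₈ σ = 512 * (c * c) * (a (suc σ) * a (suc σ))
      m8 : m ≡ 8 * (512 * (c * c))
      m8 = trans (sym (*-identityʳ m)) (trans km≡ (r c))
        where
        r : ∀ c → 4 * ((32 * c) * (32 * c)) ≡ 8 * (512 * (c * c))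
        r = solve-∀
      k≡ : ∀ σ → k σ ≡ 8 * k₈ σ
      k≡ σ = trans (cong (_* (a (suc σ) * a (suc σ))) m8) (*-assoc 8 (512 * (c * c)) _)
      l≤a : ∀ σ → suc l′ ≤ a (suc σ) * a (suc σ)
      l≤a σ = ≤-trans (suc≤^ m m≥2 l′) (≤-trans (^-monoʳ-≤ m {{m≢0}} (m≤m+n l′ (suc σ))) (m≤m*n (a (suc σ)) (a (suc σ)) {{>-nonZero (a≥1 (suc σ))}}))
      k₈≥ : ∀ σ → T + T + (7 + κ) ≤ k₈ σ
      k₈≥ σ = *-cancelˡ-≤ 8 (≤-trans κ≤ (≤-trans (*-monoʳ-≤ m (l≤a σ)) (≤-reflexive (k≡ σ))))
      window-ok : ∀ σ → σ < T → 2 * k σ * (6 * α σ) ≤ h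
      window-ok σ p = ≤-reflexive (trans (r (k σ) (α σ)) (trans (cong (12 *_) (kα≡w σ p)) (sym h≡)))
        where
        r : ∀ k α → 2 * k * (6 * α) ≡ 12 * (k * α)
        r = solve-∀
      one : ∀ σ → σ < T → T * 2 ^ T * ΣΩ (sparse σ) ≤ f y₀
      one σ p = *-cancelˡ-≤ (128 * 2 ^ κ) {{m*n≢0 128 (2 ^ κ) {{_}} {{m^n≢0 2 κ}}}} (begin
        128 * 2 ^ κ * (T * 2 ^ T * S)          ≡⟨ r 128 (2 ^ κ) T (2 ^ T) S ⟩
        T * 2 ^ T * (128 * 2 ^ κ) * S          ≤⟨ *-monoˡ-≤ S (*-monoˡ-≤ (128 * 2 ^ κ) (*-monoˡ-≤ (2 ^ T) (n≤2^n T))) ⟩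
        2 ^ T * 2 ^ T * (2 ^ 7 * 2 ^ κ) * S    ≡⟨ cong (_* S) (trans (cong₂ _*_ (sym (^-distribˡ-+-* 2 T T)) (sym (^-distribˡ-+-* 2 7 κ))) (sym (^-distribˡ-+-* 2 (T + T) (7 + κ)))) ⟩
        2 ^ (T + T + (7 + κ)) * S              ≤⟨ *-monoˡ-≤ S (^-monoʳ-≤ 2 (k₈≥ σ)) ⟩
        2 ^ k₈ σ * S
          ≤⟨ subst (λ y → 2 ^ k₈ σ * ΣΩ (λ cf → 𝟙 (Sv.long? cf) * 𝟙 (¬? (Sv.dense? σ cf)) * 𝟙 (exactly? y cf)) ≤ 128 * (K * f y)) (sym y₀≡)
               (Ir.irregular J (k σ) (k₈ σ) (α σ) (k≡ σ) (window-ok σ p) (k≤kT σ p) (2k≤J σ p)) ⟩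
        128 * (K * f y₀)                       ≤⟨ *-monoʳ-≤ 128 (*-monoˡ-≤ (f y₀) K≤) ⟩
        128 * (2 ^ κ * f y₀)                   ≡⟨ sym (*-assoc 128 (2 ^ κ) (f y₀)) ⟩
        128 * 2 ^ κ * f y₀                     ∎)
        where
        S = ΣΩ (sparse σ)
        r : ∀ q p t u s → q * p * (t * u * s) ≡ t * u * (q * p) * s
        r = solve-∀

    graphical-fraction : ∀ Lg Lp → Enumerates (λ x → IsPartition n x × Graphical x) Lg → Enumerates (IsPartition n) Lp →
      5 ^ T * length Lg ≤ 6 * (3 ^ T * length Lp)
    graphical-fraction Lg Lp enumG enumP = begin
      5 ^ T * length Lg
        ≤⟨ *-monoʳ-≤ (5 ^ T) (graphical≤ Lg enumG) ⟩
      5 ^ T * (S-short + (S-sparse + S-regular))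
        ≡⟨ r (5 ^ T) S-short S-sparse S-regular ⟩
      5 ^ T * S-short + (5 ^ T * S-sparse + 5 ^ T * S-regular)
        ≤⟨ +-mono-≤ short-bound (+-mono-≤ sparse-bound regular-bound) ⟩
      3 ^ T * f y₀ + (3 ^ T * f y₀ + 4 * (3 ^ T * f y₀))
        ≡⟨ r′ (3 ^ T * f y₀) ⟩
      6 * (3 ^ T * f y₀)
        ≤⟨ *-monoʳ-≤ 6 (*-monoʳ-≤ (3 ^ T) (partitions≤enumeration y₀ n (sym N₀≡) Lp enumP)) ⟩
      6 * (3 ^ T * length Lp) ∎
      where
      open ≤-Reasoning
      r : ∀ p x y z → p * (x + (y + z)) ≡ p * x + (p * y + p * z)
      r = solve-∀
      r′ : ∀ x → x + (x + 4 * x) ≡ 6 * x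
      r′ = solve-∀

-- 2⁵ 3⁷ < 5⁷ and 4100 · 33 · 7 < 5 · 190000.
exponent-gap : ∀ E N D → D ≡ E * 10000 → N ≤ E * 33 → 2 ^ (N * 4100) * 3 ^ (D * 19) ≤ 5 ^ (D * 19)
exponent-gap E N D refl N≤ = begin
  2 ^ (N * 4100) * 3 ^ (E * 10000 * 19)
    ≤⟨ *-mono-≤ (^-monoʳ-≤ 2 bits) (≤-reflexive (cong (3 ^_) split)) ⟩
  2 ^ (5 * x) * 3 ^ (7 * x + E * 6)
    ≡⟨ cong (2 ^ (5 * x) *_) (^-distribˡ-+-* 3 (7 * x) (E * 6)) ⟩
  2 ^ (5 * x) * (3 ^ (7 * x) * 3 ^ (E * 6))
    ≡⟨ sym (*-assoc (2 ^ (5 * x)) _ _) ⟩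
  2 ^ (5 * x) * 3 ^ (7 * x) * 3 ^ (E * 6)
    ≡⟨ cong (_* 3 ^ (E * 6)) (trans (cong₂ _*_ (sym (^-*-assoc 2 5 x)) (sym (^-*-assoc 3 7 x))) (sym (^-distribʳ-* x 32 2187))) ⟩
  69984 ^ x * 3 ^ (E * 6)
    ≤⟨ *-mono-≤ (^-monoˡ-≤ x (≤ᵇ⇒≤ 69984 78125 tt)) (^-monoˡ-≤ (E * 6) (m≤m+n 3 2)) ⟩
  78125 ^ x * 5 ^ (E * 6)
    ≡⟨ cong (_* 5 ^ (E * 6)) (^-*-assoc 5 7 x) ⟩
  5 ^ (7 * x) * 5 ^ (E * 6)
    ≡⟨ sym (^-distribˡ-+-* 5 (7 * x) (E * 6)) ⟩
  5 ^ (7 * x + E * 6)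
    ≡⟨ cong (5 ^_) (sym split) ⟩
  5 ^ (E * 10000 * 19) ∎
  where
  open ≤-Reasoning
  x = E * 27142
  split : E * 10000 * 19 ≡ 7 * x + E * 6
  split = trans (*-assoc E 10000 19) (sym (trans (cong (_+ E * 6) (trans (*-comm 7 x) (*-assoc E 27142 7))) (sym (*-distribˡ-+ E 189994 6))))
  bits : N * 4100 ≤ 5 * x
  bits = begin
    N * 4100          ≤⟨ *-monoˡ-≤ 4100 N≤ ⟩
    E * 33 * 4100     ≡⟨ *-assoc E 33 4100 ⟩
    E * 135300        ≤⟨ *-monoʳ-≤ E (≤ᵇ⇒≤ 135300 135710 tt) ⟩
    E * 135710        ≡⟨ sym (*-assoc E 27142 5) ⟩
    E * 27142 * 5     ≡⟨ *-comm x 5 ⟩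
    5 * x             ∎

-- From the decay per test to a power of n.

module _ (Q N D : ℕ) (Q≥1 : 1 ≤ Q) (N≤D : N ≤ D) (gap : Q ^ N * 3 ^ (D * 19) ≤ 5 ^ (D * 19)) where

  -- Here n^N ≤ (Q^N)^(l + 1). By `gap`, l of these factors are absorbed by (3/5)^(19 l D); the last
  -- one, Q^N ≤ Q^D, goes into the constant 6 Q.
  raise-fraction : ∀ l n G P → n ≤ Q ^ suc l → 5 ^ (19 * l) * G ≤ 6 * (3 ^ (19 * l) * P) →
    G ^ D * n ^ N ≤ (6 * Q) ^ D * P ^ D
  raise-fraction l n G P n≤ h = *-cancelˡ-≤ F {{m^n≢0 (5 ^ (D * 19)) l {{m^n≢0 5 (D * 19)}}}} (begin
    F * (G ^ D * n ^ N)                        ≡⟨ sym (*-assoc F (G ^ D) (n ^ N)) ⟩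
    F * G ^ D * n ^ N                          ≡⟨ cong (_* n ^ N) (trans (cong (_* G ^ D) (turn 5)) (sym (^-distribʳ-* D (5 ^ (19 * l)) G))) ⟩
    (5 ^ (19 * l) * G) ^ D * n ^ N             ≤⟨ *-mono-≤ (^-monoˡ-≤ D h) (^-monoˡ-≤ N n≤) ⟩
    (6 * (3 ^ (19 * l) * P)) ^ D * (Q ^ suc l) ^ N
      ≡⟨ cong₂ _*_ (trans (^-distribʳ-* D 6 (3 ^ (19 * l) * P)) (cong (6 ^ D *_) (trans (^-distribʳ-* D (3 ^ (19 * l)) P) (cong (_* P ^ D) (sym (turn 3))))))
           (trans (^-*-assoc Q (suc l) N) (trans (cong (Q ^_) (*-comm (suc l) N)) (sym (^-*-assoc Q N (suc l))))) ⟩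
    6 ^ D * ((3 ^ (D * 19)) ^ l * P ^ D) * (Q ^ N * (Q ^ N) ^ l)
      ≡⟨ r (6 ^ D) ((3 ^ (D * 19)) ^ l) (P ^ D) (Q ^ N) ((Q ^ N) ^ l) ⟩
    (Q ^ N) ^ l * (3 ^ (D * 19)) ^ l * (6 ^ D * Q ^ N * P ^ D)
      ≤⟨ *-mono-≤ (≤-trans (≤-reflexive (sym (^-distribʳ-* l (Q ^ N) (3 ^ (D * 19))))) (^-monoˡ-≤ l gap))
           (*-monoˡ-≤ (P ^ D) (*-monoʳ-≤ (6 ^ D) (^-monoʳ-≤ Q {{>-nonZero Q≥1}} N≤D))) ⟩
    F * (6 ^ D * Q ^ D * P ^ D)                ≡⟨ cong (λ x → F * (x * P ^ D)) (sym (^-distribʳ-* D 6 Q)) ⟩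
    F * ((6 * Q) ^ D * P ^ D)                  ∎)
    where
    open ≤-Reasoning
    F = (5 ^ (D * 19)) ^ l
    turn : ∀ b → (b ^ (D * 19)) ^ l ≡ (b ^ (19 * l)) ^ D
    turn b = trans (^-*-assoc b (D * 19) l) (trans (cong (b ^_) (trans (*-assoc D 19 l) (*-comm D (19 * l)))) (sym (^-*-assoc b (19 * l) D)))
    r : ∀ s t p q u → s * (t * p) * (q * u) ≡ u * t * (s * q * p)
    r = solve-∀

module Assembly
  (m m₂ c e : ℕ) (m≡ : m ≡ 2 * m₂) (16≤m₂ : 16 ≤ m₂) (cm≡4e : c * m ≡ 4 * e)
  (km≡ : m * 1 ≡ 4 * ((32 * c) * (32 * c))) (c≥1 : 1 ≤ c) (e≡ : e ≡ m * 131072)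
  (m-large : 2178000 ≤ m) (m≤ : m ≤ 2 ^ 50)
  where

  private
    m≥2 : 2 ≤ m
    m≥2 = ≤-trans (≤ᵇ⇒≤ 2 2178000 tt) m-large

    m≢0 : NonZero m
    m≢0 = >-nonZero (≤-trans (s≤s z≤n) m≥2)

  -- The last boundary is J = m^(2 (l′ + T + 1)) = m^(40 (l′ + 1)) for T = 19 (l′ + 1). A margin of
  -- m^(l′ + 1) between J and √n keeps z large, so √n ≥ m^(41 (l′ + 1)) is required, and this
  -- explains the 82.
  fraction : ∀ l′ n → m ^ (82 * suc l′) ≤ n → n < m ^ (82 * suc (suc l′)) →
    ∀ Lg Lp → Enumerates (λ x → IsPartition n x × Graphical x) Lg → Enumerates (IsPartition n) Lp →
    5 ^ (19 * suc l′) * length Lg ≤ 6 * (3 ^ (19 * suc l′) * length Lp)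
  fraction l′ n n≥ n< Lg Lp enumG enumP =
      with-root (19 * suc l′) refl (scaled-root (132 * kT (19 * suc l′)) (*-mono-≤ (s≤s (z≤n {131})) (kT≥1 (19 * suc l′))) n)
    where
    a : ℕ → ℕ
    a t = m ^ (l′ + t)
    kT J : ℕ → ℕ
    kT T = m * (a T * a T)
    J T = a (suc T) * a (suc T)
    kT≥1 : ∀ T → 1 ≤ kT T
    kT≥1 T = *-mono-≤ (≤-trans (s≤s z≤n) m≥2) (*-mono-≤ (m^n>0 m {{m≢0}} (l′ + T)) (m^n>0 m {{m≢0}} (l′ + T)))
    J≥1 : ∀ T → 1 ≤ J T
    J≥1 T = *-mono-≤ (m^n>0 m {{m≢0}} (l′ + suc T)) (m^n>0 m {{m≢0}} (l′ + suc T))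
    mkT≡J : ∀ T → m * kT T ≡ J T
    mkT≡J T = trans (r m (a T)) (cong (λ z → z * z) (sym (cong (m ^_) (+-suc l′ T))))
      where
      r : ∀ m a → m * (m * (a * a)) ≡ m * a * (m * a)
      r = solve-∀
    root≤ : ∀ T → T ≡ 19 * suc l′ → J T * m ^ suc l′ * (J T * m ^ suc l′) ≤ n
    root≤ T T≡ = ≤-trans (≤-reflexive (begin
      J T * m ^ suc l′ * (J T * m ^ suc l′)
        ≡⟨ cong (λ z → z * m ^ suc l′ * (z * m ^ suc l′)) (sym (^-distribˡ-+-* m x x)) ⟩
      m ^ (x + x) * m ^ suc l′ * (m ^ (x + x) * m ^ suc l′)
        ≡⟨ cong (λ z → z * z) (sym (^-distribˡ-+-* m (x + x) (suc l′))) ⟩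
      m ^ (x + x + suc l′) * m ^ (x + x + suc l′)
        ≡⟨ sym (^-distribˡ-+-* m (x + x + suc l′) (x + x + suc l′)) ⟩
      m ^ ((x + x + suc l′) + (x + x + suc l′))
        ≡⟨ cong (m ^_) (trans (cong (λ T → (l′ + suc T + (l′ + suc T) + suc l′) + (l′ + suc T + (l′ + suc T) + suc l′)) T≡) (r l′)) ⟩
      m ^ (82 * suc l′) ∎)) n≥
      where
      open ≡-Reasoning
      x = l′ + suc T
      r : ∀ l → (l + suc (19 * suc l) + (l + suc (19 * suc l)) + suc l) + (l + suc (19 * suc l) + (l + suc (19 * suc l)) + suc l) ≡ 82 * suc l
      r = solve-∀
    X : ℕ
    X = 2 ^ (50 * (82 * suc (suc l′)))
    n<X : n < X
    n<X = ≤-trans n< (≤-trans (^-monoˡ-≤ (82 * suc (suc l′)) m≤) (≤-reflexive (^-*-assoc 2 50 (82 * suc (suc l′)))))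

    with-root : ∀ T → T ≡ 19 * suc l′ → (∃ λ z → 132 * kT T * z * (132 * kT T * z) ≤ n × n < 132 * kT T * suc z * (132 * kT T * suc z)) →
      5 ^ T * length Lg ≤ 6 * (3 ^ T * length Lp)
    with-root T T≡ (z , lower , upper) = Core.graphical-fraction m m₂ c e m≡ 16≤m₂ cm≡4e km≡ c≥1 e≡ m≥2
        l′ T n z w (12 * w) (12 * w * kT T) (n + 12 * w * kT T) (suc (n + 12 * w * kT T)) (432 * w)
        refl w≥1 12≤z w-lower (root-upper (kT T) z n 12≤z upper) refl refl refl refl refl
        κ K≤ T≥1 z≥ κ≤ Lg Lp enumG enumP
      where
      open ≤-Reasoning
      w κ : ℕ
      w = kT T * z
      κ = suc (50 * (82 * suc (suc l′)))
      -- From J m^(l′ + 1) ≤ √n < 132 kT (z + 1), cancelling J = m kT.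
      z-bound : m * m ^ suc l′ < 132 * suc z
      z-bound = *-cancelˡ-< (J T) _ _ (begin-strict
        J T * (m * m ^ suc l′)       ≡⟨ r₁ (J T) m (m ^ suc l′) ⟩
        m * (J T * m ^ suc l′)       <⟨ *-monoʳ-< m {{m≢0}} (square-cancel-< {J T * m ^ suc l′} {132 * kT T * suc z} (≤-<-trans (root≤ T T≡) upper)) ⟩
        m * (132 * kT T * suc z)     ≡⟨ r₂ m (kT T) (suc z) ⟩
        m * kT T * (132 * suc z)     ≡⟨ cong (_* (132 * suc z)) (mkT≡J T) ⟩
        J T * (132 * suc z)          ∎)
        where
        r₁ : ∀ J m x → J * (m * x) ≡ m * (J * x)
        r₁ = solve-∀
        r₂ : ∀ m k z → m * (132 * k * z) ≡ m * k * (132 * z)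
        r₂ = solve-∀
      zl : m * suc l′ * 16500 ≤ z
      zl = z-large m (suc l′) (m ^ suc l′) z z-bound (*-monoʳ-≤ m (suc≤^ m m≥2 l′)) m-large
      12≤z : 12 ≤ z
      12≤z = ≤-trans (≤-trans (≤ᵇ⇒≤ 12 16500 tt) (m≤n*m 16500 (m * suc l′) {{m*n≢0 m (suc l′) {{m≢0}}}})) zl
      w≥1 : 1 ≤ w
      w≥1 = *-mono-≤ (kT≥1 T) (≤-trans (s≤s z≤n) 12≤z)
      w-lower : w * w * 17424 ≤ n
      w-lower = root-lower (kT T) z n lower
      T≥1 : 1 ≤ T
      T≥1 = subst (1 ≤_) (sym T≡) (s≤s z≤n)
      y₀≤n : 12 * w * kT T ≤ n
      y₀≤n = begin
        12 * w * kT T        ≡⟨ r w (kT T) ⟩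
        w * (kT T * 12)      ≤⟨ *-monoʳ-≤ w (*-monoʳ-≤ (kT T) 12≤z) ⟩
        w * w                ≤⟨ m≤m*n (w * w) 17424 ⟩
        w * w * 17424        ≤⟨ w-lower ⟩
        n                    ∎
        where
        r : ∀ w k → 12 * w * k ≡ w * (k * 12)
        r = solve-∀
      K≤ : suc (n + 12 * w * kT T) ≤ 2 ^ κ
      K≤ = +-mono-≤ n<X (≤-trans y₀≤n (≤-trans (<⇒≤ n<X) (≤-reflexive (sym (+-identityʳ X)))))
      -- T + 1 + 2 κ is 16422 at l′ = 0 and grows by 8219 with each unit of l′, so 16500 (l′ + 1) is
      -- enough.
      z≥ : m * (T + 1 + (κ + κ)) ≤ z
      z≥ = ≤-trans (*-monoʳ-≤ m (subst (λ T → T + 1 + (κ + κ) ≤ suc l′ * 16500) (sym T≡) (≤-by (78 + l′ * 8281) (r l′))))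
             (≤-trans (≤-reflexive (sym (*-assoc m (suc l′) 16500))) zl)
        where
        r : ∀ l → suc l * 16500 ≡ 19 * suc l + 1 + (suc (50 * (82 * suc (suc l))) + suc (50 * (82 * suc (suc l)))) + (78 + l * 8281)
        r = solve-∀
      κ≤ : 8 * (T + T + (7 + κ)) ≤ m * suc l′
      κ≤ = ≤-trans (subst (λ T → 8 * (T + T + (7 + κ)) ≤ suc l′ * 65968) (sym T≡) (≤-by (l′ * 32864) (r l′)))
             (≤-trans (*-monoʳ-≤ (suc l′) (≤-trans (≤ᵇ⇒≤ 65968 2178000 tt) m-large)) (≤-reflexive (*-comm (suc l′) m)))
        where
        r : ∀ l → suc l * 65968 ≡ 8 * (19 * suc l + 19 * suc l + (7 + suc (50 * (82 * suc (suc l))))) + l * 32864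
        r = solve-∀

  bound-power : ∀ Q E N D → m ^ 82 ≤ Q → D ≡ E * 10000 → N ≤ E * 33 → Q ^ N ≤ 2 ^ (N * 4100) →
    ∀ n → n ≥ 1 → ∀ Lg Lp → Enumerates (λ x → IsPartition n x × Graphical x) Lg → Enumerates (IsPartition n) Lp →
    length Lg ^ D * n ^ N ≤ (6 * Q) ^ D * length Lp ^ D
  bound-power Q E N D m≤Q D≡ N≤ Q≤ n n≥1 Lg Lp enumG enumP = by-scale (scaled-log (m ^ 82) m⁸²≥2 n n≥1)
    where
    m⁸²≥2 : 2 ≤ m ^ 82
    m⁸²≥2 = ≤-trans m≥2 (≤-trans (≤-reflexive (sym (^-identityʳ m))) (^-monoʳ-≤ m {{m≢0}} (s≤s (z≤n {81}))))
    Q≥1 : 1 ≤ Q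
    Q≥1 = ≤-trans (≤-trans (s≤s z≤n) m⁸²≥2) m≤Q
    N≤D : N ≤ D
    N≤D = ≤-trans N≤ (≤-trans (*-monoʳ-≤ E (≤ᵇ⇒≤ 33 10000 tt)) (≤-reflexive (sym D≡)))
    gap : Q ^ N * 3 ^ (D * 19) ≤ 5 ^ (D * 19)
    gap = ≤-trans (*-monoˡ-≤ (3 ^ (D * 19)) Q≤) (exponent-gap E N D D≡ N≤)
    Lg≤Lp : length Lg ≤ length Lp
    Lg≤Lp = pigeonhole _≡_ Lg Lp (proj₁ enumG)
      (λ {x} x∈ → x , Equivalence.from (proj₂ enumP x) (proj₁ (Equivalence.to (proj₂ enumG x) x∈)) , refl) (λ p q → trans p (sym q))
    n-upper : ∀ l → n < (m ^ 82) ^ suc l → n ≤ Q ^ suc l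
    n-upper l h = ≤-trans (<⇒≤ h) (^-monoˡ-≤ (suc l) m≤Q)
    by-scale : (∃ λ l → (m ^ 82) ^ l ≤ n × n < (m ^ 82) ^ suc l) → length Lg ^ D * n ^ N ≤ (6 * Q) ^ D * length Lp ^ D
    -- Below m^82 no test fits, and the trivial bound of the fraction by 1 is used with l = 0; the
    -- constant covers n^N.
    by-scale (zero , _ , upper) = raise-fraction Q N D Q≥1 N≤D gap 0 n (length Lg) (length Lp) (n-upper 0 upper)
      (≤-trans (≤-reflexive (*-identityˡ (length Lg))) (≤-trans Lg≤Lp
        (≤-trans (≤-reflexive (sym (*-identityˡ (length Lp)))) (m≤n*m (1 * length Lp) 6))))
    by-scale (suc l′ , lower , upper) = raise-fraction Q N D Q≥1 N≤D gap (suc l′) n (length Lg) (length Lp) (n-upper (suc l′) upper)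
      (fraction l′ n (≤-trans (≤-reflexive (sym (^-*-assoc m 82 (suc l′)))) lower)
        (≤-trans upper (≤-reflexive (^-*-assoc m 82 (suc (suc l′))))) Lg Lp enumG enumP)

theorem1p2 : Σ ℕ λ C → (0 < C) × ((n : ℕ) → n ≥ 1 →
    (Lg Lp : List (List ℕ)) →
    Enumerates (λ x → IsPartition n x × Graphical x) Lg →
    Enumerates (IsPartition n) Lp →
    length Lg ^ expDen * n ^ expNum ≤ C ^ expDen * length Lp ^ expDen)
theorem1p2 = 6 * 2 ^ 4100 , *-mono-≤ (s≤s (z≤n {5})) (m^n>0 2 4100) ,
  -- 2⁵⁰, 2⁴⁹, 2¹⁹ and 2⁶⁷.
  Assembly.bound-power 1125899906842624 562949953421312 524288 147573952589676412928
    refl (≤ᵇ⇒≤ 16 562949953421312 tt) refl refl (s≤s z≤n) refl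
    (≤ᵇ⇒≤ 2178000 1125899906842624 tt) ≤-refl
    (2 ^ 4100) 100000000 expNum expDen
    (≤-reflexive (^-*-assoc 2 50 82)) refl (≤ᵇ⇒≤ 3297210314 3300000000 tt) (base expNum)
  where
  base : ∀ N → (2 ^ 4100) ^ N ≤ 2 ^ (N * 4100)
  base N = ≤-reflexive (trans (^-*-assoc 2 4100 N) (cong (2 ^_) (*-comm 4100 N)))
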